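{- Let $\mathbb{S}$ be any surface (orientable or non-orientable) and let $n\geq 1$ be an integer. There exists a bijection between the set of rooted bipartite quadrangulations on $\mathbb{S}$ with $n$ faces and the set of rooted well-labeled unicellular maps on $\mathbb{S}$ with $n$ edges, with the following property. For a rooted bipartite quadrangulation $\mathfrak{q}$ with root vertex $v_0$, let $N_i$ denote the set of vertices of $\mathfrak{q}$ at graph distance $i$ from $v_0$, and $E(N_i,N_{i-1})$ the set of edges of $\mathfrak{q}$ joining a vertex of $N_i$ to a vertex of $N_{i-1}$. Then, for every $i\geq 1$, the well-labeled unicellular map associated with $\mathfrak{q}$ has exactly $|N_i|$ vertices of label $i$ and exactly $|E(N_i,N_{i-1})|$ corners of label $i$.
   Context: A surface is a compact connected 2-dimensional manifold, considered up to homeomorphism. A map is an embedding of a finite connected graph (loops and multiple edges allowed) into a surface such that each face (connected component of the complement of the graph) is simply connected; maps are considered up to homeomorphism. A unicellular map is a map with exactly one face. Each edge consists of two half-edges; a corner is an angular sector between two consecutive half-edges around a vertex; the degree of a face is the number of corners in it. A map is rooted if it carries a distinguished half-edge together with a distinguished side of it (equivalently, a distinguished corner, the root corner, with an orientation); the vertex incident to the root is the root vertex. A quadrangulation is a map all of whose faces have degree 4; it is bipartite if its vertices can be 2-colored so that adjacent vertices get different colors. A labeled unicellular map is a rooted unicellular map whose vertices carry integer labels such that the root vertex has label 1 and the labels of any two vertices joined by an edge differ by at most 1; it is well-labeled if moreover all labels are positive. The label of a corner is the label of the vertex it is incident to. -}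

module Defs where

open import Data.Nat as ℕ using (ℕ; zero; suc; _∸_; _<ᵇ_)
open import Data.Integer as ℤ using (ℤ; +_; _-_; ∣_∣)
open import Data.Bool using (Bool; true; false; _∨_; _∧_; not; if_then_else_)
open import Data.Fin using (Fin; toℕ; _≟_)
open import Data.List using (List; []; _∷_)
open import Data.Bool.ListAction using (any)
open import Data.Product using (Σ; _×_; _,_)
open import Function using (_∘_)
open import Function.Bundles using (_↔_; Inverse)
open import Relation.Binary.PropositionalEquality using (_≡_; _≢_)
open import Relation.Nullary.Decidable using (⌊_⌋)
open import Relation.Nullary using (¬_)

count : ∀ {m} → (Fin m → Bool) → ℕ
count {zero}  p = 0
count {suc m} p = (if p Fin.zero then 1 else 0) ℕ.+ count (p ∘ Fin.suc)

anyFin : ∀ {m} → (Fin m → Bool) → Bool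
anyFin p = 0 <ᵇ count p

step : ∀ {m} → List (Fin m → Fin m) → (Fin m → Bool) → (Fin m → Bool)
step gs S y = S y ∨ any (λ g → S (g y)) gs

iter : ∀ {A : Set} → ℕ → (A → A) → A → A
iter zero    f a = a
iter (suc k) f a = f (iter k f a)

-- sameOrbit gs x y : y lies in the orbit of x under the group generated by
-- the (involutive) permutations gs.  Computed by m rounds of closure,
-- which suffices since an orbit has at most m elements.
sameOrbit : ∀ {m} → List (Fin m → Fin m) → Fin m → Fin m → Bool
sameOrbit {m} gs x = iter m (step gs) (λ y → ⌊ y ≟ x ⌋)

isRep : ∀ {m} → List (Fin m → Fin m) → Fin m → Bool
isRep gs x = not (anyFin (λ y → (toℕ y <ᵇ toℕ x) ∧ sameOrbit gs y x))

-- Rooted maps on surfaces, as combinatorial (flag / "graph-encoded") maps.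
-- Flags are Fin m; α0 exchanges the vertex, α1 the edge, α2 the face of a
-- flag.  These encode exactly the maps on arbitrary (orientable or not)
-- closed surfaces.  The root (half-edge + side / oriented root corner)
-- is a distinguished flag.

Inv : ∀ {m} → (Fin m → Fin m) → Set
Inv {m} α = (x : Fin m) → (α (α x) ≡ x) × (α x ≢ x)

record Map : Set where
  field
    m          : ℕ
    α0 α1 α2   : Fin m → Fin m
    inv0       : Inv α0
    inv1       : Inv α1
    inv2       : Inv α2
    comm02     : (x : Fin m) → α0 (α2 x) ≡ α2 (α0 x)
    free02     : (x : Fin m) → α0 (α2 x) ≢ x
    root       : Fin m
    connected  : (x y : Fin m) → sameOrbit (α0 ∷ α1 ∷ α2 ∷ []) x y ≡ true

  vGens eGens fGens cGens : List (Fin m → Fin m)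
  vGens = α1 ∷ α2 ∷ []     -- vertices  = <α1,α2>-orbits
  eGens = α0 ∷ α2 ∷ []     -- edges     = <α0,α2>-orbits
  fGens = α0 ∷ α1 ∷ []     -- faces     = <α0,α1>-orbits
  cGens = α1 ∷ []          -- corners   = <α1>-orbits

  sameVertex : Fin m → Fin m → Bool
  sameVertex = sameOrbit vGens

  #V #E #F : ℕ
  #V = count (isRep vGens)
  #E = count (isRep eGens)
  #F = count (isRep fGens)

  faceDegree : Fin m → ℕ
  faceDegree x = count (λ y → sameOrbit fGens x y ∧ isRep cGens y)

  euler : ℤ
  euler = (+ #V - + #E) ℤ.+ + #F

  Orientable : Set
  Orientable = Σ (Fin m → Bool) λ s → (x : Fin m) →
    (s (α0 x) ≡ not (s x)) × (s (α1 x) ≡ not (s x)) × (s (α2 x) ≡ not (s x))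

  Bipartite : Set
  Bipartite = Σ (Fin m → Bool) λ c → (x : Fin m) →
    (c (α1 x) ≡ c x) × (c (α2 x) ≡ c x) × (c (α0 x) ≡ not (c x))

  IsQuadrangulation : Set
  IsQuadrangulation = (x : Fin m) → faceDegree x ≡ 4

  Unicellular : Set
  Unicellular = #F ≡ 1

  within : ℕ → Fin m → Bool
  within zero    x = sameVertex root x
  within (suc k) x = within k x ∨ anyFin (λ y → sameVertex x y ∧ within k (α0 y))

  atDist : ℕ → Fin m → Bool
  atDist zero    x = within zero x
  atDist (suc k) x = within (suc k) x ∧ not (within k x)

  layerSize : ℕ → ℕ
  layerSize i = count (λ x → isRep vGens x ∧ atDist i x)

  -- |E(N_i , N_{i-1})|  (used for i ≥ 1); the endpoints of the edge of
  -- flag x are the vertices of x and of α0 x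
  layerEdges : ℕ → ℕ
  layerEdges i = count (λ x → isRep eGens x ∧
    ((atDist i x ∧ atDist (i ∸ 1) (α0 x)) ∨ (atDist (i ∸ 1) x ∧ atDist i (α0 x))))

open Map public

record _≅_ (M N : Map) : Set where
  field
    φ      : Fin (m M) ↔ Fin (m N)
    pres0  : ∀ x → Inverse.to φ (α0 M x) ≡ α0 N (Inverse.to φ x)
    pres1  : ∀ x → Inverse.to φ (α1 M x) ≡ α1 N (Inverse.to φ x)
    pres2  : ∀ x → Inverse.to φ (α2 M x) ≡ α2 N (Inverse.to φ x)
    presR  : Inverse.to φ (root M) ≡ root N

-- Surfaces, via the classification of compact surfaces:
-- orientable g = sphere with g handles (χ = 2 - 2g),
-- nonorientable k = connected sum of (k+1) projective planes (χ = 1 - k).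

data Surface : Set where
  orientable    : ℕ → Surface
  nonorientable : ℕ → Surface

OnSurface : Map → Surface → Set
OnSurface M (orientable g)    = Orientable M × (euler M ≡ + 2 - + (2 ℕ.* g))
OnSurface M (nonorientable k) = (¬ Orientable M) × (euler M ≡ + 1 - + k)

record BipQuad (S : Surface) (n : ℕ) : Set where
  field
    map      : Map
    onS      : OnSurface map S
    quad     : IsQuadrangulation map
    bip      : Bipartite map
    nfaces   : #F map ≡ n

_≅Q_ : ∀ {S n} → BipQuad S n → BipQuad S n → Set
q ≅Q q' = BipQuad.map q ≅ BipQuad.map q'

record WLUnicellular (S : Surface) (n : ℕ) : Set where
  field
    map      : Map
    label    : Fin (m map) → ℤ
    onS      : OnSurface map S
    unicell  : Unicellular map
    nedges   : #E map ≡ n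
    labVert1 : ∀ x → label (α1 map x) ≡ label x
    labVert2 : ∀ x → label (α2 map x) ≡ label x
    labRoot  : label (root map) ≡ + 1
    labEdge  : ∀ x → ∣ label x - label (α0 map x) ∣ ℕ.≤ 1
    labPos   : ∀ x → + 1 ℤ.≤ label x

  vertsLabel : ℕ → ℕ
  vertsLabel i = count (λ x → isRep (vGens map) x ∧ ⌊ label x ℤ.≟ + i ⌋)

  cornersLabel : ℕ → ℕ
  cornersLabel i = count (λ x → isRep (cGens map) x ∧ ⌊ label x ℤ.≟ + i ⌋)

_≅L_ : ∀ {S n} → WLUnicellular S n → WLUnicellular S n → Set
u ≅L u' = Σ (WLUnicellular.map u ≅ WLUnicellular.map u') λ i →
  ∀ x → WLUnicellular.label u' (Inverse.to (_≅_.φ i) x) ≡ WLUnicellular.label u x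

{-# OPTIONS --safe #-}
-- Call a flag of a quadrangulation far if it lies at the end of its edge that is farther from the root
-- vertex. The far flags carry the involution ν changing the side of the edge, and in each face two
-- commuting involutions α and β permuting its four far flags; forgetting the near flags loses nothing.
-- A labelled unicellular map is the same kind of labelled structure, with ν = α1, α = α2 and β = α0;
-- only the conditions on the structure differ, and they can be compared one label at a time.
--
-- The flags of label i + 1 form loops under ν and an involution c preserving labels. Shifting β by one
-- step along every loop, in one of its two directions, replaces the condition of a quadrangulation at this
-- label by that of a unicellular map, and shifting in the opposite direction undoes this. To choose the
-- directions canonically, follow the contour of the flags of label at most i from the root: it is a single
-- cycle, it is not affected by the shift, and each loop is directed by the first of its flags attached to
-- the contour. Vertices, corners, edges and orientability can be followed through each shift.
module Submission where

open import Defs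
open import Data.Nat as ℕ using (ℕ; zero; suc; _≤_; _<_; _<ᵇ_; z≤n; s≤s)
open import Data.Nat.Properties as ℕₚ using (≤-reflexive; ≤-trans; <-irrefl; ≤-antisym; ≤-refl; <⇒≱; m≤n⇒m≤1+n; n≤1+n; m≤n⇒m<n∨m≡n; m<n⇒m<1+n)
open import Data.Integer as ℤ using (ℤ; +_; _-_; ∣_∣)
import Data.Integer.Properties as ℤₚ
open import Data.Integer.Tactic.RingSolver using (solve-∀)
open import Data.Bool using (Bool; true; false; _∨_; _∧_; not; if_then_else_; T)
import Data.Bool.Properties as 𝔹ₚ
open import Data.Bool.ListAction using (any)
open import Data.Fin as Fin using (Fin; toℕ; _≟_)
import Data.Fin.Properties as Finₚ
open import Data.List using (List; []; _∷_)
open import Data.List.Relation.Unary.All as All using (All; []; _∷_)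
open import Data.List.Relation.Unary.Any using (here; there)
open import Data.List.Membership.Propositional using (_∈_)
open import Data.Product using (Σ; ∃; _×_; _,_; proj₁; proj₂)
open import Data.Sum using (_⊎_; inj₁; inj₂)
open import Data.Unit using (⊤; tt)
open import Data.Empty using (⊥; ⊥-elim)
open import Function using (_∘_)
open import Function.Bundles using (_↔_; Inverse)
open import Relation.Binary.Definitions using (tri<; tri≈; tri>)
open import Relation.Binary.PropositionalEquality
open import Relation.Nullary using (¬_; Dec; yes; no)
open import Relation.Nullary.Decidable using (⌊_⌋; _⊎-dec_; _×-dec_)


-- The labels of a quadrangulation must be distances, and this can be checked locally: the flags of
-- label 1 form one contour, around the root vertex, and the near vertex of every other flag has a
-- neighbour of smaller label, which means that turning around it one meets a descending flag. A
-- unicellular map requires instead that the contour of all its flags is a single cycle. `Hybrid`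
-- interpolates between the two by a threshold: a single contour below it, descending flags above
-- it. A shift at label `i + 1` moves the threshold by one because each turn of the old contour at
-- label `i` becomes an excursion of the new one along a walk between two descending flags. The
-- obstacle is the direction of the shift. On an orientable surface an orientation would supply it
-- globally; on a general surface every loop needs its own, and an inverse exists only if that
-- choice can be read off after the shift as well as before. For the same reason the labels are
-- treated in increasing order, so that all data used for a choice lie below the flags that are
-- moved.

true≢false : ∀ {b} → b ≡ true → b ≡ false → ⊥
true≢false refl ()

¬true⇒false : ∀ {b} → ¬ (b ≡ true) → b ≡ false
¬true⇒false {true}  h = ⊥-elim (h refl)
¬true⇒false {false} h = refl

∧-elim : ∀ {a b} → a ∧ b ≡ true → a ≡ true × b ≡ true
∧-elim {true} {true} _ = refl , refl

∧-intro : ∀ {a b} → a ≡ true → b ≡ true → a ∧ b ≡ true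
∧-intro refl refl = refl

∨-elim : ∀ {a b} → a ∨ b ≡ true → a ≡ true ⊎ b ≡ true
∨-elim {true}         _ = inj₁ refl
∨-elim {false} {true} _ = inj₂ refl

∨-introˡ : ∀ {a b} → a ≡ true → a ∨ b ≡ true
∨-introˡ refl = refl

∨-introʳ : ∀ {a b} → b ≡ true → a ∨ b ≡ true
∨-introʳ {true}  _ = refl
∨-introʳ {false} h = h

bool-ext : ∀ {a b} → (a ≡ true → b ≡ true) → (b ≡ true → a ≡ true) → a ≡ b
bool-ext {true}          f g = sym (f refl)
bool-ext {false} {true}  f g = g refl
bool-ext {false} {false} f g = refl

not-elim : ∀ {a} → not a ≡ true → a ≡ false
not-elim {false} _ = refl

not-intro : ∀ {a} → ¬ (a ≡ true) → not a ≡ true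
not-intro h = cong not (¬true⇒false h)

<ᵇ-sound : ∀ {a b} → (a <ᵇ b) ≡ true → a < b
<ᵇ-sound {a} {b} h = ℕₚ.<ᵇ⇒< a b (subst T (sym h) tt)

<ᵇ-complete : ∀ {a b} → a < b → (a <ᵇ b) ≡ true
<ᵇ-complete {a} {b} h with a <ᵇ b | ℕₚ.<⇒<ᵇ h
... | true | _ = refl

⌊⌋-sound : ∀ {P : Set} {d : Dec P} → ⌊ d ⌋ ≡ true → P
⌊⌋-sound {d = yes p} _ = p

⌊⌋-complete : ∀ {P : Set} {d : Dec P} → P → ⌊ d ⌋ ≡ true
⌊⌋-complete {d = yes _} _ = refl
⌊⌋-complete {d = no ¬p} p = ⊥-elim (¬p p)

dec-true : (b : Bool) → Dec (b ≡ true)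
dec-true b = b Data.Bool.≟ true

invol-injective : ∀ {A : Set} {f : A → A} → (∀ x → f (f x) ≡ x) → ∀ {x y} → f x ≡ f y → x ≡ y
invol-injective {f = f} h {x} {y} e = trans (sym (h x)) (trans (cong f e) (h y))

to-injective : ∀ {A B : Set} (φ : A ↔ B) {x y} → Inverse.to φ x ≡ Inverse.to φ y → x ≡ y
to-injective φ e = trans (sym (Inverse.strictlyInverseʳ φ _)) (trans (cong (Inverse.from φ) e) (Inverse.strictlyInverseʳ φ _))

from-injective : ∀ {A B : Set} (φ : A ↔ B) {x y} → Inverse.from φ x ≡ Inverse.from φ y → x ≡ y
from-injective φ e = trans (sym (Inverse.strictlyInverseˡ φ _)) (trans (cong (Inverse.to φ) e) (Inverse.strictlyInverseˡ φ _))

-- Counting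

enum : ∀ {m} (p : Fin m → Bool) → Fin (count p) → Fin m
enum {suc m} p j with p Fin.zero
enum {suc m} p Fin.zero    | true  = Fin.zero
enum {suc m} p (Fin.suc j) | true  = Fin.suc (enum (p ∘ Fin.suc) j)
enum {suc m} p j           | false = Fin.suc (enum (p ∘ Fin.suc) j)

enum-holds : ∀ {m} (p : Fin m → Bool) j → p (enum p j) ≡ true
enum-holds {suc m} p j with p Fin.zero in eq
enum-holds {suc m} p Fin.zero    | true  = eq
enum-holds {suc m} p (Fin.suc j) | true  = enum-holds (p ∘ Fin.suc) j
enum-holds {suc m} p j           | false = enum-holds (p ∘ Fin.suc) j

enum-injective : ∀ {m} (p : Fin m → Bool) {i j} → enum p i ≡ enum p j → i ≡ j
enum-injective {suc m} p {i} {j} e with p Fin.zero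
enum-injective {suc m} p {Fin.zero} {Fin.zero} e | true = refl
enum-injective {suc m} p {Fin.suc i} {Fin.suc j} e | true =
  cong Fin.suc (enum-injective (p ∘ Fin.suc) (Finₚ.suc-injective e))
enum-injective {suc m} p e | false = enum-injective (p ∘ Fin.suc) (Finₚ.suc-injective e)

index : ∀ {m} (p : Fin m → Bool) x → p x ≡ true → ∃ λ j → enum p j ≡ x
index {suc m} p Fin.zero h with p Fin.zero
... | true = Fin.zero , refl
index {suc m} p (Fin.suc x) h with index (p ∘ Fin.suc) x h
... | j , e with p Fin.zero
... | true  = Fin.suc j , cong Fin.suc e
... | false = j , cong Fin.suc e

count-mono : ∀ {m m'} (p : Fin m → Bool) (p' : Fin m' → Bool)
  (g : ∀ x → p x ≡ true → ∃ λ y → p' y ≡ true) →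
  (∀ x y hx hy → proj₁ (g x hx) ≡ proj₁ (g y hy) → x ≡ y) → count p ≤ count p'
count-mono p p' g inj = Finₚ.injective⇒≤ {f = h} λ {i} {j} e →
  enum-injective p (inj _ _ _ _ (trans (sym (hspec i)) (trans (cong (enum p') e) (hspec j))))
  where
  G : ∀ j → ∃ λ y → p' y ≡ true
  G j = g (enum p j) (enum-holds p j)
  h : Fin (count p) → Fin (count p')
  h j = proj₁ (index p' (proj₁ (G j)) (proj₂ (G j)))
  hspec : ∀ j → enum p' (h j) ≡ proj₁ (G j)
  hspec j = proj₂ (index p' (proj₁ (G j)) (proj₂ (G j)))

count-ext : ∀ {m} {p q : Fin m → Bool} → (∀ x → p x ≡ q x) → count p ≡ count q
count-ext {zero}  h = refl
count-ext {suc m} h = cong₂ ℕ._+_ (cong (if_then 1 else 0) (h Fin.zero)) (count-ext (h ∘ Fin.suc))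

count-strict : ∀ {m} (p q : Fin m → Bool) → (∀ x → p x ≡ true → q x ≡ true) →
  ∀ x → p x ≡ false → q x ≡ true → count p < count q
count-strict {suc m} p q h Fin.zero px qx rewrite px | qx =
  s≤s (count-mono (p ∘ Fin.suc) (q ∘ Fin.suc) (λ y hy → y , h (Fin.suc y) hy) (λ _ _ _ _ e → e))
count-strict {suc m} p q h (Fin.suc x) px qx with p Fin.zero in ep | q Fin.zero in eq
... | true  | true  = s≤s (count-strict (p ∘ Fin.suc) (q ∘ Fin.suc) (h ∘ Fin.suc) x px qx)
... | true  | false = ⊥-elim (true≢false (h Fin.zero ep) eq)
... | false | true  = m<n⇒m<1+n (count-strict (p ∘ Fin.suc) (q ∘ Fin.suc) (h ∘ Fin.suc) x px qx)
... | false | false = count-strict (p ∘ Fin.suc) (q ∘ Fin.suc) (h ∘ Fin.suc) x px qx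

count≤m : ∀ {m} (p : Fin m → Bool) → count p ≤ m
count≤m p = Finₚ.injective⇒≤ {f = enum p} (enum-injective p)

count-exact : ∀ {m k} (p : Fin m → Bool) (w : Fin k → Fin m) →
  (∀ j → p (w j) ≡ true) → (∀ {i j} → w i ≡ w j → i ≡ j) →
  (∀ y → p y ≡ true → ∃ λ j → w j ≡ y) → count p ≡ k
count-exact {k = k} p w hold inj cov = ≤-antisym
  (Finₚ.injective⇒≤ {f = λ j → proj₁ (cov (enum p j) (enum-holds p j))}
    λ {i} {j} e → enum-injective p (trans (sym (proj₂ (cov (enum p i) (enum-holds p i))))
      (trans (cong w e) (proj₂ (cov (enum p j) (enum-holds p j))))))
  (Finₚ.injective⇒≤ {f = λ j → proj₁ (index p (w j) (hold j))}
    λ {i} {j} e → inj (trans (sym (proj₂ (index p (w i) (hold i))))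
      (trans (cong (enum p) e) (proj₂ (index p (w j) (hold j))))))

count-split : ∀ {m} (p q : Fin m → Bool) →
  count p ≡ count (λ x → p x ∧ q x) ℕ.+ count (λ x → p x ∧ not (q x))
count-split {zero}  p q = refl
count-split {suc m} p q with p Fin.zero | q Fin.zero
... | true  | true  = cong suc (count-split (p ∘ Fin.suc) (q ∘ Fin.suc))
... | true  | false = trans (cong suc (count-split (p ∘ Fin.suc) (q ∘ Fin.suc))) (sym (ℕₚ.+-suc _ _))
... | false | true  = count-split (p ∘ Fin.suc) (q ∘ Fin.suc)
... | false | false = count-split (p ∘ Fin.suc) (q ∘ Fin.suc)

anyFin-sound : ∀ {m} (p : Fin m → Bool) → anyFin p ≡ true → ∃ λ x → p x ≡ true
anyFin-sound p h with count p | enum p | enum-holds p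
... | suc k | e | eh = e Fin.zero , eh Fin.zero

anyFin-complete : ∀ {m} (p : Fin m → Bool) x → p x ≡ true → anyFin p ≡ true
anyFin-complete p x h = <ᵇ-complete (≤-trans (s≤s z≤n) (Finₚ.toℕ<n (proj₁ (index p x h))))

-- Reachability under a list of maps

data Reach {A : Set} (gs : List (A → A)) (x : A) : A → Set where
  done : Reach gs x x
  _▸_  : ∀ {y g} → Reach gs x y → g ∈ gs → Reach gs x (g y)

pattern 1st = here refl
pattern 2nd = there (here refl)
pattern 3rd = there (there (here refl))

Involutive : {A : Set} → (A → A) → Set
Involutive f = ∀ x → f (f x) ≡ x

module _ {A : Set} {gs : List (A → A)} where

  Reach-trans : ∀ {x y z} → Reach gs x y → Reach gs y z → Reach gs x z
  Reach-trans r done     = r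
  Reach-trans r (s ▸ g∈) = Reach-trans r s ▸ g∈

  Reach-≡ : ∀ {x y} → x ≡ y → Reach gs x y
  Reach-≡ refl = done

  Reach-sym : All Involutive gs → ∀ {x y} → Reach gs x y → Reach gs y x
  Reach-sym inv done = done
  Reach-sym inv (_▸_ {y} {g} r g∈) =
    Reach-trans (subst (Reach gs (g y)) (All.lookup inv g∈ y) (done ▸ g∈)) (Reach-sym inv r)

  Reach-fold : (P : A → Set) → All (λ g → ∀ y → P y → P (g y)) gs → ∀ {x z} → P x → Reach gs x z → P z
  Reach-fold P cl p done     = p
  Reach-fold P cl p (r ▸ g∈) = All.lookup cl g∈ _ (Reach-fold P cl p r)

Reach-map : ∀ {A B : Set} {gs : List (A → A)} {hs : List (B → B)} (f : A → B) →
  All (λ g → ∀ y → Reach hs (f y) (f (g y))) gs → ∀ {x y} → Reach gs x y → Reach hs (f x) (f y)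
Reach-map f cl done     = done
Reach-map f cl (r ▸ g∈) = Reach-trans (Reach-map f cl r) (All.lookup cl g∈ _)

Reach-invariant : ∀ {A B : Set} {gs : List (A → A)} (f : A → B) →
  All (λ g → ∀ y → f (g y) ≡ f y) gs → ∀ {x y} → Reach gs x y → f y ≡ f x
Reach-invariant f cl done     = refl
Reach-invariant f cl (r ▸ g∈) = trans (All.lookup cl g∈ _) (Reach-invariant f cl r)

any-complete : ∀ {A : Set} (p : A → Bool) {x} {xs : List A} → x ∈ xs → p x ≡ true → any p xs ≡ true
any-complete p (here refl) h = ∨-introˡ h
any-complete p {xs = y ∷ _} (there i) h = ∨-introʳ {p y} (any-complete p i h)

any-sound : ∀ {A : Set} (p : A → Bool) (xs : List A) → any p xs ≡ true → ∃ λ x → x ∈ xs × p x ≡ true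
any-sound p (x ∷ xs) h with ∨-elim {p x} h
... | inj₁ e = x , here refl , e
... | inj₂ e with any-sound p xs e
... | y , i , e' = y , there i , e'

module _ {m : ℕ} (gs : List (Fin m → Fin m)) where

  private
    start : Fin m → Fin m → Bool
    start x y = ⌊ y ≟ x ⌋

  rounds-sound : All Involutive gs → ∀ k {x y} → iter k (step gs) (start x) y ≡ true → Reach gs x y
  rounds-sound inv zero h = Reach-≡ (sym (⌊⌋-sound h))
  rounds-sound inv (suc k) {x} {y} h with ∨-elim {iter k (step gs) (start x) y} h
  ... | inj₁ e = rounds-sound inv k e
  ... | inj₂ e with any-sound _ gs e
  ... | g , g∈ , e' = subst (Reach gs x) (All.lookup inv g∈ y) (rounds-sound inv k e' ▸ g∈)

  -- Each round of closure applies one generator, along which `f` grows by at most one. With one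
  -- round per flag, this bounds distances and labels by the number of flags.
  rounds-bound : (f : Fin m → ℕ) → All (λ g → ∀ y → f y ≤ suc (f (g y))) gs →
    ∀ k {x y} → iter k (step gs) (start x) y ≡ true → f y ≤ f x ℕ.+ k
  rounds-bound f cl zero h = ≤-reflexive (trans (cong f (⌊⌋-sound h)) (sym (ℕₚ.+-identityʳ _)))
  rounds-bound f cl (suc k) {x} {y} h with ∨-elim {iter k (step gs) (start x) y} h
  ... | inj₁ e = ≤-trans (rounds-bound f cl k e) (ℕₚ.+-monoʳ-≤ (f x) (n≤1+n k))
  ... | inj₂ e with any-sound _ gs e
  ... | g , g∈ , e' = ≤-trans (All.lookup cl g∈ y)
        (≤-trans (s≤s (rounds-bound f cl k e')) (≤-reflexive (sym (ℕₚ.+-suc (f x) k))))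

  private
    R : Fin m → ℕ → Fin m → Bool
    R x k = iter k (step gs) (start x)

    mono : ∀ x k {j y} → R x k y ≡ true → R x (j ℕ.+ k) y ≡ true
    mono x k {zero}  h = h
    mono x k {suc j} h = ∨-introˡ (mono x k {j} h)

    Stable : Fin m → ℕ → Set
    Stable x k = ∀ y → R x (suc k) y ≡ true → R x k y ≡ true

    -- Until the closure is stable, every round adds at least one element.
    grow : ∀ x k → (∃ λ j → j ≤ k × Stable x j) ⊎ suc k ≤ count (R x k)
    grow x zero = inj₂ (≤-trans (s≤s z≤n) (count-strict (λ _ → false) (start x) (λ _ ()) x refl (⌊⌋-complete {d = x ≟ x} refl)))
    grow x (suc k) with grow x k
    ... | inj₁ (j , j≤k , st) = inj₁ (j , m≤n⇒m≤1+n j≤k , st)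
    ... | inj₂ k≤ with Finₚ.any? (λ y → dec-true (R x (suc k) y ∧ not (R x k y)))
    ... | yes (y , h) = inj₂ (≤-trans (s≤s k≤) (count-strict _ _ (λ z hz → mono x k {1} {z} hz) y
            (not-elim (proj₂ (∧-elim {R x (suc k) y} h))) (proj₁ (∧-elim {R x (suc k) y} h))))
    ... | no ¬h = inj₁ (k , n≤1+n k , λ y h →
            𝔹ₚ.not-injective (¬true⇒false λ e → ¬h (y , ∧-intro h e)))

    stable : ∀ x → ∃ λ j → j ≤ m × Stable x j
    stable x with grow x m
    ... | inj₁ st = st
    ... | inj₂ h  = ⊥-elim (<-irrefl refl (≤-trans h (count≤m (R x m))))

  sameOrbit-sound : All Involutive gs → ∀ {x y} → sameOrbit gs x y ≡ true → Reach gs x y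
  sameOrbit-sound inv = rounds-sound inv m

  sameOrbit-complete : All Involutive gs → ∀ {x y} → Reach gs x y → sameOrbit gs x y ≡ true
  sameOrbit-complete inv {x} {y} r with stable x
  ... | j , j≤m , st = subst (λ k → R x k y ≡ true) (ℕₚ.m∸n+n≡m j≤m) (mono x j {m ℕ.∸ j} (go r))
    where
    go : ∀ {y} → Reach gs x y → R x j y ≡ true
    go done = subst (λ k → R x k x ≡ true) (ℕₚ.+-identityʳ j) (mono x 0 {j} (⌊⌋-complete {d = x ≟ x} refl))
    go (_▸_ {y} {g} r g∈) = st (g y) (∨-introʳ {R x j (g y)} (any-complete (λ h → R x j (h (g y))) g∈
      (subst (λ z → R x j z ≡ true) (sym (All.lookup inv g∈ y)) (go r))))

  module _ (inv : All Involutive gs) where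

    Reach-dec : ∀ x y → Dec (Reach gs x y)
    Reach-dec x y with sameOrbit gs x y in e
    ... | true  = yes (sameOrbit-sound inv e)
    ... | false = no λ r → true≢false (sameOrbit-complete inv r) e

    isRep-sound : ∀ {x y} → isRep gs x ≡ true → Reach gs y x → toℕ x ≤ toℕ y
    isRep-sound {x} {y} h r = ℕₚ.≮⇒≥ λ y<x → true≢false
      (anyFin-complete (λ y → (toℕ y <ᵇ toℕ x) ∧ sameOrbit gs y x) y
        (∧-intro (<ᵇ-complete y<x) (sameOrbit-complete inv r))) (not-elim h)

    isRep-unique : ∀ {x y} → isRep gs x ≡ true → isRep gs y ≡ true → Reach gs x y → x ≡ y
    isRep-unique hx hy r = Finₚ.toℕ-injective
      (≤-antisym (isRep-sound hx (Reach-sym inv r)) (isRep-sound hy r))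

    private
      search : ∀ n x → toℕ x < n → ∃ λ y → isRep gs y ≡ true × Reach gs x y
      search (suc n) x (s≤s x≤n) with isRep gs x in e
      ... | true = x , e , done
      ... | false with anyFin-sound _ (𝔹ₚ.not-injective {x = anyFin (λ y → (toℕ y <ᵇ toℕ x) ∧ sameOrbit gs y x)} {y = true} e)
      ... | y , hy with ∧-elim {toℕ y <ᵇ toℕ x} hy
      ... | y<x , s with search n y (≤-trans (<ᵇ-sound y<x) x≤n)
      ... | z , hz , r = z , hz , Reach-trans (Reach-sym inv (sameOrbit-sound inv s)) r

    rep : ∀ x → ∃ λ y → isRep gs y ≡ true × Reach gs x y
    rep x = search (suc (toℕ x)) x ≤-refl

-- Comparing numbers of orbits

module _ {m m' : ℕ} (gs : List (Fin m → Fin m)) (gs' : List (Fin m' → Fin m'))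
  (inv : All Involutive gs) (inv' : All Involutive gs')
  (p : Fin m → Bool) (p' : Fin m' → Bool)
  (p-inv : ∀ {x y} → Reach gs x y → p x ≡ p y)
  (p'-inv : ∀ {x y} → Reach gs' x y → p' x ≡ p' y)
  (f : Fin m → Fin m')
  (f-p : ∀ x → p x ≡ true → p' (f x) ≡ true)
  (f-pres : ∀ {x y} → p x ≡ true → Reach gs x y → Reach gs' (f x) (f y))
  (f-refl : ∀ {x y} → p x ≡ true → p y ≡ true → Reach gs' (f x) (f y) → Reach gs x y)
  (f-onto : ∀ y → p' y ≡ true → ∃ λ x → p x ≡ true × Reach gs' y (f x)) where

  -- Only the map induced by `f` on orbits has to be bijective. Each inequality sends a
  -- representative to the representative of the orbit that corresponds to its own.
  count-orbits : count (λ x → isRep gs x ∧ p x) ≡ count (λ y → isRep gs' y ∧ p' y)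
  count-orbits = ≤-antisym
    (count-mono _ _
      (λ x h → let y , hy , r = rep gs' inv' (f x) in
        y , ∧-intro hy (trans (sym (p'-inv r)) (f-p x (proj₂ (∧-elim {isRep gs x} h)))))
      λ x y hx hy e →
        let rx , px = ∧-elim {isRep gs x} hx
            ry , py = ∧-elim {isRep gs y} hy
            _ , _ , r₁ = rep gs' inv' (f x)
            _ , _ , r₂ = rep gs' inv' (f y)
        in isRep-unique gs inv rx ry (f-refl px py
             (Reach-trans r₁ (Reach-trans (Reach-≡ e) (Reach-sym inv' r₂)))))
    (count-mono _ _
      (λ y h → let x , hx , r = f-onto y (proj₂ (∧-elim {isRep gs' y} h))
                   z , hz , s = rep gs inv x in
        z , ∧-intro hz (trans (sym (p-inv s)) hx))
      λ x y hx hy e →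
        let rx , px = ∧-elim {isRep gs' x} hx
            ry , py = ∧-elim {isRep gs' y} hy
            a , pa , r₁ = f-onto x px
            b , pb , r₂ = f-onto y py
            _ , _ , s₁ = rep gs inv a
            _ , _ , s₂ = rep gs inv b
        in isRep-unique gs' inv' rx ry (Reach-trans r₁ (Reach-trans
             (f-pres pa (Reach-trans s₁ (Reach-trans (Reach-≡ e) (Reach-sym inv s₂)))) (Reach-sym inv' r₂))))

module _ {m k : ℕ} (gs : List (Fin m → Fin m)) (inv : All Involutive gs)
  (w : Fin k → Fin m → Fin m) (w-reach : ∀ j x → Reach gs x (w j x))
  (w-cover : ∀ {x y} → Reach gs x y → ∃ λ j → w j x ≡ y)
  (w-inj : ∀ x {i j} → w i x ≡ w j x → i ≡ j) where

  -- Pairs of a representative and an index into the list `w` of its orbit enumerate the whole set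
  -- without repetition.
  count-orbits-of-size : count (isRep gs) ℕ.* k ≡ m
  count-orbits-of-size = ≤-antisym
    (Finₚ.injective⇒≤ {f = h} λ {i} {j} e → to-injective Finₚ.*↔× (h-inj _ _ e))
    (Finₚ.injective⇒≤ {f = g} g-inj)
    where
    h : Fin (count (isRep gs) ℕ.* k) → Fin m
    h i = let a , b = Inverse.to (Finₚ.*↔× {count (isRep gs)} {k}) i in w b (enum (isRep gs) a)
    h-inj : ∀ (p q : Fin (count (isRep gs)) × Fin k) →
      w (proj₂ p) (enum (isRep gs) (proj₁ p)) ≡ w (proj₂ q) (enum (isRep gs) (proj₁ q)) → p ≡ q
    h-inj (a , b) (a' , b') e with enum-injective (isRep gs) (isRep-unique gs inv
        (enum-holds (isRep gs) a) (enum-holds (isRep gs) a')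
        (Reach-trans (w-reach b _) (Reach-trans (Reach-≡ e) (Reach-sym inv (w-reach b' _)))))
    ... | refl = cong (a ,_) (w-inj _ e)
    A : ∀ x → ∃ λ a → ∃ λ b → w b (enum (isRep gs) a) ≡ x
    A x = let y , hy , r = rep gs inv x
              a , ea = index (isRep gs) y hy
              b , eb = w-cover (Reach-sym inv r)
          in a , b , trans (cong (w b) ea) eb
    g : Fin m → Fin (count (isRep gs) ℕ.* k)
    g x = Inverse.from (Finₚ.*↔× {count (isRep gs)} {k}) (proj₁ (A x) , proj₁ (proj₂ (A x)))
    g-inj : ∀ {x y} → g x ≡ g y → x ≡ y
    g-inj {x} {y} e = trans (sym (proj₂ (proj₂ (A x)))) (trans
      (cong (λ p → w (proj₂ p) (enum (isRep gs) (proj₁ p))) (from-injective (Finₚ.*↔× {count (isRep gs)} {k}) e))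
      (proj₂ (proj₂ (A y))))

-- Two-colourings of the orbits of two fixed point free involutions

iter-comm : ∀ {A : Set} k (f : A → A) a → iter k f (f a) ≡ f (iter k f a)
iter-comm zero    f a = refl
iter-comm (suc k) f a = cong f (iter-comm k f a)

iter-+ : ∀ {A : Set} j k (f : A → A) a → iter (j ℕ.+ k) f a ≡ iter j f (iter k f a)
iter-+ zero    k f a = refl
iter-+ (suc j) k f a = cong f (iter-+ j k f a)

iter-injective : ∀ {A : Set} {f : A → A} → (∀ {x y} → f x ≡ f y → x ≡ y) →
  ∀ k {x y} → iter k f x ≡ iter k f y → x ≡ y
iter-injective inj zero    e = e
iter-injective inj (suc k) e = iter-injective inj k (inj e)

period : ∀ {m} (f : Fin m → Fin m) → (∀ {x y} → f x ≡ f y → x ≡ y) → ∀ x → ∃ λ d → d < m × iter (suc d) f x ≡ x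
period {m} f inj x with Finₚ.pigeonhole ≤-refl (λ (k : Fin (suc m)) → iter (toℕ k) f x)
... | i , j , i<j , e with ℕₚ.m≤n⇒∃[o]m+o≡n i<j
... | d , si+d≡j = d , ≤-trans (≤-trans (s≤s (ℕₚ.m≤n+m d (toℕ i))) (≤-reflexive si+d≡j)) (ℕ.s≤s⁻¹ (Finₚ.toℕ<n j)) ,
  sym (iter-injective inj (toℕ i) (trans e (trans (cong (λ n → iter n f x) (trans (sym si+d≡j) (sym (ℕₚ.+-suc (toℕ i) d)))) (iter-+ (toℕ i) (suc d) f x))))

module Colour {m : ℕ} (f g : Fin m → Fin m) (f-inv : Inv f) (g-inv : Inv g) where

  private
    r : Fin m → Fin m
    r x = g (f x)

    ff : ∀ x → f (f x) ≡ x
    ff x = proj₁ (f-inv x)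
    gg : ∀ x → g (g x) ≡ x
    gg x = proj₁ (g-inv x)

    r-inj : ∀ {x y} → r x ≡ r y → x ≡ y
    r-inj e = invol-injective {f = f} ff (invol-injective {f = g} gg e)

  -- Cancelling one rotation at each end turns the equation for `k + 2` and `x` into the equation
  -- for `k` and `r x`, until a fixed point of `f` or of `g` is left. So an orbit, walked as a
  -- cycle, is never re-entered in the opposite sense.
  no-reflection : ∀ k x → iter k r x ≢ f x
  no-reflection zero x e = proj₂ (f-inv x) (sym e)
  no-reflection (suc zero) x e = proj₂ (g-inv (f x)) e
  no-reflection (suc (suc k)) x e = no-reflection k (r x) (trans (iter-comm k r x)
    (trans (sym (ff _)) (cong f (trans (sym (gg _)) (cong g e)))))

  private
    -- The rotation `r` splits every orbit into two halves which `f` and `g` exchange; the half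
    -- containing the base point `y` is coloured `true`.
    Side : Fin m → Fin m → Bool → Set
    Side y x true  = ∃ λ k → iter k r y ≡ x
    Side y x false = ∃ λ k → iter k r y ≡ f x

    side-f : ∀ {y x} b → Side y x b → Side y (f x) (not b)
    side-f true  (k , e) = k , trans e (sym (ff _))
    side-f false (k , e) = k , e

    side-g : ∀ {y x} b → Side y x b → Side y (g x) (not b)
    -- The point preceding `x` under `r` is found by going once around the cycle: if `d + 1`
    -- rotations fix `x`, then `d` rotations lead to `f (g x)`.
    side-g {y} {x} true (k , e) with period r r-inj x
    ... | d , _ , p = d ℕ.+ k , trans (iter-+ d k r y) (trans (cong (iter d r) e)
          (trans (sym (ff _)) (cong f (trans (sym (gg _)) (cong g p)))))
    side-g false (k , e) = suc k , cong g (trans (cong f e) (ff _))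

    side-exclusive : ∀ {y x} → Side y x true → Side y x false → ⊥
    side-exclusive {y} {x} (k , e) (j , e') with ℕₚ.≤-total k j
    ... | inj₁ k≤j = no-reflection (j ℕ.∸ k) x (trans (cong (iter (j ℕ.∸ k) r) (sym e))
          (trans (sym (iter-+ (j ℕ.∸ k) k r y)) (trans (cong (λ n → iter n r y) (ℕₚ.m∸n+n≡m k≤j)) e')))
    ... | inj₂ j≤k = no-reflection (k ℕ.∸ j) (f x) (trans (cong (iter (k ℕ.∸ j) r) (sym e'))
          (trans (sym (iter-+ (k ℕ.∸ j) j r y)) (trans (cong (λ n → iter n r y) (ℕₚ.m∸n+n≡m j≤k)) (trans e (sym (ff x))))))

    side-unique : ∀ {y x} b b' → Side y x b → Side y x b' → b ≡ b'
    side-unique true  true  _ _ = refl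
    side-unique false false _ _ = refl
    side-unique true  false s t = ⊥-elim (side-exclusive s t)
    side-unique false true  s t = ⊥-elim (side-exclusive t s)

    gs : List (Fin m → Fin m)
    gs = f ∷ g ∷ []
    gs-inv : All Involutive gs
    gs-inv = (λ x → ff x) ∷ (λ x → gg x) ∷ []

    side : ∀ {y x} → Reach gs y x → ∃ (Side y x)
    side {y} r = Reach-fold (λ x → ∃ (Side y x))
      ((λ x (b , s) → not b , side-f {y} {x} b s) ∷ (λ x (b , s) → not b , side-g {y} {x} b s) ∷ []) (true , 0 , refl) r

    base : Fin m → Fin m
    base x = proj₁ (rep gs gs-inv x)

    base-reach : ∀ x → Reach gs x (base x)
    base-reach x = proj₂ (proj₂ (rep gs gs-inv x))

    base-inv : ∀ {x y} → Reach gs x y → base x ≡ base y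
    base-inv {x} {y} r = isRep-unique gs gs-inv (proj₁ (proj₂ (rep gs gs-inv x))) (proj₁ (proj₂ (rep gs gs-inv y)))
      (Reach-trans (Reach-sym gs-inv (base-reach x)) (Reach-trans r (base-reach y)))

    side-of : ∀ x → ∃ (Side (base x) x)
    side-of x = side (Reach-sym gs-inv (base-reach x))

  colour : Fin m → Bool
  colour x = proj₁ (side-of x)

  colour-f : ∀ x → colour (f x) ≡ not (colour x)
  colour-f x = side-unique _ _ (proj₂ (side-of (f x)))
    (subst (λ y → Side y (f x) (not (colour x))) (base-inv (done ▸ 1st)) (side-f _ (proj₂ (side-of x))))

  colour-g : ∀ x → colour (g x) ≡ not (colour x)
  colour-g x = side-unique _ _ (proj₂ (side-of (g x)))
    (subst (λ y → Side y (g x) (not (colour x))) (base-inv (done ▸ 2nd)) (side-g _ (proj₂ (side-of x))))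

least : {P : ℕ → Set} → (∀ k → Dec (P k)) → ∀ n → P n → ∃ λ k → P k × (∀ j → j < k → ¬ P j)
least {P} P? n p = go n p
  where
  below : ∀ n → (∃ λ k → P k × (∀ j → j < k → ¬ P j)) ⊎ (∀ j → j < n → ¬ P j)
  below zero = inj₂ λ _ ()
  below (suc n) with below n
  ... | inj₁ found = inj₁ found
  ... | inj₂ none with P? n
  ... | yes p = inj₁ (n , p , none)
  ... | no ¬p = inj₂ λ j j<sn → case-< (m≤n⇒m<n∨m≡n (ℕ.s≤s⁻¹ j<sn))
    where
    case-< : ∀ {j} → j < n ⊎ j ≡ n → ¬ P j
    case-< (inj₁ j<n)  = none _ j<n
    case-< (inj₂ refl) = ¬p
  go : ∀ n → P n → ∃ λ k → P k × (∀ j → j < k → ¬ P j)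
  go n p with below n
  ... | inj₁ found = found
  ... | inj₂ none  = n , p , none

least-unique : {P : ℕ → Set} → ∀ {k l} → P k → (∀ j → j < k → ¬ P j) → P l → (∀ j → j < l → ¬ P j) → k ≡ l
least-unique {k = k} {l} pk mk pl ml = ≤-antisym (ℕₚ.≮⇒≥ λ l<k → mk l l<k pl) (ℕₚ.≮⇒≥ λ k<l → ml k k<l pk)

-- Normalising makes a two-colouring unique, hence invariant under isomorphisms.

module Normal {m : ℕ} (f g : Fin m → Fin m) (s : ℕ → Fin m) where

  gens : List (Fin m → Fin m)
  gens = f ∷ g ∷ []

  First : Fin m → ℕ → Set
  First x k = Reach gens x (s k) × (∀ j → j < k → ¬ Reach gens x (s j))

  Norm : (Fin m → Set) → (Fin m → Bool) → Set
  Norm Q o = ∀ x → Q x → ∃ λ k → First x k × o (s k) ≡ true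

  -- Colourings flipped by the same two involutions agree on an orbit once they agree at one of its
  -- points, and `Norm` prescribes the value at the first point of `s` in the orbit.
  norm-unique : {Q : Fin m → Set} → All (λ h → ∀ y → Q y → Q (h y)) gens → ∀ {o o'} →
    (∀ x → Q x → o (f x) ≡ not (o x) × o (g x) ≡ not (o x)) →
    (∀ x → Q x → o' (f x) ≡ not (o' x) × o' (g x) ≡ not (o' x)) →
    Norm Q o → Norm Q o' → ∀ x → Q x → o x ≡ o' x
  norm-unique {Q} (Qf ∷ Qg ∷ []) {o} {o'} fl fl' N N' x q with N x q | N' x q
  ... | k , (r , mk) , e | k' , (r' , mk') , e' with least-unique r mk r' mk'
  ... | refl = proj₂ (Reach-fold (λ y → Q y × (o y ≡ o' y → o x ≡ o' x))
      ((λ y (qy , b) → Qf y qy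
          , λ h → b (𝔹ₚ.not-injective (trans (sym (proj₁ (fl y qy))) (trans h (proj₁ (fl' y qy))))))
      ∷ (λ y (qy , b) → Qg y qy
          , λ h → b (𝔹ₚ.not-injective (trans (sym (proj₂ (fl y qy))) (trans h (proj₂ (fl' y qy))))))
      ∷ []) (q , λ h → h) r) (trans e (sym e'))

  module _ (f-inv : Inv f) (g-inv : Inv g) where

    private
      invs : All Involutive gens
      invs = (λ x → proj₁ (f-inv x)) ∷ (λ x → proj₁ (g-inv x)) ∷ []

    firstOf : ∀ {x} → (∃ λ k → Reach gens x (s k)) → ∃ (First x)
    firstOf {x} (n , r) with least {P = λ k → Reach gens x (s k)} (λ k → Reach-dec gens invs x (s k)) n r
    ... | k , p , mn = k , p , mn

    First-shift : ∀ {x y k} → Reach gens x y → First x k → First y k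
    First-shift r (t , mn) = Reach-trans (Reach-sym invs r) t , λ j j<k u → mn j j<k (Reach-trans r u)

    module _ {Q : Fin m → Set} (Q-cl : All (λ h → ∀ y → Q y → Q (h y)) gens) (Q? : ∀ x → Dec (Q x))
      (cover : ∀ x → Q x → ∃ λ k → Reach gens x (s k)) where

      open Colour f g f-inv g-inv

      private
        same : Bool → Bool → Bool
        same a b = if a then b else not b

        same-not : ∀ a b → same (not a) b ≡ not (same a b)
        same-not true  b = refl
        same-not false b = sym (𝔹ₚ.not-involutive b)

        same-refl : ∀ a → same a a ≡ true
        same-refl true  = refl
        same-refl false = refl

      -- The quotient of the arbitrary colouring by its value at the first point of `s` in the
      -- orbit, so that this point receives `true`.
      normalColour : Fin m → Bool
      normalColour x with Q? x
      ... | yes q = same (colour x) (colour (s (proj₁ (firstOf (cover x q)))))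
      ... | no _  = true

      private
        normalColour-val : ∀ {x k} → Q x → First x k → normalColour x ≡ same (colour x) (colour (s k))
        normalColour-val {x} {k} q F with Q? x
        ... | no ¬q = ⊥-elim (¬q q)
        ... | yes q' = let k' , (r , mk) = firstOf (cover x q') in
          cong (λ n → same (colour x) (colour (s n))) (least-unique r mk (proj₁ F) (proj₂ F))

        flip : ∀ (h : Fin m → Fin m) → h ∈ gens → (∀ x → colour (h x) ≡ not (colour x)) →
          ∀ x → Q x → normalColour (h x) ≡ not (normalColour x)
        flip h h∈ ch x q = let k , F = firstOf (cover x q) in
          trans (normalColour-val (All.lookup Q-cl h∈ x q) (First-shift (done ▸ h∈) F))
            (trans (cong (λ b → same b (colour (s k))) (ch x))
            (trans (same-not (colour x) _) (cong not (sym (normalColour-val q F)))))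

      normalColour-flips : ∀ x → Q x →
        normalColour (f x) ≡ not (normalColour x) × normalColour (g x) ≡ not (normalColour x)
      normalColour-flips x q = flip f 1st colour-f x q , flip g 2nd colour-g x q

      normalColour-norm : Norm Q normalColour
      normalColour-norm x q = let k , F = firstOf (cover x q) in
        k , F , trans (normalColour-val (Reach-fold Q Q-cl q (proj₁ F)) (First-shift (proj₁ F) F)) (same-refl (colour (s k)))

-- Labelled structures, their contours, loops and walks

record Str (m : ℕ) : Set where
  field
    ν α β   : Fin m → Fin m
    lab     : Fin m → ℕ
    rt      : Fin m
    ν-inv   : Inv ν
    α-inv   : Inv α
    β-inv   : Inv β
    comm    : ∀ x → β (α x) ≡ α (β x)
    free    : ∀ x → β (α x) ≢ x
    lab-ν   : ∀ x → lab (ν x) ≡ lab x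
    lab-α   : ∀ x → lab (α x) ≡ lab x
    -- Applied to `β x`, the same bound limits the change in the other direction.
    lab-β   : ∀ x → lab (β x) ≤ suc (lab x)
    lab-pos : ∀ x → 1 ≤ lab x
    lab-rt  : lab rt ≡ 1

  νν : Involutive ν
  νν x = proj₁ (ν-inv x)
  αα : Involutive α
  αα x = proj₁ (α-inv x)
  ββ : Involutive β
  ββ x = proj₁ (β-inv x)

module Levels {m} (D : Str m) where
  open Str D

  -- In a quadrangulation a flat flag of label l lies in a face with labels l, l - 1, l, l - 1;
  -- descending flags of label l and ascending flags of label l - 1 share a face with labels l, l - 1, l - 2, l - 1.
  Flat Dn Up : Fin m → Set
  Flat x = lab (β x) ≡ lab x
  Dn x   = lab x ≡ suc (lab (β x))
  Up x   = lab (β x) ≡ suc (lab x)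

  data Kind (x : Fin m) : Set where
    flat : Flat x → Kind x
    dn   : Dn x → Kind x
    up   : Up x → Kind x

  kind : ∀ x → Kind x
  kind x with m≤n⇒m<n∨m≡n (lab-β x)
  ... | inj₂ e = up e
  ... | inj₁ (s≤s h) with m≤n⇒m<n∨m≡n h
  ... | inj₂ e = flat e
  ... | inj₁ h' = dn (≤-antisym (≤-trans (≤-reflexive (cong lab (sym (ββ x)))) (lab-β (β x))) h')

  dn⇒¬flat : ∀ {x} → Dn x → ¬ Flat x
  dn⇒¬flat {x} d e = ℕₚ.1+n≢n (sym (trans e d))

  up⇒¬flat : ∀ {x} → Up x → ¬ Flat x
  up⇒¬flat {x} d e = ℕₚ.1+n≢n (trans (sym d) e)

  dn⇒¬up : ∀ {x} → Dn x → ¬ Up x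
  dn⇒¬up {x} d e = <-irrefl (trans e (cong suc d)) (m<n⇒m<1+n ≤-refl)

  labβα : ∀ x → lab (β (α x)) ≡ lab (β x)
  labβα x = trans (cong lab (comm x)) (lab-α (β x))

  flat-α : ∀ {x} → Flat x → Flat (α x)
  flat-α {x} h = trans (labβα x) (trans h (sym (lab-α x)))

  dn-α : ∀ {x} → Dn x → Dn (α x)
  dn-α {x} h = trans (lab-α x) (trans h (cong suc (sym (labβα x))))

  up-α : ∀ {x} → Up x → Up (α x)
  up-α {x} h = trans (labβα x) (trans h (cong suc (sym (lab-α x))))

  flat-β : ∀ {x} → Flat x → Flat (β x)
  flat-β {x} h = trans (cong lab (ββ x)) (sym h)

  dn-β : ∀ {x} → Up x → Dn (β x)
  dn-β {x} h = trans h (cong (suc ∘ lab) (sym (ββ x)))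

  up-β : ∀ {x} → Dn x → Up (β x)
  up-β {x} h = trans (cong lab (ββ x)) h

  dn-lab : ∀ {x i} → Dn x → lab x ≡ suc i → lab (β x) ≡ i
  dn-lab d e = ℕₚ.suc-injective (trans (sym d) e)

  up-lab : ∀ {x i} → Up x → lab x ≡ i → lab (β x) ≡ suc i
  up-lab u e = trans u (cong suc e)

  Dn? : ∀ x → Dec (Dn x)
  Dn? x = lab x ℕ.≟ suc (lab (β x))

  -- The flags at which the contour may follow `β`; at the others it turns back by `α`. Flat flags
  -- are included at every level, so that `b 0` follows them without changing the label.
  Keep : ℕ → Fin m → Set
  Keep i x = Flat x ⊎ (lab x ≤ i × lab (β x) ≤ i)

  keep? : ∀ i x → Dec (Keep i x)
  keep? i x = (lab (β x) ℕ.≟ lab x) ⊎-dec ((lab x ℕ.≤? i) ×-dec (lab (β x) ℕ.≤? i))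

  -- ν and b i trace the contour of the flags of label at most i; ν and c = b 0 stay inside a label class.
  b : ℕ → Fin m → Fin m
  b i x with keep? i x
  ... | yes _ = β x
  ... | no _  = α x

  b-keep : ∀ {i x} → Keep i x → b i x ≡ β x
  b-keep {i} {x} k with keep? i x
  ... | yes _ = refl
  ... | no ¬k = ⊥-elim (¬k k)

  b-cross : ∀ {i x} → ¬ Keep i x → b i x ≡ α x
  b-cross {i} {x} ¬k with keep? i x
  ... | yes k = ⊥-elim (¬k k)
  ... | no _  = refl

  c : Fin m → Fin m
  c = b 0

  c-flat : ∀ {x} → Flat x → c x ≡ β x
  c-flat h = b-keep (inj₁ h)

  keep-0 : ∀ {x} → Keep 0 x → Flat x
  keep-0 (inj₁ f) = f
  keep-0 {x} (inj₂ (h , _)) with ≤-trans (lab-pos x) h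
  ... | ()

  c-steep : ∀ {x} → ¬ Flat x → c x ≡ α x
  c-steep h = b-cross (h ∘ keep-0)

  keep-β : ∀ {i x} → Keep i x → Keep i (β x)
  keep-β (inj₁ f) = inj₁ (flat-β f)
  keep-β {x = x} (inj₂ (p , q)) = inj₂ (q , ≤-trans (≤-reflexive (cong lab (ββ x))) p)

  keep-α : ∀ {i x} → Keep i x → Keep i (α x)
  keep-α (inj₁ f) = inj₁ (flat-α f)
  keep-α {x = x} (inj₂ (p , q)) = inj₂ (≤-trans (≤-reflexive (lab-α x)) p , ≤-trans (≤-reflexive (labβα x)) q)

  b-inv : ∀ i → Inv (b i)
  b-inv i x with keep? i x
  ... | yes k = trans (b-keep (keep-β k)) (ββ x) , proj₂ (β-inv x)
  ... | no ¬k = trans (b-cross (λ k → ¬k (subst (Keep i) (αα x) (keep-α k)))) (αα x) , proj₂ (α-inv x)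

  b-lab≤ : ∀ i x → lab x ≤ i → lab (b i x) ≤ i
  b-lab≤ i x h with keep? i x
  ... | yes (inj₁ f)       = ≤-trans (≤-reflexive f) h
  ... | yes (inj₂ (_ , q)) = q
  ... | no ¬k = ≤-trans (≤-reflexive (lab-α x)) h

  lab-c : ∀ x → lab (c x) ≡ lab x
  lab-c x with keep? 0 x
  ... | yes k = keep-0 k
  ... | no ¬k = lab-α x

  dn-c : ∀ {x} → Dn x → Dn (c x)
  dn-c {x} d = subst Dn (sym (c-steep (dn⇒¬flat d))) (dn-α d)

  cc : Involutive c
  cc x = proj₁ (b-inv 0 x)

  dn-c⁻ : ∀ {x} → Dn (c x) → Dn x
  dn-c⁻ {x} d = subst Dn (cc x) (dn-c d)

  -- Fixing the descending flags cuts the loops of ν and c into walks, whose ends K pairs up.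

  pc : Fin m → Fin m
  pc x with Dn? x
  ... | yes _ = x
  ... | no _  = c x

  pc-dn : ∀ {x} → Dn x → pc x ≡ x
  pc-dn {x} d with Dn? x
  ... | yes _ = refl
  ... | no ¬d = ⊥-elim (¬d d)

  pc-else : ∀ {x} → ¬ Dn x → pc x ≡ c x
  pc-else {x} ¬d with Dn? x
  ... | yes d = ⊥-elim (¬d d)
  ... | no _  = refl

  pc-inv : Involutive pc
  pc-inv x with Dn? x
  ... | yes d = pc-dn d
  ... | no ¬d = trans (pc-else (¬d ∘ dn-c⁻)) (cc x)

  -- In a quadrangulation a loop of label `l` crosses in succession edges between distances `l` and
  -- `l - 1`, and a walk turns around one near vertex. In a unicellular map a loop runs along a
  -- boundary of a component of the subgraph induced by the vertices of label `l`.
  pGens loopGens : List (Fin m → Fin m)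
  pGens = ν ∷ pc ∷ []
  loopGens = ν ∷ c ∷ []

  P : Fin m → Fin m → Set
  P = Reach pGens

  P-sym : ∀ {x y} → P x y → P y x
  P-sym = Reach-sym (νν ∷ pc-inv ∷ [])

  lab-pc : ∀ x → lab (pc x) ≡ lab x
  lab-pc x with Dn? x
  ... | yes _ = refl
  ... | no _  = lab-c x

  P-lab : ∀ {x y} → P x y → lab y ≡ lab x
  P-lab = Reach-invariant lab (lab-ν ∷ lab-pc ∷ [])

  loop-lab : ∀ {x y} → Reach loopGens x y → lab y ≡ lab x
  loop-lab = Reach-invariant lab (lab-ν ∷ lab-c ∷ [])

  loop-sym : ∀ {x y} → Reach loopGens x y → Reach loopGens y x
  loop-sym = Reach-sym (νν ∷ cc ∷ [])

  -- A walk in a fixed sense up to the first descending flag. As an inductive predicate it permits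
  -- induction along the walk, and that the walk stops is proved apart from it.
  data Hit : Fin m → Fin m → Set where
    stop : ∀ {x} → Dn x → Hit x x
    move : ∀ {x z} → ¬ Dn x → Hit (ν (c x)) z → Hit x z

  Hit-dn : ∀ {x z} → Hit x z → Dn z
  Hit-dn (stop d)   = d
  Hit-dn (move _ h) = Hit-dn h

  Hit-det : ∀ {x z z'} → Hit x z → Hit x z' → z ≡ z'
  Hit-det (stop _)   (stop _)    = refl
  Hit-det (stop d)   (move ¬d _) = ⊥-elim (¬d d)
  Hit-det (move ¬d _) (stop d)   = ⊥-elim (¬d d)
  Hit-det (move _ h) (move _ h') = Hit-det h h'

  Hit-P : ∀ {x z} → Hit x z → P x z
  Hit-P (stop _) = done
  Hit-P {x} (move ¬d h) = Reach-trans (subst (λ y → P x (ν y)) (pc-else ¬d) ((done ▸ 2nd) ▸ 1st)) (Hit-P h)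

  Hit-loop : ∀ {x z} → Hit x z → Reach loopGens x z
  Hit-loop (stop _)   = done
  Hit-loop (move _ h) = Reach-trans ((done ▸ 2nd) ▸ 1st) (Hit-loop h)

  Hit-lab : ∀ {x z} → Hit x z → lab z ≡ lab x
  Hit-lab h = P-lab (Hit-P h)

  -- The walk is turned around one move at a time: each move made forwards from `x` is put in front
  -- of the walk in the opposite sense.
  Hit-rev : ∀ {x z w} → Hit x z → Hit (ν x) w → Hit (ν z) w
  Hit-rev (stop _) h = h
  Hit-rev {x} {w = w} (move ¬d h) k = Hit-rev h (subst (λ y → Hit y w) (sym (νν (c x)))
    (move (¬d ∘ dn-c⁻) (subst (λ y → Hit (ν y) w) (sym (cc x)) k)))

  Hit-colour : ∀ {j} (o : Fin m → Bool) → (∀ x → lab x ≡ j → o (ν x) ≡ not (o x) × o (c x) ≡ not (o x)) →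
    ∀ {x z} → lab x ≡ j → Hit x z → o z ≡ o x
  Hit-colour o fl e (stop _) = refl
  Hit-colour o fl {x} e (move _ h) = trans (Hit-colour o fl (trans (lab-ν _) (trans (lab-c _) e)) h)
    (trans (proj₁ (fl (c x) (trans (lab-c x) e))) (trans (cong not (proj₂ (fl x e))) (𝔹ₚ.not-involutive _)))

  private
    rr : Fin m → Fin m
    rr x = ν (c x)

    hit-within : ∀ d {x} → Dn (iter d rr x) → ∃ (Hit x)
    hit-within zero d = _ , stop d
    hit-within (suc n) {x} d with Dn? x
    ... | yes dx = x , stop dx
    ... | no ¬dx = let z , h = hit-within n (subst Dn (sym (iter-comm n rr x)) d) in z , move ¬dx h

    -- The cycle of `ν ∘ c` through `ν t` passes through `c t` just before it closes, and `c t` is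
    -- descending because `t` is. So the walk stops there at the latest.
    hit : ∀ {t} → Dn t → ∃ (Hit (ν t))
    hit {t} d with period rr (λ e → invol-injective {f = c} cc (invol-injective {f = ν} νν e)) (ν t)
    ... | n , _ , e = hit-within n (subst Dn
      (trans (cong c (sym (invol-injective {f = ν} νν e))) (cc _)) (dn-c d))

  K : Fin m → Fin m
  K x with Dn? x
  ... | yes d = proj₁ (hit d)
  ... | no _  = x

  K-hit : ∀ {t} → Dn t → Hit (ν t) (K t)
  K-hit {t} d with Dn? t
  ... | yes d' = proj₂ (hit d')
  ... | no ¬d  = ⊥-elim (¬d d)

  K-dn : ∀ {t} → Dn t → Dn (K t)
  K-dn d = Hit-dn (K-hit d)

  K-lab : ∀ {t} → Dn t → lab (K t) ≡ lab t
  K-lab d = trans (Hit-lab (K-hit d)) (lab-ν _)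

  KK : ∀ {t} → Dn t → K (K t) ≡ t
  KK {t} d = Hit-det (K-hit (K-dn d)) (Hit-rev (K-hit d) (subst (λ y → Hit y t) (sym (νν t)) (stop d)))

  K-P : ∀ {t} → Dn t → P t (K t)
  K-P d = Reach-trans (done ▸ 1st) (Hit-P (K-hit d))

  K-loop : ∀ {t} → Dn t → Reach loopGens t (K t)
  K-loop d = Reach-trans (done ▸ 1st) (Hit-loop (K-hit d))

  -- Every move of the walk flips the colour twice; only the initial `ν` counts.
  K-colour : ∀ {j} (o : Fin m → Bool) → (∀ x → lab x ≡ j → o (ν x) ≡ not (o x) × o (c x) ≡ not (o x)) →
    ∀ {t} → Dn t → lab t ≡ j → o (K t) ≡ not (o t)
  K-colour o fl {t} d e = trans (Hit-colour o fl (trans (lab-ν t) e) (K-hit d)) (proj₁ (fl t e))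

  α-colour : ∀ {j} (o : Fin m → Bool) → (∀ x → lab x ≡ j → o (ν x) ≡ not (o x) × o (c x) ≡ not (o x)) →
    ∀ {t} → Dn t → lab t ≡ j → o (α t) ≡ not (o t)
  α-colour o fl {t} d e = trans (cong o (sym (c-steep (dn⇒¬flat d)))) (proj₂ (fl t e))

  -- The two descending flags at the ends of a walk are an invariant of its points.
  P-ends : ∀ {t t'} → Dn t → Dn t' → P t t' → t' ≡ t ⊎ t' ≡ K t
  P-ends {t} {t'} d d' r with ends r
    where
    Ends : Fin m → Fin m → Fin m → Set
    Ends y z w = Hit y z × Hit (ν y) w

    swap-pc : ∀ y {z w} → Hit y z → Hit (ν y) w → (Hit (pc y) z × Hit (ν (pc y)) w) ⊎ (Hit (pc y) w × Hit (ν (pc y)) z)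
    swap-pc y {z} {w} h h' with Dn? y
    ... | yes _ = inj₁ (h , h')
    ... | no ¬d with h
    ... | stop d = ⊥-elim (¬d d)
    ... | move _ k = inj₂ (move (¬d ∘ dn-c⁻) (subst (λ v → Hit (ν v) w) (sym (cc y)) h') , k)

    ends : ∀ {y} → P t y → Ends y t (K t) ⊎ Ends y (K t) t
    ends = Reach-fold (λ y → Ends y t (K t) ⊎ Ends y (K t) t)
      ( (λ { y (inj₁ (h , h')) → inj₂ (h' , subst (λ v → Hit v t) (sym (νν y)) h)
           ; y (inj₂ (h , h')) → inj₁ (h' , subst (λ v → Hit v (K t)) (sym (νν y)) h) })
      ∷ (λ { y (inj₁ (h , h')) → swap-pc y h h'
           ; y (inj₂ (h , h')) → Data.Sum.swap (swap-pc y h h') })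
      ∷ []) (inj₁ (stop d , K-hit d))
  ... | inj₁ (h , _) = inj₁ (Hit-det (stop d') h)
  ... | inj₂ (h , _) = inj₂ (Hit-det (stop d') h)

  -- At label exactly `i` the contour turns back at ascending flags and follows flat ones, just as
  -- `c` does. The two rules differ only at descending flags, where a walk stops.
  P⇒b : ∀ {i x y} → lab x ≡ i → P x y → Reach (ν ∷ b i ∷ []) x y
  P⇒b {i} e done = done
  P⇒b e (r ▸ 1st) = P⇒b e r ▸ 1st
  P⇒b {i} {x} e (_▸_ {y} r 2nd) with Dn? y
  ... | yes _ = P⇒b e r
  ... | no ¬d = subst (Reach (ν ∷ b i ∷ []) x) same (P⇒b e r ▸ 2nd)
    where
    same : b i y ≡ c y
    same with kind y
    ... | flat f = trans (b-keep (inj₁ f)) (sym (c-flat f))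
    ... | dn d   = ⊥-elim (¬d d)
    ... | up u   = trans (b-cross λ { (inj₁ f) → up⇒¬flat u f
                                    ; (inj₂ (_ , q)) → <⇒≱ (≤-reflexive (sym (up-lab u (trans (P-lab r) e)))) q })
                     (sym (c-steep (up⇒¬flat u)))

  -- Hybrid 1 characterises quadrangulations, Hybrid i for large i unicellular maps.
  record Hybrid (i : ℕ) : Set where
    field
      low  : ∀ x → lab x ≤ i → Reach (ν ∷ b i ∷ []) rt x
      high : ∀ x → i < lab x → ∃ λ t → Dn t × P x t

  Flips : ℕ → (Fin m → Bool) → Set
  Flips j o = ∀ x → lab x ≡ j → o (ν x) ≡ not (o x) × o (c x) ≡ not (o x)

-- A single shift, described by its effect

module _ {m} (D D' : Str m) where
  private
    module D = Str D
    module D' = Str D'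
    module L = Levels D
    module L' = Levels D'

  -- D' arises from D by shifting β along the loops of label i + 1, in the direction given by o.
  -- On ascending flags this exchanges α with the conjugate of K by β.
  record Step (i : ℕ) (o : Fin m → Bool) : Set where
    field
      ν≡      : ∀ x → D'.ν x ≡ D.ν x
      lab≡    : ∀ x → D'.lab x ≡ D.lab x
      rt≡     : D'.rt ≡ D.rt
      labβ≡   : ∀ x → D'.lab (D'.β x) ≡ D.lab (D.β x)
      α-off   : ∀ {x} → ¬ (L.Up x × D.lab x ≡ i) → D'.α x ≡ D.α x
      β-off   : ∀ {x} → ¬ (L.Up x × D.lab x ≡ i) → ¬ (L.Dn x × D.lab x ≡ suc i) → D'.β x ≡ D.β x
      flips   : L.Flips (suc i) o
      β-true  : ∀ {t} → L.Dn t → D.lab t ≡ suc i → o t ≡ true → D'.β t ≡ D.β (L.K t)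
      β-false : ∀ {t} → L.Dn t → D.lab t ≡ suc i → o t ≡ false → D'.β t ≡ D.β (D.α t)
      α-on    : ∀ {x} → L.Up x → D.lab x ≡ i → D'.α x ≡ D.β (L.K (D.β x))

module StepFacts {m} {D D' : Str m} {i : ℕ} {o : Fin m → Bool} (S : Step D D' i o) where
  open Step S
  module D = Str D
  module D' = Str D'
  module L = Levels D
  module L' = Levels D'

  flat' : ∀ {x} → L.Flat x → L'.Flat x
  flat' {x} f = trans (labβ≡ x) (trans f (sym (lab≡ x)))
  dn' : ∀ {x} → L.Dn x → L'.Dn x
  dn' {x} f = trans (lab≡ x) (trans f (cong suc (sym (labβ≡ x))))
  up' : ∀ {x} → L.Up x → L'.Up x
  up' {x} f = trans (labβ≡ x) (trans f (cong suc (sym (lab≡ x))))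
  flat⁻ : ∀ {x} → L'.Flat x → L.Flat x
  flat⁻ {x} f = trans (sym (labβ≡ x)) (trans f (lab≡ x))
  dn⁻ : ∀ {x} → L'.Dn x → L.Dn x
  dn⁻ {x} f = trans (sym (lab≡ x)) (trans f (cong suc (labβ≡ x)))
  up⁻ : ∀ {x} → L'.Up x → L.Up x
  up⁻ {x} f = trans (sym (labβ≡ x)) (trans f (cong suc (lab≡ x)))

  β-flat : ∀ {x} → L.Flat x → D'.β x ≡ D.β x
  β-flat f = β-off (λ (u , _) → L.up⇒¬flat u f) (λ (d , _) → L.dn⇒¬flat d f)

  β-dn-off : ∀ {x} → L.Dn x → D.lab x ≢ suc i → D'.β x ≡ D.β x
  β-dn-off d h = β-off (λ (u , _) → L.dn⇒¬up d u) (λ (_ , e) → h e)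

  c-steep-same : ∀ {x} → i < D.lab x → ¬ L.Flat x → L'.c x ≡ L.c x
  c-steep-same h ¬f =
    trans (L'.c-steep (¬f ∘ flat⁻)) (trans (α-off λ (_ , e) → <-irrefl (sym e) h) (sym (L.c-steep ¬f)))

  c-same : ∀ {x} → i < D.lab x → L'.c x ≡ L.c x
  c-same {x} h with L.kind x
  ... | L.flat f = trans (L'.c-flat (flat' f)) (trans (β-flat f) (sym (L.c-flat f)))
  ... | L.dn d   = c-steep-same h (L.dn⇒¬flat d)
  ... | L.up u   = c-steep-same h (L.up⇒¬flat u)

  pc-same : ∀ {x} → i < D.lab x → L'.pc x ≡ L.pc x
  pc-same {x} h with L.Dn? x
  ... | yes d = L'.pc-dn (dn' d)
  ... | no ¬d = trans (L'.pc-else (¬d ∘ dn⁻)) (c-same h)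

  P-same : ∀ {x y} → i < D.lab x → L.P x y → L'.P x y
  P-same h done = done
  P-same {x} h (_▸_ {y} r 1st) = subst (L'.P x) (ν≡ y) (P-same h r ▸ 1st)
  P-same {x} h (_▸_ {y} r 2nd) = subst (L'.P x)
    (pc-same (≤-trans h (≤-reflexive (sym (L.P-lab r))))) (P-same h r ▸ 2nd)

  P-same⁻ : ∀ {x y} → i < D.lab x → L'.P x y → L.P x y
  P-same⁻ h done = done
  P-same⁻ {x} h (_▸_ {y} r 1st) = subst (L.P x) (sym (ν≡ y)) (P-same⁻ h r ▸ 1st)
  P-same⁻ {x} h (_▸_ {y} r 2nd) = subst (L.P x)
    (sym (pc-same (≤-trans h (≤-reflexive (sym (L.P-lab (P-same⁻ h r))))))) (P-same⁻ h r ▸ 2nd)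

  loop-same : ∀ {x y} → i < D.lab x → Reach L.loopGens x y → Reach L'.loopGens x y
  loop-same h done = done
  loop-same {x} h (_▸_ {y} r 1st) = subst (Reach L'.loopGens x) (ν≡ y) (loop-same h r ▸ 1st)
  loop-same {x} h (_▸_ {y} r 2nd) = subst (Reach L'.loopGens x)
    (c-same (≤-trans h (≤-reflexive (sym (L.loop-lab r))))) (loop-same h r ▸ 2nd)

  Hit-same : ∀ {x z} → i < D.lab x → L.Hit x z → L'.Hit x z
  Hit-same h (L.stop d) = L'.stop (dn' d)
  Hit-same {x} {z} h (L.move ¬d k) = L'.move (¬d ∘ dn⁻)
    (subst (λ y → L'.Hit y z) (trans (cong D.ν (sym (c-same h))) (sym (ν≡ _)))
      (Hit-same (≤-trans h (≤-reflexive (sym (trans (D.lab-ν _) (L.lab-c x))))) k))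

  K-same : ∀ {t} → L.Dn t → i < D.lab t → L'.K t ≡ L.K t
  K-same {t} d h = L'.Hit-det (L'.K-hit (dn' d)) (subst (λ y → L'.Hit y (L.K t)) (sym (ν≡ t))
    (Hit-same (≤-trans h (≤-reflexive (sym (D.lab-ν t)))) (L.K-hit d)))

  oK : ∀ {t} → L.Dn t → D.lab t ≡ suc i → o (L.K t) ≡ not (o t)
  oK = L.K-colour o flips
  oα : ∀ {t} → L.Dn t → D.lab t ≡ suc i → o (D.α t) ≡ not (o t)
  oα = L.α-colour o flips

  β'K : ∀ {t} → L.Dn t → D.lab t ≡ suc i → o t ≡ false → D'.β (L.K t) ≡ D.β t
  β'K {t} d e h = trans (β-true (L.K-dn d) (trans (L.K-lab d) e) (trans (oK d e) (cong not h))) (cong D.β (L.KK d))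

  β'α : ∀ {t} → L.Dn t → D.lab t ≡ suc i → o t ≡ true → D'.β (D.α t) ≡ D.β t
  β'α {t} d e h = trans (β-false (L.dn-α d) (trans (D.lab-α t) e) (trans (oα d e) (cong not h))) (cong D.β (D.αα t))

  -- `Step` prescribes the new `β` at the descending flags that move; its values at ascending flags
  -- follow since it is an involution.
  β'-up : ∀ {x} → L.Up x → D.lab x ≡ i →
    (o (D.β x) ≡ true × D'.β x ≡ D.α (D.β x)) ⊎ (o (D.β x) ≡ false × D'.β x ≡ L.K (D.β x))
  β'-up {x} u e with o (D.β x) in h
  ... | true  = inj₁ (refl , D'-eq (β'α (L.dn-β u) (L.up-lab u e) h))
    where
    D'-eq : ∀ {y} → D'.β y ≡ D.β (D.β x) → D'.β x ≡ y
    D'-eq {y} q = trans (cong D'.β (trans (sym (D.ββ x)) (sym q))) (D'.ββ y)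
  ... | false = inj₂ (refl , D'-eq (β'K (L.dn-β u) (L.up-lab u e) h))
    where
    D'-eq : ∀ {y} → D'.β y ≡ D.β (D.β x) → D'.β x ≡ y
    D'-eq {y} q = trans (cong D'.β (trans (sym (D.ββ x)) (sym q))) (D'.ββ y)

  -- The partner of an ascending flag moves to the next descending flag of its loop, by `α` or by
  -- `K`, and both change the colour.
  o-β'-up : ∀ {x} → L.Up x → D.lab x ≡ i → o (D'.β x) ≡ not (o (D.β x))
  o-β'-up u e with β'-up u e
  ... | inj₁ (_ , q) = trans (cong o q) (oα (L.dn-β u) (L.up-lab u e))
  ... | inj₂ (_ , q) = trans (cong o q) (oK (L.dn-β u) (L.up-lab u e))

  loop-β'-up : ∀ {x} → L.Up x → D.lab x ≡ i → Reach L.loopGens (D.β x) (D'.β x)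
  loop-β'-up u e with β'-up u e
  ... | inj₁ (_ , q) = subst (Reach L.loopGens _) (trans (L.c-steep (L.dn⇒¬flat (L.dn-β u))) (sym q)) (done ▸ 2nd)
  ... | inj₂ (_ , q) = subst (Reach L.loopGens _) (sym q) (L.K-loop (L.dn-β u))

  -- Loops, walks and `K` at label `i + 1` are common to both structures, so the shift against the
  -- direction is a shift along the complementary colouring. Conjugating `K` by the new `β` restores
  -- the old `α` at ascending flags.
  step-sym : Step D' D i (not ∘ o)
  step-sym = record
    { ν≡ = λ x → sym (ν≡ x)
    ; lab≡ = λ x → sym (lab≡ x)
    ; rt≡ = sym rt≡
    ; labβ≡ = λ x → sym (labβ≡ x)
    ; α-off = λ h → sym (α-off λ (u , e) → h (up' u , trans (lab≡ _) e))
    ; β-off = λ h k → sym (β-off (λ (u , e) → h (up' u , trans (lab≡ _) e)) (λ (d , e) → k (dn' d , trans (lab≡ _) e)))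
    ; flips = λ x e → let e' = trans (sym (lab≡ x)) e
                          p , q = flips x e' in
        cong not (trans (cong o (ν≡ x)) p) , cong not (trans (cong o (c-same (≤-reflexive (sym e')))) q)
    ; β-true = λ {t} d' e h → let d = dn⁻ d' ; e' = trans (sym (lab≡ t)) e in
        trans (sym (β'K d e' (not-elim h))) (cong D'.β (sym (K-same d (≤-reflexive (sym e')))))
    ; β-false = λ {t} d' e h → let d = dn⁻ d' ; e' = trans (sym (lab≡ t)) e in
        trans (sym (β'α d e' (𝔹ₚ.not-injective h))) (cong D'.β (sym (α-off λ (u , _) → L.dn⇒¬up d u)))
    ; α-on = λ {x} u' e → α-on' (up⁻ u') (trans (sym (lab≡ x)) e)
    }
    where
    α-on' : ∀ {x} → L.Up x → D.lab x ≡ i → D.α x ≡ D'.β (L'.K (D'.β x))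
    α-on' {x} u e with β'-up u e
    ... | inj₁ (h , q) = begin
      D.α x                   ≡⟨ cong D.α (D.ββ x) ⟨
      D.α (D.β (D.β x))       ≡⟨ D.comm (D.β x) ⟨
      D.β (D.α w)             ≡⟨ cong D.β (L.KK dα) ⟨
      D.β (L.K (L.K (D.α w))) ≡⟨ β-true (L.K-dn dα) (trans (L.K-lab dα) eα) oKα ⟨
      D'.β (L.K (D.α w))      ≡⟨ cong D'.β (K-same dα (≤-reflexive (sym eα))) ⟨
      D'.β (L'.K (D.α w))     ≡⟨ cong (D'.β ∘ L'.K) q ⟨
      D'.β (L'.K (D'.β x))    ∎
      where
      open ≡-Reasoning
      w : Fin m
      w = D.β x
      dα : L.Dn (D.α w)
      dα = L.dn-α (L.dn-β u)
      eα : D.lab (D.α w) ≡ suc i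
      eα = trans (D.lab-α w) (L.up-lab u e)
      oKα : o (L.K (D.α w)) ≡ true
      oKα = trans (oK dα eα) (trans (cong not (oα (L.dn-β u) (L.up-lab u e))) (trans (𝔹ₚ.not-involutive _) h))
    ... | inj₂ (h , q) = begin
      D.α x                   ≡⟨ cong D.α (D.ββ x) ⟨
      D.α (D.β (D.β x))       ≡⟨ D.comm (D.β x) ⟨
      D.β (D.α w)             ≡⟨ β-false dw ew h ⟨
      D'.β w                  ≡⟨ cong D'.β (L.KK dw) ⟨
      D'.β (L.K (L.K w))      ≡⟨ cong D'.β (K-same (L.K-dn dw) (≤-reflexive (sym (trans (L.K-lab dw) ew)))) ⟨
      D'.β (L'.K (L.K w))     ≡⟨ cong (D'.β ∘ L'.K) q ⟨
      D'.β (L'.K (D'.β x))    ∎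
      where
      open ≡-Reasoning
      w : Fin m
      w = D.β x
      dw : L.Dn w
      dw = L.dn-β u
      ew : D.lab w ≡ suc i
      ew = L.up-lab u e

module StepHybrid {m} {D D' : Str m} {i : ℕ} {o : Fin m → Bool} (1≤i : 1 ≤ i) (S : Step D D' i o) where
  open StepFacts S
  open Step S
  private
    module S' = Step step-sym

  up-not-keep : ∀ {x} → L.Up x → D.lab x ≡ i → ¬ L.Keep i x
  up-not-keep u e (inj₁ f) = L.up⇒¬flat u f
  up-not-keep u e (inj₂ (_ , q)) = <⇒≱ (≤-reflexive (sym (L.up-lab u e))) q

  keep-off : ∀ {x} → L.Keep i x → D'.β x ≡ D.β x
  keep-off (inj₁ f) = β-flat f
  keep-off (inj₂ (p , q)) = β-off
    (λ (u , e) → <⇒≱ (≤-reflexive (sym (L.up-lab u e))) q)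
    (λ (d , e) → <⇒≱ (≤-reflexive (sym e)) p)

  keep-up : ∀ {x} → L.Keep i x → L'.Keep (suc i) x
  keep-up (inj₁ f) = inj₁ (flat' f)
  keep-up {x} (inj₂ (p , q)) = inj₂ (≤-trans (≤-reflexive (lab≡ x)) (m≤n⇒m≤1+n p)
                                   , ≤-trans (≤-reflexive (labβ≡ x)) (m≤n⇒m≤1+n q))

  up-keep' : ∀ {x} → L.Up x → D.lab x ≡ i → L'.Keep (suc i) x
  up-keep' {x} u e = inj₂ (≤-trans (≤-reflexive (trans (lab≡ x) e)) (n≤1+n i)
                          , ≤-reflexive (trans (labβ≡ x) (L.up-lab u e)))

  dn-keep' : ∀ {x} → L.Dn x → D.lab x ≡ suc i → L'.Keep (suc i) x
  dn-keep' {x} d e = inj₂ (≤-reflexive (trans (lab≡ x) e)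
                          , ≤-trans (≤-reflexive (trans (labβ≡ x) (L.dn-lab d e))) (n≤1+n i))

  crossing : ∀ {x} → D.lab x ≤ i → ¬ L.Keep i x → L.Up x × D.lab x ≡ i
  crossing {x} h ¬k with L.kind x
  ... | L.flat f = ⊥-elim (¬k (inj₁ f))
  ... | L.dn d = ⊥-elim (¬k (inj₂ (h , ≤-trans (n≤1+n _) (≤-trans (≤-reflexive (sym d)) h))))
  ... | L.up u with m≤n⇒m<n∨m≡n h
  ... | inj₂ e = u , e
  ... | inj₁ l = ⊥-elim (¬k (inj₂ (h , ≤-trans (≤-reflexive u) l)))

  private
    R : Fin m → Fin m → Set
    R = Reach (D.ν ∷ L.b i ∷ [])
    R' : Fin m → Fin m → Set
    R' = Reach (D'.ν ∷ L'.b (suc i) ∷ [])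

    R'-sym : ∀ {x y} → R' x y → R' y x
    R'-sym = Reach-sym (D'.νν ∷ (λ x → proj₁ (L'.b-inv (suc i) x)) ∷ [])

  -- A turn `α` of the old contour at an ascending flag of label `i` is `β`, `K`, `β` in `D'`: up,
  -- along a walk of label `i + 1`, and down again. These excursions cover label `i + 1`, since by
  -- `high` every flag there lies on a walk with a descending end, and `β` takes that end to the old
  -- contour.
  hybrid-step : L.Hybrid i → L'.Hybrid (suc i)
  hybrid-step H = record { low = low ; high = high }
    where
    module H = L.Hybrid H

    β'-move : ∀ {x} → L'.Keep (suc i) x → R' x (D'.β x)
    β'-move {x} k = subst (R' x) (L'.b-keep k) (done ▸ 2nd)

    b-move : ∀ {y} → D.lab y ≤ i → R' y (L.b i y)
    b-move {y} h with L.keep? i y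
    ... | yes k = subst (R' y) (keep-off k) (β'-move (keep-up k))
    ... | no ¬k with crossing h ¬k
    ... | u , e = subst (R' y) (sym (S'.α-on (up' u) (trans (lab≡ y) e)))
          (Reach-trans (β'-move (up-keep' u e)) (Reach-trans
            (L'.P⇒b (trans (labβ≡ y) (L.up-lab u e)) (L'.K-P dβ))
            (β'-move (dn-keep' (dn⁻ (L'.K-dn dβ)) (trans (sym (lab≡ _)) (trans (L'.K-lab dβ) (trans (labβ≡ y) (L.up-lab u e))))))))
      where
      dβ : L'.Dn (D'.β y)
      dβ = L'.dn-β (up' u)

    lower : ∀ {x} → R D.rt x → D.lab x ≤ i × R' D.rt x
    lower = Reach-fold (λ x → D.lab x ≤ i × R' D.rt x)
      ( (λ y (h , r) → ≤-trans (≤-reflexive (D.lab-ν y)) h , subst (R' D.rt) (ν≡ y) (r ▸ 1st))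
      ∷ (λ y (h , r) → L.b-lab≤ i y h , Reach-trans r (b-move h))
      ∷ []) (≤-trans (≤-reflexive D.lab-rt) 1≤i , done)

    low : ∀ x → D'.lab x ≤ suc i → R' D'.rt x
    low x h with m≤n⇒m<n∨m≡n (≤-trans (≤-reflexive (sym (lab≡ x))) h)
    ... | inj₁ (s≤s l) = subst (λ r → R' r x) (sym rt≡) (proj₂ (lower (H.low x l)))
    ... | inj₂ e with H.high x (≤-reflexive (sym e))
    ... | t , d , p = subst (λ r → R' r x) (sym rt≡)
          (Reach-trans (proj₂ (lower (H.low (D'.β t) (≤-reflexive (trans (sym (lab≡ _)) (trans (labβ≡ t) (L.dn-lab d et)))))))
            (Reach-trans (R'-sym (β'-move (dn-keep' d et)))
              (R'-sym (L'.P⇒b (trans (lab≡ x) e) (P-same (≤-reflexive (sym e)) p)))))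
      where
      et : D.lab t ≡ suc i
      et = trans (L.P-lab p) e

    high : ∀ x → suc i < D'.lab x → ∃ λ t → L'.Dn t × L'.P x t
    high x h = let h' = ≤-trans (n≤1+n _) (≤-trans h (≤-reflexive (lab≡ x)))
                   t , d , p = H.high x h' in t , dn' d , P-same h' p

  -- Excursions of the new contour to label `i + 1` are contracted. `above` records the descending
  -- flag `t` by which the excursion entered; by `P-ends` it leaves at `t` or at `K t`, and in the
  -- second case it amounts to one turn `α` of the old contour.
  hybrid-unstep : L'.Hybrid (suc i) → L.Hybrid i
  hybrid-unstep H = record { low = low ; high = high }
    where
    module H = L'.Hybrid H

    data State (y : Fin m) : Set where
      below : D.lab y ≤ i → R D.rt y → State y
      above : ∀ {t} → L.Dn t → D.lab t ≡ suc i → L.P t y → R D.rt (D'.β t) → State y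

    lab-β't : ∀ {t} → L.Dn t → D.lab t ≡ suc i → D.lab (D'.β t) ≡ i
    lab-β't {t} d e = trans (sym (lab≡ _)) (trans (labβ≡ t) (L.dn-lab d e))

    up-β't : ∀ {t} → L.Dn t → L.Up (D'.β t)
    up-β't d = up⁻ (L'.up-β (dn' d))

    move-b : ∀ y → State y → State (L'.b (suc i) y)
    move-b y (below h r) with L.keep? i y
    ... | yes k = subst State (trans (L.b-keep k) (trans (sym (keep-off k)) (sym (L'.b-keep (keep-up k)))))
          (below (L.b-lab≤ i y h) (r ▸ 2nd))
    ... | no ¬k with crossing h ¬k
    ... | u , e = subst State (sym (L'.b-keep (up-keep' u e)))
          (above (dn⁻ (L'.dn-β (up' u))) (trans (sym (lab≡ _)) (trans (labβ≡ y) (L.up-lab u e))) done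
            (subst (R D.rt) (sym (D'.ββ y)) r))
    move-b y (above {t} d e p r) with L.kind y
    ... | L.flat f = subst State (trans (L.pc-else (λ d → L.dn⇒¬flat d f))
            (trans (L.c-flat f) (trans (sym (β-flat f)) (sym (L'.b-keep (inj₁ (flat' f))))))) (above d e (p ▸ 2nd) r)
    ... | L.up u = subst State (trans (L.pc-else (λ d → L.dn⇒¬up d u)) (trans (L.c-steep (L.up⇒¬flat u))
            (trans (sym (α-off λ (_ , e') → ℕₚ.1+n≢n (trans (sym (trans (L.P-lab p) e)) e')))
              (sym (L'.b-cross λ { (inj₁ f) → L.up⇒¬flat u (flat⁻ f)
                                 ; (inj₂ (_ , q)) → <⇒≱ (≤-reflexive (sym (trans (labβ≡ y) (L.up-lab u (trans (L.P-lab p) e))))) q })))))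
            (above d e (p ▸ 2nd) r)
    ... | L.dn dy = subst State (sym (L'.b-keep (dn-keep' dy (trans (L.P-lab p) e)))) (below
            (≤-reflexive (lab-β't dy (trans (L.P-lab p) e))) (land (L.P-ends d dy p)))
      where
      land : y ≡ t ⊎ y ≡ L.K t → R D.rt (D'.β y)
      land (inj₁ q) = subst (λ z → R D.rt (D'.β z)) (sym q) r
      land (inj₂ q) = subst (R D.rt) (begin
          L.b i (D'.β t)                 ≡⟨ L.b-cross (up-not-keep (up-β't d) (lab-β't d e)) ⟩
          D.α (D'.β t)                   ≡⟨ S'.α-on (L'.up-β (dn' d)) (trans (lab≡ _) (lab-β't d e)) ⟩
          D'.β (L'.K (D'.β (D'.β t)))    ≡⟨ cong (D'.β ∘ L'.K) (D'.ββ t) ⟩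
          D'.β (L'.K t)                  ≡⟨ cong D'.β (K-same d (≤-reflexive (sym e))) ⟩
          D'.β (L.K t)                   ≡⟨ cong D'.β q ⟨
          D'.β y                         ∎) (r ▸ 2nd)
        where open ≡-Reasoning

    state : ∀ {y} → R' D.rt y → State y
    state = Reach-fold State
      ( (λ { y (below h r) → subst State (sym (ν≡ y)) (below (≤-trans (≤-reflexive (D.lab-ν y)) h) (r ▸ 1st))
           ; y (above d e p r) → subst State (sym (ν≡ y)) (above d e (p ▸ 1st) r) })
      ∷ move-b ∷ []) (below (≤-trans (≤-reflexive D.lab-rt) 1≤i) done)

    state-of : ∀ x → D.lab x ≤ suc i → State x
    state-of x h = state (subst (λ r → R' r x) rt≡ (H.low x (≤-trans (≤-reflexive (lab≡ x)) h)))

    low : ∀ x → D.lab x ≤ i → R D.rt x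
    low x h with state-of x (m≤n⇒m≤1+n h)
    ... | below _ r = r
    ... | above d e p _ = ⊥-elim (<⇒≱ (≤-reflexive (sym (trans (L.P-lab p) e))) h)

    high : ∀ x → i < D.lab x → ∃ λ t → L.Dn t × L.P x t
    high x h with m≤n⇒m<n∨m≡n h
    ... | inj₁ l = let t , d , p = H.high x (≤-trans l (≤-reflexive (sym (lab≡ x)))) in t , dn⁻ d , P-same⁻ h p
    ... | inj₂ e with state-of x (≤-reflexive (sym e))
    ... | below l _ = ⊥-elim (<⇒≱ h l)
    ... | above {t} d _ p _ = t , d , L.P-sym p

-- Existence of the shift for a given direction

module Flip {m} (D : Str m) (i : ℕ) (o : Fin m → Bool) (fl : Levels.Flips D (suc i) o) where
  open Str D
  open Levels D

  private
    OnUp OnDn : Fin m → Set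
    OnUp x = Up x × lab x ≡ i
    OnDn x = Dn x × lab x ≡ suc i

    onUp? : ∀ x → Dec (OnUp x)
    onUp? x = (lab (β x) ℕ.≟ suc (lab x)) ×-dec (lab x ℕ.≟ i)

    onDn? : ∀ x → Dec (OnDn x)
    onDn? x = Dn? x ×-dec (lab x ℕ.≟ suc i)

    up⇒dn : ∀ {x} → OnUp x → OnDn (β x)
    up⇒dn (u , e) = dn-β u , up-lab u e

    dn⇒up : ∀ {x} → OnDn x → OnUp (β x)
    dn⇒up (d , e) = up-β d , dn-lab d e

    off-dn : ∀ {x} → OnUp x → ¬ OnDn x
    off-dn (u , _) (d , _) = dn⇒¬up d u

    -- The descending flags of a loop form a cycle in which neighbours are joined alternately by `α`
    -- and by `K`. Since `o` alternates as well, `θ` moves all of them one place in the same sense,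
    -- and `θ⁻` moves them back.
    θ θ⁻ : Fin m → Fin m
    θ x  = if o x then K x else α x
    θ⁻ x = if o x then α x else K x

    K-on : ∀ {x} → OnDn x → OnDn (K x)
    K-on (d , e) = K-dn d , trans (K-lab d) e
    α-on : ∀ {x} → OnDn x → OnDn (α x)
    α-on (d , e) = dn-α d , trans (lab-α _) e
    α-up : ∀ {x} → OnUp x → OnUp (α x)
    α-up (u , e) = up-α u , trans (lab-α _) e

    oK : ∀ {x} → OnDn x → o (K x) ≡ not (o x)
    oK (d , e) = K-colour o fl d e
    oα : ∀ {x} → OnDn x → o (α x) ≡ not (o x)
    oα (d , e) = α-colour o fl d e

    θ-true : ∀ {x} → o x ≡ true → θ x ≡ K x
    θ-true {x} h rewrite h = refl
    θ-false : ∀ {x} → o x ≡ false → θ x ≡ α x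
    θ-false {x} h rewrite h = refl
    θ⁻-true : ∀ {x} → o x ≡ true → θ⁻ x ≡ α x
    θ⁻-true {x} h rewrite h = refl
    θ⁻-false : ∀ {x} → o x ≡ false → θ⁻ x ≡ K x
    θ⁻-false {x} h rewrite h = refl

    θ-on : ∀ {x} → OnDn x → OnDn (θ x)
    θ-on {x} h with o x
    ... | true  = K-on h
    ... | false = α-on h
    θ⁻-on : ∀ {x} → OnDn x → OnDn (θ⁻ x)
    θ⁻-on {x} h with o x
    ... | true  = α-on h
    ... | false = K-on h

    θθ⁻ : ∀ {x} → OnDn x → θ (θ⁻ x) ≡ x
    θθ⁻ {x} h with o x in e
    ... | true  = trans (θ-false (trans (oα h) (cong not e))) (αα x)
    ... | false = trans (θ-true (trans (oK h) (cong not e))) (KK (proj₁ h))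

    θ⁻θ : ∀ {x} → OnDn x → θ⁻ (θ x) ≡ x
    θ⁻θ {x} h with o x in e
    ... | true  = trans (θ⁻-false (trans (oK h) (cong not e))) (KK (proj₁ h))
    ... | false = trans (θ⁻-true (trans (oα h) (cong not e))) (αα x)

    -- A rotation by one place exchanges the two kinds of neighbour. Hence the new `α` at ascending
    -- flags must come from `K` if it is to commute with the new `β`.
    θα : ∀ {x} → OnDn x → θ (α x) ≡ K (θ x)
    θα {x} h with o x in e
    ... | true  = trans (θ-false (trans (oα h) (cong not e))) (trans (αα x) (sym (KK (proj₁ h))))
    ... | false = θ-true (trans (oα h) (cong not e))

    θ⁻K : ∀ {x} → OnDn x → θ⁻ (K x) ≡ α (θ⁻ x)
    θ⁻K {x} h with o x in e
    ... | true  = trans (θ⁻-false (trans (oK h) (cong not e))) (trans (KK (proj₁ h)) (sym (αα x)))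
    ... | false = θ⁻-true (trans (oK h) (cong not e))

  β' α' : Fin m → Fin m
  β' x with onDn? x | onUp? x
  ... | yes _ | _     = β (θ x)
  ... | no _  | yes _ = θ⁻ (β x)
  ... | no _  | no _  = β x
  α' x with onUp? x
  ... | yes _ = β (K (β x))
  ... | no _  = α x

  private
    β'-dn : ∀ {x} → OnDn x → β' x ≡ β (θ x)
    β'-dn {x} h with onDn? x | onUp? x
    ... | yes _ | _ = refl
    ... | no ¬h | _ = ⊥-elim (¬h h)

    β'-up : ∀ {x} → OnUp x → β' x ≡ θ⁻ (β x)
    β'-up {x} h with onDn? x | onUp? x
    ... | yes h' | _     = ⊥-elim (off-dn h h')
    ... | no _   | yes _ = refl
    ... | no _   | no ¬h = ⊥-elim (¬h h)

    β'-off : ∀ {x} → ¬ OnUp x → ¬ OnDn x → β' x ≡ β x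
    β'-off {x} h k with onDn? x | onUp? x
    ... | yes h' | _      = ⊥-elim (k h')
    ... | no _   | yes h' = ⊥-elim (h h')
    ... | no _   | no _   = refl

    α'-up : ∀ {x} → OnUp x → α' x ≡ β (K (β x))
    α'-up {x} h with onUp? x
    ... | yes _ = refl
    ... | no ¬h = ⊥-elim (¬h h)

    α'-off : ∀ {x} → ¬ OnUp x → α' x ≡ α x
    α'-off {x} h with onUp? x
    ... | yes h' = ⊥-elim (h h')
    ... | no _   = refl

    data Place (x : Fin m) : Set where
      onDn : OnDn x → Place x
      onUp : OnUp x → Place x
      off  : ¬ OnUp x → ¬ OnDn x → Place x

    place : ∀ x → Place x
    place x with onUp? x | onDn? x
    ... | yes h | _     = onUp h
    ... | no _  | yes h = onDn h
    ... | no h  | no k  = off h k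

    off-α : ∀ {x} → ¬ OnUp x → ¬ OnUp (α x)
    off-α h k = h (subst OnUp (αα _) (α-up k))
    off-α-dn : ∀ {x} → ¬ OnDn x → ¬ OnDn (α x)
    off-α-dn h k = h (subst OnDn (αα _) (α-on k))
    off-β-up : ∀ {x} → ¬ OnDn x → ¬ OnUp (β x)
    off-β-up h k = h (subst OnDn (ββ _) (up⇒dn k))
    off-β-dn : ∀ {x} → ¬ OnUp x → ¬ OnDn (β x)
    off-β-dn h k = h (subst OnUp (ββ _) (dn⇒up k))

    α'-upOn : ∀ {x} → OnUp x → OnUp (α' x)
    α'-upOn h = subst OnUp (sym (α'-up h)) (dn⇒up (K-on (up⇒dn h)))

    labβ' : ∀ x → lab (β' x) ≡ lab (β x)
    labβ' x with place x
    ... | onDn h = trans (cong lab (β'-dn h)) (trans (proj₂ (dn⇒up (θ-on h))) (sym (proj₂ (dn⇒up h))))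
    ... | onUp h = trans (cong lab (β'-up h)) (trans (proj₂ (θ⁻-on (up⇒dn h))) (sym (proj₂ (up⇒dn h))))
    ... | off h k = cong lab (β'-off h k)

    ββ' : ∀ x → β' (β' x) ≡ x
    ββ' x with place x
    ... | onDn h = begin
      β' (β' x)         ≡⟨ cong β' (β'-dn h) ⟩
      β' (β (θ x))      ≡⟨ β'-up (dn⇒up (θ-on h)) ⟩
      θ⁻ (β (β (θ x)))  ≡⟨ cong θ⁻ (ββ (θ x)) ⟩
      θ⁻ (θ x)          ≡⟨ θ⁻θ h ⟩
      x                 ∎ where open ≡-Reasoning
    ... | onUp h = begin
      β' (β' x)         ≡⟨ cong β' (β'-up h) ⟩
      β' (θ⁻ (β x))     ≡⟨ β'-dn (θ⁻-on (up⇒dn h)) ⟩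
      β (θ (θ⁻ (β x)))  ≡⟨ cong β (θθ⁻ (up⇒dn h)) ⟩
      β (β x)           ≡⟨ ββ x ⟩
      x                 ∎ where open ≡-Reasoning
    ... | off h k = trans (cong β' (β'-off h k)) (trans (β'-off (off-β-up k) (off-β-dn h)) (ββ x))

    steep-β' : ∀ {x y} → lab x ≡ lab y → ¬ Flat y → β' y ≢ x
    steep-β' {x} {y} e ¬f q = ¬f (trans (sym (labβ' y)) (trans (cong lab q) e))

    β'-free : ∀ x → β' x ≢ x
    β'-free x with place x
    ... | onDn (d , _) = steep-β' refl (dn⇒¬flat d)
    ... | onUp (u , _) = steep-β' refl (up⇒¬flat u)
    ... | off h k = λ q → proj₂ (β-inv x) (trans (sym (β'-off h k)) q)

    αα' : ∀ x → α' (α' x) ≡ x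
    αα' x with place x
    ... | onDn h = trans (cong α' (α'-off λ u → off-dn u h)) (trans (α'-off (off-α λ u → off-dn u h)) (αα x))
    ... | off h _ = trans (cong α' (α'-off h)) (trans (α'-off (off-α h)) (αα x))
    ... | onUp h = begin
      α' (α' x)                     ≡⟨ α'-up (α'-upOn h) ⟩
      β (K (β (α' x)))              ≡⟨ cong (β ∘ K ∘ β) (α'-up h) ⟩
      β (K (β (β (K (β x)))))       ≡⟨ cong (β ∘ K) (ββ _) ⟩
      β (K (K (β x)))               ≡⟨ cong β (KK (proj₁ (up⇒dn h))) ⟩
      β (β x)                       ≡⟨ ββ x ⟩
      x                             ∎ where open ≡-Reasoning

    α'-free : ∀ x → α' x ≢ x
    α'-free x q with place x
    ... | onDn h = proj₂ (α-inv x) (trans (sym (α'-off λ u → off-dn u h)) q)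
    ... | off h _ = proj₂ (α-inv x) (trans (sym (α'-off h)) q)
    -- A fixed point here would give a fixed point of `K`, but `K` changes the colour `o`.
    ... | onUp h = 𝔹ₚ.not-¬ refl (trans (cong o (sym K-fix)) (oK (up⇒dn h)))
      where
      K-fix : K (β x) ≡ β x
      K-fix = invol-injective {f = β} ββ (trans (sym (α'-up h)) (trans q (sym (ββ x))))

    lab-α' : ∀ x → lab (α' x) ≡ lab x
    lab-α' x with place x
    ... | onDn h = trans (cong lab (α'-off λ u → off-dn u h)) (lab-α x)
    ... | off h _ = trans (cong lab (α'-off h)) (lab-α x)
    ... | onUp h = trans (proj₂ (α'-upOn h)) (sym (proj₂ h))

    comm' : ∀ x → β' (α' x) ≡ α' (β' x)
    comm' x with place x
    ... | off h k = begin
      β' (α' x)  ≡⟨ cong β' (α'-off h) ⟩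
      β' (α x)   ≡⟨ β'-off (off-α h) (off-α-dn k) ⟩
      β (α x)    ≡⟨ comm x ⟩
      α (β x)    ≡⟨ α'-off (off-β-up k) ⟨
      α' (β x)   ≡⟨ cong α' (β'-off h k) ⟨
      α' (β' x)  ∎ where open ≡-Reasoning
    ... | onDn h = begin
      β' (α' x)            ≡⟨ cong β' (α'-off λ u → off-dn u h) ⟩
      β' (α x)             ≡⟨ β'-dn (α-on h) ⟩
      β (θ (α x))          ≡⟨ cong β (θα h) ⟩
      β (K (θ x))          ≡⟨ cong (β ∘ K) (ββ (θ x)) ⟨
      β (K (β (β (θ x))))  ≡⟨ α'-up (dn⇒up (θ-on h)) ⟨
      α' (β (θ x))         ≡⟨ cong α' (β'-dn h) ⟨
      α' (β' x)            ∎ where open ≡-Reasoning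
    ... | onUp h = begin
      β' (α' x)               ≡⟨ β'-up (α'-upOn h) ⟩
      θ⁻ (β (α' x))           ≡⟨ cong (θ⁻ ∘ β) (α'-up h) ⟩
      θ⁻ (β (β (K (β x))))    ≡⟨ cong θ⁻ (ββ _) ⟩
      θ⁻ (K (β x))            ≡⟨ θ⁻K (up⇒dn h) ⟩
      α (θ⁻ (β x))            ≡⟨ α'-off (λ u → off-dn u (θ⁻-on (up⇒dn h))) ⟨
      α' (θ⁻ (β x))           ≡⟨ cong α' (β'-up h) ⟨
      α' (β' x)               ∎ where open ≡-Reasoning

    free' : ∀ x → β' (α' x) ≢ x
    free' x with place x
    ... | onDn h = steep-β' (sym (lab-α' x)) λ f → dn⇒¬flat (dn-α (proj₁ h)) (subst Flat (α'-off λ u → off-dn u h) f)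
    ... | onUp h = steep-β' (sym (lab-α' x)) (up⇒¬flat (proj₁ (α'-upOn h)))
    ... | off h k = λ q → free x (trans (sym (trans (cong β' (α'-off h)) (β'-off (off-α h) (off-α-dn k)))) q)

  flip : Str m
  flip = record
    { ν = ν ; α = α' ; β = β' ; lab = lab ; rt = rt
    ; ν-inv = ν-inv
    ; α-inv = λ x → αα' x , α'-free x
    ; β-inv = λ x → ββ' x , β'-free x
    ; comm = comm' ; free = free'
    ; lab-ν = lab-ν ; lab-α = lab-α'
    ; lab-β = λ x → ≤-trans (≤-reflexive (labβ' x)) (lab-β x)
    ; lab-pos = lab-pos ; lab-rt = lab-rt }

  flip-step : Step D flip i o
  flip-step = record
    { ν≡ = λ _ → refl ; lab≡ = λ _ → refl ; rt≡ = refl ; labβ≡ = labβ'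
    ; α-off = α'-off ; β-off = β'-off ; flips = fl
    ; β-true = λ d e h → trans (β'-dn (d , e)) (cong β (θ-true h))
    ; β-false = λ d e h → trans (β'-dn (d , e)) (cong β (θ-false h))
    ; α-on = λ u e → α'-up (u , e) }

-- Isomorphisms of labelled structures

record Iso {m m'} (D : Str m) (D' : Str m') : Set where
  private
    module D = Str D
    module D' = Str D'
  field
    φ : Fin m ↔ Fin m'
  f : Fin m → Fin m'
  f = Inverse.to φ
  field
    φν  : ∀ x → f (D.ν x) ≡ D'.ν (f x)
    φα  : ∀ x → f (D.α x) ≡ D'.α (f x)
    φβ  : ∀ x → f (D.β x) ≡ D'.β (f x)
    φlab : ∀ x → D'.lab (f x) ≡ D.lab x
    φrt : f D.rt ≡ D'.rt

↔-id : ∀ {A : Set} → A ↔ A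
↔-id = record { to = λ x → x ; from = λ x → x ; to-cong = cong _ ; from-cong = cong _ ; inverse = (λ e → e) , (λ e → e) }

↔-flip : ∀ {A B : Set} → A ↔ B → B ↔ A
↔-flip φ = record { to = Inverse.from φ ; from = Inverse.to φ ; to-cong = cong _ ; from-cong = cong _
  ; inverse = Inverse.inverseʳ φ , Inverse.inverseˡ φ }

↔-comp : ∀ {A B C : Set} → A ↔ B → B ↔ C → A ↔ C
↔-comp φ ψ = record { to = Inverse.to ψ ∘ Inverse.to φ ; from = Inverse.from φ ∘ Inverse.from ψ
  ; to-cong = cong _ ; from-cong = cong _
  ; inverse = (λ e → Inverse.inverseˡ ψ (Inverse.inverseˡ φ e)) , (λ e → Inverse.inverseʳ φ (Inverse.inverseʳ ψ e)) }

↔-natural : ∀ {A B : Set} (φ : A ↔ B) {g : A → A} {h : B → B} →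
  (∀ x → Inverse.to φ (g x) ≡ h (Inverse.to φ x)) → ∀ y → Inverse.from φ (h y) ≡ g (Inverse.from φ y)
↔-natural φ {g} {h} e y = to-injective φ (trans (Inverse.strictlyInverseˡ φ (h y))
  (sym (trans (e _) (cong h (Inverse.strictlyInverseˡ φ y)))))

Iso-refl : ∀ {m} {D : Str m} → Iso D D
Iso-refl = record { φ = ↔-id ; φν = λ _ → refl ; φα = λ _ → refl ; φβ = λ _ → refl ; φlab = λ _ → refl ; φrt = refl }

Iso-sym : ∀ {m m'} {D : Str m} {D' : Str m'} → Iso D D' → Iso D' D
Iso-sym {D = D} {D'} I = record
  { φ = ↔-flip I.φ
  ; φν = ↔-natural I.φ I.φν ; φα = ↔-natural I.φ I.φα ; φβ = ↔-natural I.φ I.φβ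
  ; φlab = λ y → trans (sym (I.φlab _)) (cong (Str.lab D') (Inverse.strictlyInverseˡ I.φ y))
  ; φrt = trans (cong (Inverse.from I.φ) (sym I.φrt)) (Inverse.strictlyInverseʳ I.φ _) }
  where module I = Iso I

Iso-trans : ∀ {m m' m''} {D : Str m} {D' : Str m'} {D'' : Str m''} → Iso D D' → Iso D' D'' → Iso D D''
Iso-trans I J = record
  { φ = ↔-comp I.φ J.φ
  ; φν = λ x → trans (cong J.f (I.φν x)) (J.φν _)
  ; φα = λ x → trans (cong J.f (I.φα x)) (J.φα _)
  ; φβ = λ x → trans (cong J.f (I.φβ x)) (J.φβ _)
  ; φlab = λ x → trans (J.φlab _) (I.φlab x)
  ; φrt = trans (cong J.f I.φrt) J.φrt }
  where module I = Iso I
        module J = Iso J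

module IsoFacts {m m'} {D : Str m} {D' : Str m'} (I : Iso D D') where
  open Iso I
  module D = Str D
  module D' = Str D'
  module L = Levels D
  module L' = Levels D'

  φlabβ : ∀ x → D'.lab (D'.β (f x)) ≡ D.lab (D.β x)
  φlabβ x = trans (cong D'.lab (sym (φβ x))) (φlab (D.β x))

  flat' : ∀ {x} → L.Flat x → L'.Flat (f x)
  flat' {x} h = trans (φlabβ x) (trans h (sym (φlab x)))
  dn' : ∀ {x} → L.Dn x → L'.Dn (f x)
  dn' {x} h = trans (φlab x) (trans h (cong suc (sym (φlabβ x))))
  up' : ∀ {x} → L.Up x → L'.Up (f x)
  up' {x} h = trans (φlabβ x) (trans h (cong suc (sym (φlab x))))
  dn⁻ : ∀ {x} → L'.Dn (f x) → L.Dn x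
  dn⁻ {x} h = trans (sym (φlab x)) (trans h (cong suc (φlabβ x)))
  up⁻ : ∀ {x} → L'.Up (f x) → L.Up x
  up⁻ {x} h = trans (sym (φlabβ x)) (trans h (cong suc (φlab x)))

  keep⁻ : ∀ {i x} → L'.Keep i (f x) → L.Keep i x
  keep⁻ {i} {x} (inj₁ h) = inj₁ (trans (sym (φlabβ x)) (trans h (φlab x)))
  keep⁻ {i} {x} (inj₂ (p , q)) = inj₂ (subst (_≤ i) (φlab x) p , subst (_≤ i) (φlabβ x) q)

  keep' : ∀ {i x} → L.Keep i x → L'.Keep i (f x)
  keep' {i} {x} (inj₁ h) = inj₁ (flat' h)
  keep' {i} {x} (inj₂ (p , q)) = inj₂ (subst (_≤ i) (sym (φlab x)) p , subst (_≤ i) (sym (φlabβ x)) q)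

  φb : ∀ i x → f (L.b i x) ≡ L'.b i (f x)
  φb i x with L.keep? i x
  ... | yes k = trans (φβ x) (sym (L'.b-keep (keep' k)))
  ... | no ¬k = trans (φα x) (sym (L'.b-cross (¬k ∘ keep⁻)))

  φHit : ∀ {x z} → L.Hit x z → L'.Hit (f x) (f z)
  φHit (L.stop d) = L'.stop (dn' d)
  φHit {x} {z} (L.move ¬d h) = L'.move (¬d ∘ dn⁻)
    (subst (λ y → L'.Hit y (f z)) (trans (φν _) (cong D'.ν (φb 0 x))) (φHit h))

  φK : ∀ {t} → L.Dn t → f (L.K t) ≡ L'.K (f t)
  φK {t} d = L'.Hit-det (subst (λ y → L'.Hit y (f (L.K t))) (φν t) (φHit (L.K-hit d))) (L'.K-hit (dn' d))

  φloop : ∀ {x y} → Reach L.loopGens x y → Reach L'.loopGens (f x) (f y)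
  φloop = Reach-map f ((λ y → Reach-trans (done ▸ 1st) (Reach-≡ (sym (φν y))))
                      ∷ (λ y → Reach-trans (done ▸ 2nd) (Reach-≡ (sym (φb 0 y)))) ∷ [])

-- The result of a shift is determined by the structure and by the direction at label `i + 1` alone.
-- So two shifts agree when their directions do, whether they were built forwards or backwards.
step-iso : ∀ {m m'} {D E : Str m} {D' E' : Str m'} {i o o'} (I : Iso D D') →
  Step D E i o → Step D' E' i o' → (∀ x → Str.lab D x ≡ suc i → o' (Iso.f I x) ≡ o x) → Iso E E'
step-iso {D = D} {E} {D'} {E'} {i} {o} {o'} I S S' eq = record
  { φ = φ
  ; φν = λ x → trans (cong f (S.ν≡ x)) (trans (φν x) (sym (S'.ν≡ _)))
  ; φα = φα'
  ; φβ = φβ'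
  ; φlab = λ x → trans (S'.lab≡ _) (trans (φlab x) (sym (S.lab≡ x)))
  ; φrt = trans (cong f S.rt≡) (trans φrt (sym S'.rt≡)) }
  where
  open Iso I
  open IsoFacts I
  module S = Step S
  module S' = Step S'
  module F = StepFacts S
  module F' = StepFacts S'
  module E = Str E
  module E' = Str E'

  φα' : ∀ x → f (E.α x) ≡ E'.α (f x)
  φα' x with (D.lab (D.β x) ℕ.≟ suc (D.lab x)) ×-dec (D.lab x ℕ.≟ i)
  ... | yes (u , e) = trans (cong f (S.α-on u e)) (trans (φβ _) (trans (cong D'.β (trans (φK (L.dn-β u)) (cong L'.K (φβ x))))
                        (sym (S'.α-on (up' u) (trans (φlab x) e)))))
  ... | no h = trans (cong f (S.α-off h)) (trans (φα x) (sym (S'.α-off λ (u , e) → h (up⁻ u , trans (sym (φlab x)) e))))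

  φβ-dn : ∀ {t} → L.Dn t → D.lab t ≡ suc i → f (E.β t) ≡ E'.β (f t)
  φβ-dn {t} d e with o t in h
  ... | true  = trans (cong f (S.β-true d e h)) (trans (φβ _) (trans (cong D'.β (φK d))
                  (sym (S'.β-true (dn' d) (trans (φlab t) e) (trans (eq t e) h)))))
  ... | false = trans (cong f (S.β-false d e h)) (trans (φβ _) (trans (cong D'.β (φα t))
                  (sym (S'.β-false (dn' d) (trans (φlab t) e) (trans (eq t e) h)))))

  φβ' : ∀ x → f (E.β x) ≡ E'.β (f x)
  φβ' x with (D.lab (D.β x) ℕ.≟ suc (D.lab x)) ×-dec (D.lab x ℕ.≟ i) | L.Dn? x ×-dec (D.lab x ℕ.≟ suc i)
  ... | _ | yes (d , e) = φβ-dn d e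
  ... | no h | no k = trans (cong f (S.β-off h k)) (trans (φβ x) (sym (S'.β-off
          (λ (u , e) → h (up⁻ u , trans (sym (φlab x)) e)) (λ (d , e) → k (dn⁻ d , trans (sym (φlab x)) e)))))
  -- At an ascending flag the claim follows from the one at its descending partner, `β` being an
  -- involution on both sides.
  ... | yes (u , e) | no _ = begin
    f (E.β x)               ≡⟨ E'.ββ _ ⟨
    E'.β (E'.β (f (E.β x))) ≡⟨ cong E'.β (φβ-dn (F.dn⁻ (F.L'.dn-β (F.up' u))) (trans (sym (S.lab≡ _)) (trans (S.labβ≡ x) (L.up-lab u e)))) ⟨
    E'.β (f (E.β (E.β x)))  ≡⟨ cong (E'.β ∘ f) (E.ββ x) ⟩
    E'.β (f x)              ∎ where open ≡-Reasoning

-- The contour of the part of label at most i, starting at the root.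

even : ℕ → Bool
even zero    = true
even (suc k) = not (even k)

alt : ∀ {A : Set} (f g : A → A) → A → ℕ → A
alt f g r zero    = r
alt f g r (suc k) = if even k then f (alt f g r k) else g (alt f g r k)

module _ {m} (f g : Fin m → Fin m) (r : Fin m) (f-inv : Inv f) (g-inv : Inv g) where

  private
    ff : Involutive f
    ff x = proj₁ (f-inv x)
    gg : Involutive g
    gg x = proj₁ (g-inv x)

    even-double : ∀ d → even (d ℕ.+ d) ≡ true
    even-double zero = refl
    even-double (suc d) = trans (cong (not ∘ even) (ℕₚ.+-suc d d)) (trans (𝔹ₚ.not-involutive _) (even-double d))

    alt-double : ∀ d → alt f g r (d ℕ.+ d) ≡ iter d (g ∘ f) r
    alt-double zero = refl
    alt-double (suc d) = trans (cong (λ n → alt f g r (suc n)) (ℕₚ.+-suc d d)) lemma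
      where
      lemma : alt f g r (suc (suc (d ℕ.+ d))) ≡ g (f (iter d (g ∘ f) r))
      lemma rewrite even-double d = cong (g ∘ f) (alt-double d)

    alt-f : ∀ k → ∃ λ j → alt f g r j ≡ f (alt f g r k)
    alt-f k with even k in e
    ... | true  = suc k , cong (λ b → if b then f (alt f g r k) else g (alt f g r k)) e
    alt-f (suc k) | false with even k
    ... | true = k , sym (ff _)

    alt-g : ∀ k → ∃ λ j → alt f g r j ≡ g (alt f g r k)
    alt-g k with even k in e
    ... | false = suc k , cong (λ b → if b then f (alt f g r k) else g (alt f g r k)) e
    -- The sequence leaves `r` by `f`. It reaches the other neighbour `g r` only when the cycle is
    -- about to close, at the odd index `2d + 1`.
    alt-g zero | true with period (g ∘ f) (λ e → invol-injective {f = f} ff (invol-injective {f = g} gg e)) r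
    ... | d , _ , p = suc (d ℕ.+ d) , trans lemma (trans (sym (gg _)) (cong g p))
      where
      lemma : alt f g r (suc (d ℕ.+ d)) ≡ f (iter d (g ∘ f) r)
      lemma rewrite even-double d = cong f (alt-double d)
    alt-g (suc k) | true with even k
    ... | false = k , sym (gg _)

  alt-cover : ∀ {x} → Reach (f ∷ g ∷ []) r x → ∃ λ k → alt f g r k ≡ x
  alt-cover = Reach-fold (λ x → ∃ λ k → alt f g r k ≡ x)
    ( (λ y (k , e) → let j , q = alt-f k in j , trans q (cong f e))
    ∷ (λ y (k , e) → let j , q = alt-g k in j , trans q (cong g e)) ∷ []) (0 , refl)

alt-map : ∀ {A B : Set} {f g : A → A} {f' g' : B → B} {r r'} (h : A → B) (Q : A → Set) →
  Q r → (∀ x → Q x → Q (f x) × h (f x) ≡ f' (h x)) → (∀ x → Q x → Q (g x) × h (g x) ≡ g' (h x)) →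
  h r ≡ r' → ∀ k → Q (alt f g r k) × h (alt f g r k) ≡ alt f' g' r' k
alt-map h Q qr F G e zero = qr , e
alt-map {f' = f'} {g'} h Q qr F G e (suc k) with even k | alt-map {f' = f'} {g'} h Q qr F G e k
... | true  | q , p = proj₁ (F _ q) , trans (proj₂ (F _ q)) (cong f' p)
... | false | q , p = proj₁ (G _ q) , trans (proj₂ (G _ q)) (cong g' p)

contour : ∀ {m} → Str m → ℕ → ℕ → Fin m
contour D i = alt (Str.ν D) (Levels.b D i) (Str.rt D)

contour-low : ∀ {m} (D : Str m) {i} → 1 ≤ i → ∀ k → Str.lab D (contour D i k) ≤ i
contour-low D {i} 1≤i k = proj₁ (alt-map {f' = ν} {b i} (λ x → x) (λ x → lab x ≤ i)
  (≤-trans (≤-reflexive lab-rt) 1≤i)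
  (λ x h → ≤-trans (≤-reflexive (lab-ν x)) h , refl) (λ x h → b-lab≤ i x h , refl) refl k)
  where open Str D
        open Levels D

contour-cover : ∀ {m} (D : Str m) {i} → Levels.Hybrid D i → ∀ x → Str.lab D x ≤ i → ∃ λ k → contour D i k ≡ x
contour-cover D {i} H x h = alt-cover (Str.ν D) (Levels.b D i) (Str.rt D) (Str.ν-inv D) (Levels.b-inv D i)
  (Levels.Hybrid.low H x h)

-- The canonical direction of the loops

module _ {m} (D : Str m) (i : ℕ) where
  open Str D
  open Levels D

  -- `β` carries the ascending flags of the contour to the loops of label `i + 1`, and the first of
  -- these images on a loop directs it. Since the contour has labels at most `i`, an anchor of label
  -- `i + 1` always comes from an ascending flag of label `i`.
  anchors : (ℕ → Fin m) → ℕ → Fin m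
  anchors p k = β (p k)

  record Canonical (p : ℕ → Fin m) (o : Fin m → Bool) : Set where
    field
      flips : Flips (suc i) o
      norm  : Normal.Norm ν c (anchors p) (λ x → lab x ≡ suc i) o

  lab-closed : ∀ {j} → All (λ h → ∀ y → lab y ≡ j → lab (h y) ≡ j) loopGens
  lab-closed = (λ y e → trans (lab-ν y) e) ∷ (λ y e → trans (lab-c y) e) ∷ []

  canonical-unique : ∀ {p o o'} → Canonical p o → Canonical p o' → ∀ x → lab x ≡ suc i → o x ≡ o' x
  canonical-unique {p} C C' = Normal.norm-unique ν c (anchors p) lab-closed
    (Canonical.flips C) (Canonical.flips C') (Canonical.norm C) (Canonical.norm C')

  module _ (p : ℕ → Fin m) (cover : ∀ x → lab x ≡ suc i → ∃ λ k → Reach loopGens x (anchors p k)) where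
    open Normal ν c (anchors p)

    abstract
      canonical : Fin m → Bool
      canonical = normalColour ν-inv (b-inv 0) lab-closed (λ x → lab x ℕ.≟ suc i) cover

      canonical-spec : Canonical p canonical
      canonical-spec = record
        { flips = normalColour-flips ν-inv (b-inv 0) lab-closed (λ x → lab x ℕ.≟ suc i) cover
        ; norm  = normalColour-norm ν-inv (b-inv 0) lab-closed (λ x → lab x ℕ.≟ suc i) cover }

  P⇒loop : ∀ {x y} → P x y → Reach loopGens x y
  P⇒loop done = done
  P⇒loop (r ▸ 1st) = P⇒loop r ▸ 1st
  P⇒loop {x} (_▸_ {y} r 2nd) with Dn? y
  ... | yes _ = P⇒loop r
  ... | no _  = P⇒loop r ▸ 2nd

canonical-ext : ∀ {m} {D : Str m} {i p p' o} → (∀ k → p k ≡ p' k) → Canonical D i p o → Canonical D i p' o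
canonical-ext {D = D} {p = p} {p'} {o} e C = record
  { flips = flips
  ; norm = λ x q → let k , (r , mn) , h = norm x q in
      k , (subst (Reach loopGens x) (cong β (e k)) r
          , λ j j<k r' → mn j j<k (subst (Reach loopGens x) (cong β (sym (e j))) r'))
        , trans (cong (o ∘ β) (sym (e k))) h }
  where open Canonical C
        open Str D
        open Levels D

-- The shift replaces each anchor of label `i + 1` by a neighbouring descending flag of the same
-- loop. The first index on a loop is unchanged while the colour there is reversed, and
-- complementing the colouring restores `true`.
canonical-step : ∀ {m} {D D' : Str m} {i o p} → (∀ k → Str.lab D (p k) ≤ i) →
  Step D D' i o → Canonical D i p o → Canonical D' i p (not ∘ o)
canonical-step {D = D} {D'} {i} {o} {p} low S C = record
  { flips = Step.flips step-sym
  ; norm = norm' }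
  where
  open StepFacts S
  open Step S
  module C = Canonical C
  module F' = StepFacts step-sym

  rises : ∀ k → D.lab (D.β (p k)) ≡ suc i → L.Up (p k) × D.lab (p k) ≡ i
  rises k e = trans e (cong suc (sym pk)) , pk
    where
    pk : D.lab (p k) ≡ i
    pk = ≤-antisym (low k) (ℕ.s≤s⁻¹ (≤-trans (≤-reflexive (sym e)) (D.lab-β (p k))))

  norm' : Normal.Norm D'.ν L'.c (anchors D' i p) (λ x → D'.lab x ≡ suc i) (not ∘ o)
  norm' x q' with trans (sym (lab≡ x)) q'
  ... | q with C.norm x q
  ... | k , (r , mn) , h = k ,
      ( Reach-trans (loop-same (≤-reflexive (sym q)) r)
          (loop-same (≤-reflexive (sym (L.up-lab (proj₁ (R k r)) (proj₂ (R k r))))) (loop-β'-up (proj₁ (R k r)) (proj₂ (R k r))))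
      , λ j j<k r' → mn j j<k (back j r') )
      , trans (cong not (o-β'-up (proj₁ (R k r)) (proj₂ (R k r)))) (trans (𝔹ₚ.not-involutive _) h)
    where
    R : ∀ k → Reach L.loopGens x (D.β (p k)) → L.Up (p k) × D.lab (p k) ≡ i
    R k r = rises k (trans (L.loop-lab r) q)

    back : ∀ j → Reach L'.loopGens x (D'.β (p j)) → Reach L.loopGens x (D.β (p j))
    back j r' = Reach-trans (F'.loop-same (≤-reflexive (sym q')) r')
      (L.loop-sym (loop-β'-up (proj₁ u) (proj₂ u)))
      where
      u : L.Up (p j) × D.lab (p j) ≡ i
      u = rises j (trans (sym (labβ≡ (p j))) (trans (L'.loop-lab r') q'))

canonical-iso : ∀ {m m'} {D : Str m} {D' : Str m'} {i p p' o} (I : Iso D D') →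
  (∀ k → Iso.f I (p k) ≡ p' k) → Canonical D' i p' o → Canonical D i p (o ∘ Iso.f I)
canonical-iso {D = D} {D'} {i} {p} {p'} {o} I e C = record
  { flips = λ x h → let a , b = C.flips (f x) (trans (φlab x) h) in
      trans (cong o (φν x)) a , trans (cong o (φb 0 x)) b
  ; norm = λ x h → let k , (r , mn) , t = C.norm (f x) (trans (φlab x) h) in
      k , (back (subst (Reach L'.loopGens (f x)) (sym (anchor k)) r)
          , λ j j<k s → mn j j<k (subst (Reach L'.loopGens (f x)) (anchor j) (φloop s)))
        , trans (cong o (anchor k)) t }
  where
  open Iso I
  open IsoFacts I
  module C = Canonical C
  module J = IsoFacts (Iso-sym I)
  anchor : ∀ k → f (D.β (p k)) ≡ D'.β (p' k)
  anchor k = trans (φβ (p k)) (cong D'.β (e k))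
  back : ∀ {x y} → Reach L'.loopGens (f x) (f y) → Reach L.loopGens x y
  back {x} {y} r = subst₂ (Reach L.loopGens) (Inverse.strictlyInverseʳ φ x) (Inverse.strictlyInverseʳ φ y) (J.φloop r)

contour-iso : ∀ {m m'} {D : Str m} {D' : Str m'} (I : Iso D D') i k → Iso.f I (contour D i k) ≡ contour D' i k
contour-iso {D = D} {D'} I i k = proj₂ (alt-map {f' = D'.ν} {L'.b i} f (λ _ → ⊤) tt
  (λ x _ → tt , φν x) (λ x _ → tt , φb i x) φrt k)
  where open Iso I
        open IsoFacts I

-- The contour below level i is already determined by the flipped structure.
contour-unstep-iso : ∀ {m m'} {D E : Str m} {D' E' : Str m'} {i o o'} → 1 ≤ i → (I : Iso E E') →
  Step D E i o → Step D' E' i o' → ∀ k → Iso.f I (contour D i k) ≡ contour D' i k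
contour-unstep-iso {D = D} {E} {D'} {E'} {i} {o} {o'} 1≤i I S S' k =
  proj₂ (alt-map {f' = D'.ν} {F'.L.b i} f (λ x → D.lab x ≤ i)
    (≤-trans (≤-reflexive D.lab-rt) 1≤i)
    (λ x h → ≤-trans (≤-reflexive (D.lab-ν x)) h , trans (cong f (sym (S.ν≡ x))) (trans (φν x) (S'.ν≡ (f x))))
    (λ x h → F.L.b-lab≤ i x h , φb' x h)
    (trans (cong f (sym S.rt≡)) (trans φrt S'.rt≡)) k)
  where
  open Iso I
  module G = IsoFacts I
  module D = Str D
  module D' = Str D'
  module E = Str E
  module E' = Str E'
  module F = StepFacts S
  module F' = StepFacts S'
  module S = Step S
  module S' = Step S'
  module T = Step F.step-sym
  module T' = Step F'.step-sym

  lab-eq : ∀ x → D'.lab (f x) ≡ D.lab x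
  lab-eq x = trans (sym (S'.lab≡ _)) (trans (φlab x) (S.lab≡ x))
  labβ-eq : ∀ x → D'.lab (D'.β (f x)) ≡ D.lab (D.β x)
  labβ-eq x = trans (sym (S'.labβ≡ _)) (trans (G.φlabβ x) (S.labβ≡ x))

  φb' : ∀ x → D.lab x ≤ i → f (F.L.b i x) ≡ F'.L.b i (f x)
  φb' x h with F.L.keep? i x
  ... | yes k = trans (cong f (sym (off S k))) (trans (φβ x) (trans (off S' (k' k)) (sym (F'.L.b-keep (k' k)))))
    where
    k' : F.L.Keep i x → F'.L.Keep i (f x)
    k' (inj₁ e) = inj₁ (trans (labβ-eq x) (trans e (sym (lab-eq x))))
    k' (inj₂ (p , q)) = inj₂ (subst (_≤ i) (sym (lab-eq x)) p , subst (_≤ i) (sym (labβ-eq x)) q)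
    off : ∀ {n} {A B : Str n} {o y} → Step A B i o → Levels.Keep A i y → Str.β B y ≡ Str.β A y
    off S = StepHybrid.keep-off 1≤i S
  ... | no ¬k with StepHybrid.crossing 1≤i S h ¬k
  ... | u , e = begin
    -- At a crossing flag the turn `α` before the shift is expressed by `β` and `K` after it, and
    -- these are carried along by `I`.
    f (D.α x)                      ≡⟨ cong f (T.α-on (F.up' u) (trans (S.lab≡ x) e)) ⟩
    f (E.β (F.L'.K (E.β x)))       ≡⟨ φβ _ ⟩
    E'.β (f (F.L'.K (E.β x)))      ≡⟨ cong E'.β (G.φK (F.L'.dn-β (F.up' u))) ⟩
    E'.β (F'.L'.K (f (E.β x)))     ≡⟨ cong (E'.β ∘ F'.L'.K) (φβ x) ⟩
    E'.β (F'.L'.K (E'.β (f x)))    ≡⟨ T'.α-on (F'.up' u') (trans (S'.lab≡ _) (trans (lab-eq x) e)) ⟨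
    D'.α (f x)                     ≡⟨ F'.L.b-cross ¬k' ⟨
    F'.L.b i (f x)                 ∎
    where
    open ≡-Reasoning
    u' : F'.L.Up (f x)
    u' = trans (labβ-eq x) (trans u (cong suc (sym (lab-eq x))))
    ¬k' : ¬ F'.L.Keep i (f x)
    ¬k' (inj₁ q) = ¬k (inj₁ (trans (sym (labβ-eq x)) (trans q (lab-eq x))))
    ¬k' (inj₂ (p , q)) = ¬k (inj₂ (subst (_≤ i) (lab-eq x) p , subst (_≤ i) (labβ-eq x) q))

-- Shifting forwards and backwards in the canonical direction

module Forward {m} (D : Str m) (i : ℕ) (1≤i : 1 ≤ i) (H : Levels.Hybrid D i) where
  open Str D
  open Levels D

  private
    -- By `high` each loop has a descending flag `t`. The flag `β t` has label `i`, so it lies on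
    -- the contour and `t` is an anchor.
    cover : ∀ x → lab x ≡ suc i → ∃ λ k → Reach loopGens x (anchors D i (contour D i) k)
    cover x e = let t , d , p = Hybrid.high H x (≤-reflexive (sym e))
                    k , q = contour-cover D H (β t) (≤-reflexive (dn-lab d (trans (P-lab p) e)))
                in k , subst (Reach loopGens x) (trans (sym (ββ t)) (cong β (sym q))) (P⇒loop D i p)

  o : Fin m → Bool
  o = canonical D i (contour D i) cover

  o-canonical : Canonical D i (contour D i) o
  o-canonical = canonical-spec D i (contour D i) cover

  private
    module F = Flip D i o (Canonical.flips o-canonical)

  abstract
    next : Str m
    next = F.flip
    next-step : Step D next i o
    next-step = F.flip-step
    next-hybrid : Levels.Hybrid next (suc i)
    next-hybrid = StepHybrid.hybrid-step 1≤i next-step H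

-- The direction of the flip is read off the contour of D₀, which does not depend on the arbitrary colouring.
module Backward {m} (D : Str m) (i : ℕ) (1≤i : 1 ≤ i) (H : Levels.Hybrid D (suc i)) where
  open Str D
  open Levels D

  private
    module C = Colour ν c ν-inv (b-inv 0)
    arbitrary : Flips (suc i) C.colour
    arbitrary x _ = C.colour-f x , C.colour-g x
    module A = Flip D i C.colour arbitrary

  abstract
    D₀ : Str m
    D₀ = A.flip

    D₀-step : Step D₀ D i (not ∘ C.colour)
    D₀-step = StepFacts.step-sym A.flip-step

  private
    module F₀ = StepFacts D₀-step
    lab₀ : ∀ x → Str.lab D₀ x ≡ lab x
    lab₀ x = sym (Step.lab≡ D₀-step x)
    H₀ : Levels.Hybrid D₀ i
    H₀ = StepHybrid.hybrid-unstep 1≤i D₀-step H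

    cover : ∀ x → lab x ≡ suc i → ∃ λ k → Reach loopGens x (anchors D i (contour D₀ i) k)
    cover x e = let e₀ = ≤-reflexive (sym (trans (lab₀ x) e))
                    t , d₀ , p₀ = Levels.Hybrid.high H₀ x e₀
                    d = F₀.dn' d₀
                    p = F₀.P-same e₀ p₀
                    k , q = contour-cover D₀ H₀ (β t) (≤-reflexive (trans (lab₀ _) (dn-lab d (trans (P-lab p) e))))
                in k , subst (Reach loopGens x) (trans (sym (ββ t)) (cong β (sym q))) (P⇒loop D i p)

  o : Fin m → Bool
  o = canonical D i (contour D₀ i) cover

  o-canonical : Canonical D i (contour D₀ i) o
  o-canonical = canonical-spec D i (contour D₀ i) cover

  private
    module B = Flip D i o (Canonical.flips o-canonical)

  abstract
    prev : Str m
    prev = B.flip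

    prev-step : Step D prev i o
    prev-step = B.flip-step

    prev-step⁻ : Step prev D i (not ∘ o)
    prev-step⁻ = StepFacts.step-sym prev-step

    prev-hybrid : Levels.Hybrid prev i
    prev-hybrid = StepHybrid.hybrid-unstep 1≤i prev-step⁻ H

module _ {i : ℕ} (1≤i : 1 ≤ i) where

  -- The canonical direction of `D'`, pulled back along `I`, is canonical for `D`, so uniqueness
  -- makes both shifts use corresponding directions.
  next-iso : ∀ {m m'} {D : Str m} {D' : Str m'} (H : Levels.Hybrid D i) (H' : Levels.Hybrid D' i) →
    Iso D D' → Iso (Forward.next D i 1≤i H) (Forward.next D' i 1≤i H')
  next-iso {D = D} {D'} H H' I = step-iso I F.next-step F'.next-step
    λ x e → sym (canonical-unique D i F.o-canonical (canonical-iso I (contour-iso I i) F'.o-canonical) x e)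
    where
    module F = Forward D i 1≤i H
    module F' = Forward D' i 1≤i H'

  prev-iso : ∀ {m m'} {D : Str m} {D' : Str m'} (H : Levels.Hybrid D (suc i)) (H' : Levels.Hybrid D' (suc i)) →
    Iso D D' → Iso (Backward.prev D i 1≤i H) (Backward.prev D' i 1≤i H')
  prev-iso {D = D} {D'} H H' I = step-iso I B.prev-step B'.prev-step
    λ x e → sym (canonical-unique D i B.o-canonical
      (canonical-iso I (contour-unstep-iso 1≤i I B.D₀-step B'.D₀-step) B'.o-canonical) x e)
    where
    module B = Backward D i 1≤i H
    module B' = Backward D' i 1≤i H'

  -- `D` and `D₀` both arise from `next` by undoing a shift at the same label, so their contours
  -- agree. Along this common contour the complement of the forward direction is canonical for
  -- `next`, hence it is the direction that `Backward` picks.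
  prev-next : ∀ {m} {D : Str m} (H : Levels.Hybrid D i) →
    Iso (Backward.prev (Forward.next D i 1≤i H) i 1≤i (Forward.next-hybrid D i 1≤i H)) D
  prev-next {D = D} H = step-iso Iso-refl B.prev-step (StepFacts.step-sym F.next-step)
    λ x e → canonical-unique F.next i
      (canonical-ext (contour-unstep-iso 1≤i (Iso-refl {D = F.next}) F.next-step B.D₀-step)
        (canonical-step (contour-low D 1≤i) F.next-step F.o-canonical))
      B.o-canonical x e
    where
    module F = Forward D i 1≤i H
    module B = Backward F.next i 1≤i F.next-hybrid

  -- `prev` and `D₀` differ only in the directions of their loops, which the contour up to `i` does
  -- not see; so the complement of the backward direction is canonical for `prev`.
  next-prev : ∀ {m} {D : Str m} (H : Levels.Hybrid D (suc i)) →
    Iso (Forward.next (Backward.prev D i 1≤i H) i 1≤i (Backward.prev-hybrid D i 1≤i H)) D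
  next-prev {D = D} H = step-iso Iso-refl F.next-step B.prev-step⁻
    λ x e → canonical-unique B.prev i
      (canonical-ext (contour-unstep-iso 1≤i (Iso-refl {D = D}) B.D₀-step B.prev-step⁻)
        (canonical-step (λ k → ≤-trans (≤-reflexive (Step.lab≡ B.D₀-step _)) (contour-low B.D₀ 1≤i k)) B.prev-step B.o-canonical))
      F.o-canonical x e
    where
    module B = Backward D i 1≤i H
    module F = Forward B.prev i 1≤i B.prev-hybrid

-- VR i and Orientation i express the vertices and the orientations of the i-th hybrid through D.

module Hybrids {m} (D : Str m) where
  open Str D
  open Levels D

  data VR (i : ℕ) (x : Fin m) : Fin m → Set where
    here  : VR i x x
    by-ν  : ∀ {y} → VR i x y → VR i x (ν y)
    by-α  : ∀ {y} → ¬ (Up y × i ≤ lab y) → VR i x y → VR i x (α y)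
    by-β  : ∀ {t t'} → Dn t → Dn t' → i < lab t → P t t' → VR i x (β t) → VR i x (β t')

  Orientation : ℕ → (Fin m → Bool) → Set
  Orientation i s = ∀ x → s (ν x) ≡ not (s x) × s (α x) ≡ not (s x) ×
    (Keep i x → s (β x) ≡ not (s x)) × (¬ Keep i x → s (β x) ≡ s x)

  orientation-flips : ∀ {i s} → Orientation i s → ∀ j → Flips j s
  orientation-flips {i} {s} O j x _ = proj₁ (O x) , flip-c
    where
    flip-c : s (c x) ≡ not (s x)
    flip-c with keep? 0 x
    ... | yes k = proj₁ (proj₂ (proj₂ (O x))) (inj₁ (keep-0 k))
    ... | no _  = proj₁ (proj₂ (O x))

record Link {m} (D D' : Str m) (i j : ℕ) : Set where
  private
    module H = Hybrids D
    module H' = Hybrids D'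
  field
    ν-eq    : ∀ x → Str.ν D' x ≡ Str.ν D x
    lab-eq  : ∀ x → Str.lab D' x ≡ Str.lab D x
    rt-eq   : Str.rt D' ≡ Str.rt D
    VR-to   : ∀ {x y} → H.VR i x y → H'.VR j x y
    VR-from : ∀ {x y} → H'.VR j x y → H.VR i x y
    or-to   : ∀ {s} → H.Orientation i s → H'.Orientation j s
    or-from : ∀ {s} → H'.Orientation j s → H.Orientation i s

link-refl : ∀ {m} {D : Str m} {i} → Link D D i i
link-refl = record { ν-eq = λ _ → refl ; lab-eq = λ _ → refl ; rt-eq = refl
  ; VR-to = λ r → r ; VR-from = λ r → r ; or-to = λ r → r ; or-from = λ r → r }

link-trans : ∀ {m} {D D' D'' : Str m} {i j k} → Link D D' i j → Link D' D'' j k → Link D D'' i k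
link-trans A B = record
  { ν-eq = λ x → trans (B.ν-eq x) (A.ν-eq x) ; lab-eq = λ x → trans (B.lab-eq x) (A.lab-eq x)
  ; rt-eq = trans B.rt-eq A.rt-eq
  ; VR-to = B.VR-to ∘ A.VR-to ; VR-from = A.VR-from ∘ B.VR-from
  ; or-to = B.or-to ∘ A.or-to ; or-from = A.or-from ∘ B.or-from }
  where module A = Link A
        module B = Link B

module _ {m} {D D' : Str m} {i : ℕ} {o : Fin m → Bool} (1≤i : 1 ≤ i) (S : Step D D' i o) where
  open StepFacts S
  open Step S
  private
    module T = Step step-sym
    module T' = StepFacts step-sym
    module SH = StepHybrid 1≤i S
    module H = Hybrids D
    module H' = Hybrids D'
    open H using (here; by-ν; by-α; by-β)

    lower : ∀ {x} → i ≤ D.lab x → D.lab x ≢ i → suc i ≤ D.lab x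
    lower h ne = ℕₚ.≤∧≢⇒< h (ne ∘ sym)

    α-even : ∀ {x} → ¬ (L.Up x × i ≤ D.lab x) → D'.α x ≡ D.α x
    α-even h = α-off λ (u , e) → h (u , ≤-reflexive (sym e))

    -- For walks of label `i + 1` the move between `β t` and `β t'` has only one nontrivial
    -- instance, `t' = K t`, by `P-ends`; this is the new `α` at the ascending flag `β t`. Walks of
    -- larger label persist unchanged.
    VR-to : ∀ {x y} → H.VR i x y → H'.VR (suc i) x y
    VR-to here = H'.here
    VR-to {x} (by-ν r) = subst (H'.VR (suc i) x) (ν≡ _) (H'.by-ν (VR-to r))
    VR-to {x} (by-α {y} h r) = subst (H'.VR (suc i) x) (α-even h)
      (H'.by-α (λ (u , e) → h (up⁻ u , ≤-trans (n≤1+n i) (≤-trans e (≤-reflexive (lab≡ y))))) (VR-to r))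
    VR-to {x} (by-β {t} {t'} d d' l p r) with m≤n⇒m<n∨m≡n l
    ... | inj₁ l' = subst (H'.VR (suc i) x) (β-dn-off d' λ e → <-irrefl (sym (trans (sym (L.P-lab p)) e)) l')
          (H'.by-β (dn' d) (dn' d') (≤-trans l' (≤-reflexive (sym (lab≡ t)))) (P-same l p)
            (subst (H'.VR (suc i) x) (sym (β-dn-off d λ e → <-irrefl (sym e) l')) (VR-to r)))
    ... | inj₂ e with L.P-ends d d' p
    ... | inj₁ refl = VR-to r
    ... | inj₂ q = subst (H'.VR (suc i) x)
          (trans (α-on (L.up-β d) eβ) (cong D.β (trans (cong L.K (D.ββ t)) (sym q))))
          (H'.by-α (λ (_ , h) → ℕₚ.1+n≰n (≤-trans h (≤-reflexive (trans (lab≡ _) eβ)))) (VR-to r))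
      where
      eβ : D.lab (D.β t) ≡ i
      eβ = L.dn-lab d (sym e)

    VR-from : ∀ {x y} → H'.VR (suc i) x y → H.VR i x y
    VR-from H'.here = here
    VR-from {x} (H'.by-ν r) = subst (H.VR i x) (sym (ν≡ _)) (by-ν (VR-from r))
    VR-from {x} (H'.by-α {y} h r) with (D.lab (D.β y) ℕ.≟ suc (D.lab y)) ×-dec (D.lab y ℕ.≟ i)
    ... | yes (u , e) = subst (H.VR i x) (sym (α-on u e))
          (by-β (L.dn-β u) (L.K-dn (L.dn-β u)) (≤-reflexive (sym (L.up-lab u e))) (L.K-P (L.dn-β u))
            (subst (H.VR i x) (sym (D.ββ y)) (VR-from r)))
    ... | no k = subst (H.VR i x) (sym (α-off k)) (by-α (λ (u , l) → h (up' u ,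
            ≤-trans (lower l (λ e → k (u , e))) (≤-reflexive (sym (lab≡ y))))) (VR-from r))
    VR-from {x} (H'.by-β {t} {t'} d d' l p r) =
      subst (H.VR i x) (sym (β-dn-off (dn⁻ d') λ e → <-irrefl (sym (trans (sym (trans (trans (sym (lab≡ t')) (L'.P-lab p)) (lab≡ t))) e)) l₀))
        (by-β (dn⁻ d) (dn⁻ d') l₁ (P-same⁻ l₁ p)
          (subst (H.VR i x) (β-dn-off (dn⁻ d) λ e → <-irrefl (sym e) l₀) (VR-from r)))
      where
      l₀ : suc i < D.lab t
      l₀ = ≤-trans l (≤-reflexive (lab≡ t))
      l₁ : i < D.lab t
      l₁ = ≤-trans (n≤1+n _) l₀

    dn-cross : ∀ {x} → L.Dn x → D.lab x ≡ suc i → ¬ L.Keep i x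
    dn-cross d e (inj₁ f) = L.dn⇒¬flat d f
    dn-cross d e (inj₂ (p , _)) = ℕₚ.1+n≰n (≤-trans (≤-reflexive (sym e)) p)

    data Pos (x : Fin m) : Set where
      inner : L.Keep i x → Pos x
      onDn  : L.Dn x → D.lab x ≡ suc i → Pos x
      onUp  : L.Up x → D.lab x ≡ i → Pos x
      outer : ¬ L.Keep i x → ¬ L'.Keep (suc i) x → D'.β x ≡ D.β x → Pos x

    pos : ∀ x → Pos x
    pos x with L.keep? i x | (D.lab (D.β x) ℕ.≟ suc (D.lab x)) ×-dec (D.lab x ℕ.≟ i) | L.Dn? x ×-dec (D.lab x ℕ.≟ suc i)
    ... | yes k | _ | _ = inner k
    ... | no _ | yes (u , e) | _ = onUp u e
    ... | no _ | no _ | yes (d , e) = onDn d e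
    ... | no ¬k | no ¬u | no ¬d = outer ¬k (out (L.kind x)) (β-off ¬u ¬d)
      where
      out : L.Kind x → ¬ L'.Keep (suc i) x
      out _ (inj₁ f) = ¬k (inj₁ (flat⁻ f))
      out (L.flat f) (inj₂ _) = ¬k (inj₁ f)
      out (L.dn d) (inj₂ (p , _)) = ¬k (inj₂ (ℕ.s≤s⁻¹ l , ℕ.s≤s⁻¹ (≤-trans (≤-reflexive (sym d)) (≤-trans (≤-reflexive (sym (lab≡ x))) p))))
        where l = ℕₚ.≤∧≢⇒< (≤-trans (≤-reflexive (sym (lab≡ x))) p) (λ e → ¬d (d , e))
      out (L.up u) (inj₂ (_ , q)) = ¬k (inj₂ (ℕₚ.<⇒≤ l , ≤-trans (≤-reflexive u) l))
        where l = ℕₚ.≤∧≢⇒< (ℕ.s≤s⁻¹ (≤-trans (≤-reflexive (sym (trans (labβ≡ x) u))) q)) (λ e → ¬u (u , e))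

    -- Flags not kept at level `i` but kept at `i + 1` are those whose `β` is moved. There the new
    -- `β` is the old one combined with one of `K` and `α`, which both reverse `s`, so `β` changes
    -- from preserving `s` to reversing it.
    or-to : ∀ {s} → H.Orientation i s → H'.Orientation (suc i) s
    or-to {s} O x = trans (cong s (ν≡ x)) (proj₁ (O x)) , flip-α , flip-β , keep-β
      where
      sα : ∀ y → s (D.α y) ≡ not (s y)
      sα y = proj₁ (proj₂ (O y))
      sK : ∀ {t} → L.Dn t → s (L.K t) ≡ not (s t)
      sK d = L.K-colour s (H.orientation-flips O _) d refl
      βdn : ∀ {t} → L.Dn t → D.lab t ≡ suc i → s (D.β t) ≡ s t
      βdn {t} d e = proj₂ (proj₂ (proj₂ (O t))) (dn-cross d e)
      βup : ∀ {y} → L.Up y → D.lab y ≡ i → s (D.β y) ≡ s y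
      βup {y} u e = proj₂ (proj₂ (proj₂ (O y))) (SH.up-not-keep u e)
      flip-α : s (D'.α x) ≡ not (s x)
      flip-α with (D.lab (D.β x) ℕ.≟ suc (D.lab x)) ×-dec (D.lab x ℕ.≟ i)
      ... | no h = trans (cong s (α-off h)) (sα x)
      ... | yes (u , e) = trans (cong s (α-on u e)) (trans
            (βdn (L.K-dn (L.dn-β u)) (trans (L.K-lab (L.dn-β u)) (L.up-lab u e)))
            (trans (sK (L.dn-β u)) (cong not (βup u e))))
      keep-β : ¬ L'.Keep (suc i) x → s (D'.β x) ≡ s x
      keep-β ¬k with pos x
      ... | inner k = ⊥-elim (¬k (SH.keep-up k))
      ... | onDn d e = ⊥-elim (¬k (SH.dn-keep' d e))
      ... | onUp u e = ⊥-elim (¬k (SH.up-keep' u e))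
      ... | outer h _ q = trans (cong s q) (proj₂ (proj₂ (proj₂ (O x))) h)
      flip-β : L'.Keep (suc i) x → s (D'.β x) ≡ not (s x)
      flip-β k with pos x
      ... | inner k' = trans (cong s (SH.keep-off k')) (proj₁ (proj₂ (proj₂ (O x))) k')
      ... | outer _ ¬k _ = ⊥-elim (¬k k)
      ... | onUp u e with β'-up u e
      ... | inj₁ (_ , q) = trans (cong s q) (trans (sα _) (cong not (βup u e)))
      ... | inj₂ (_ , q) = trans (cong s q) (trans (sK (L.dn-β u)) (cong not (βup u e)))
      flip-β k | onDn d e with o x in h
      ... | true  = trans (cong s (β-true d e h)) (trans (βdn (L.K-dn d) (trans (L.K-lab d) e)) (sK d))
      ... | false = trans (cong s (β-false d e h)) (trans (βdn (L.dn-α d) (trans (D.lab-α x) e)) (sα x))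

    or-from : ∀ {s} → H'.Orientation (suc i) s → H.Orientation i s
    or-from {s} O x = trans (cong s (sym (ν≡ x))) (proj₁ (O x)) , flip-α , flip-β , keep-β
      where
      sα : ∀ y → s (D'.α y) ≡ not (s y)
      sα y = proj₁ (proj₂ (O y))
      sK : ∀ {t} → L'.Dn t → s (L'.K t) ≡ not (s t)
      sK d = L'.K-colour s (H'.orientation-flips O _) d refl
      βdn : ∀ {t} → L.Dn t → D.lab t ≡ suc i → s (D'.β t) ≡ not (s t)
      βdn {t} d e = proj₁ (proj₂ (proj₂ (O t))) (SH.dn-keep' d e)
      βup : ∀ {y} → L.Up y → D.lab y ≡ i → s (D'.β y) ≡ not (s y)
      βup {y} u e = proj₁ (proj₂ (proj₂ (O y))) (SH.up-keep' u e)
      e' : ∀ {x j} → D.lab x ≡ j → D'.lab x ≡ j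
      e' {x} e = trans (lab≡ x) e
      e⁻ : ∀ {x j} → D'.lab x ≡ j → D.lab x ≡ j
      e⁻ {x} e = trans (sym (lab≡ x)) e
      flip-α : s (D.α x) ≡ not (s x)
      flip-α with (D.lab (D.β x) ℕ.≟ suc (D.lab x)) ×-dec (D.lab x ℕ.≟ i)
      ... | no h = trans (cong s (sym (α-off h))) (sα x)
      ... | yes (u , e) = trans (cong s (T.α-on (up' u) (e' e))) (trans
            (βdn (dn⁻ (L'.K-dn dβ)) (e⁻ (trans (L'.K-lab dβ) (L'.up-lab (up' u) (e' e)))))
            (cong not (trans (sK dβ) (trans (cong not (βup u e)) (𝔹ₚ.not-involutive _)))))
        where
        dβ : L'.Dn (D'.β x)
        dβ = L'.dn-β (up' u)
      flip-β : L.Keep i x → s (D.β x) ≡ not (s x)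
      flip-β k = trans (cong s (sym (SH.keep-off k))) (proj₁ (proj₂ (proj₂ (O x))) (SH.keep-up k))
      keep-β : ¬ L.Keep i x → s (D.β x) ≡ s x
      keep-β ¬k with pos x
      ... | inner k = ⊥-elim (¬k k)
      ... | outer _ h q = trans (cong s (sym q)) (proj₂ (proj₂ (proj₂ (O x))) h)
      ... | onUp u e with T'.β'-up (up' u) (e' e)
      ... | inj₁ (_ , q) = trans (cong s q) (trans (sα _) (trans (cong not (βup u e)) (𝔹ₚ.not-involutive _)))
      ... | inj₂ (_ , q) = trans (cong s q) (trans (sK (L'.dn-β (up' u))) (trans (cong not (βup u e)) (𝔹ₚ.not-involutive _)))
      keep-β ¬k | onDn d e with o x in h
      ... | false = trans (cong s (T.β-true (dn' d) (e' e) (cong not h))) (trans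
            (βdn (dn⁻ (L'.K-dn (dn' d))) (e⁻ (trans (L'.K-lab (dn' d)) (e' e)))) (trans (cong not (sK (dn' d))) (𝔹ₚ.not-involutive _)))
      ... | true  = trans (cong s (T.β-false (dn' d) (e' e) (cong not h))) (trans
            (βdn (dn⁻ (L'.dn-α (dn' d))) (e⁻ (trans (D'.lab-α x) (e' e)))) (trans (cong not (sα x)) (𝔹ₚ.not-involutive _)))

  step-link : Link D D' i (suc i)
  step-link = record { ν-eq = ν≡ ; lab-eq = lab≡ ; rt-eq = rt≡
    ; VR-to = VR-to ; VR-from = VR-from ; or-to = or-to ; or-from = or-from }

-- Chains of shifts over all labels

record Hyb (m i : ℕ) : Set where
  constructor hyb
  field
    str    : Str m
    hybrid : Levels.Hybrid str i
open Hyb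

nextHyb : ∀ {m} k → Hyb m (suc k) → Hyb m (suc (suc k))
nextHyb k X = hyb (Forward.next (str X) (suc k) (s≤s z≤n) (hybrid X)) (Forward.next-hybrid (str X) (suc k) (s≤s z≤n) (hybrid X))

prevHyb : ∀ {m} k → Hyb m (suc (suc k)) → Hyb m (suc k)
prevHyb k X = hyb (Backward.prev (str X) (suc k) (s≤s z≤n) (hybrid X)) (Backward.prev-hybrid (str X) (suc k) (s≤s z≤n) (hybrid X))

abstract
  raise : ∀ {m} k → Hyb m 1 → Hyb m (suc k)
  raise zero    X = X
  raise (suc k) X = nextHyb k (raise k X)

  lowerTo : ∀ {m} k → Hyb m (suc k) → Hyb m 1
  lowerTo zero    X = X
  lowerTo (suc k) X = lowerTo k (prevHyb k X)

  raise-iso : ∀ {m m'} k (X : Hyb m 1) (Y : Hyb m' 1) → Iso (str X) (str Y) → Iso (str (raise k X)) (str (raise k Y))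
  raise-iso zero    X Y I = I
  raise-iso (suc k) X Y I = next-iso (s≤s z≤n) (hybrid (raise k X)) (hybrid (raise k Y)) (raise-iso k X Y I)

  lowerTo-iso : ∀ {m m'} k (X : Hyb m (suc k)) (Y : Hyb m' (suc k)) → Iso (str X) (str Y) → Iso (str (lowerTo k X)) (str (lowerTo k Y))
  lowerTo-iso zero    X Y I = I
  lowerTo-iso (suc k) X Y I = lowerTo-iso k _ _ (prev-iso (s≤s z≤n) (hybrid X) (hybrid Y) I)

  lowerTo-raise : ∀ {m} k (X : Hyb m 1) → Iso (str (lowerTo k (raise k X))) (str X)
  lowerTo-raise zero    X = Iso-refl
  lowerTo-raise (suc k) X = Iso-trans (lowerTo-iso k _ _ (prev-next (s≤s z≤n) (hybrid (raise k X)))) (lowerTo-raise k X)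

  raise-lowerTo : ∀ {m} k (X : Hyb m (suc k)) → Iso (str (raise k (lowerTo k X))) (str X)
  raise-lowerTo zero    X = Iso-refl
  raise-lowerTo (suc k) X = Iso-trans
    (next-iso (s≤s z≤n) _ (Backward.prev-hybrid (str X) (suc k) (s≤s z≤n) (hybrid X)) (raise-lowerTo k _))
    (next-prev (s≤s z≤n) (hybrid X))

  raise-link : ∀ {m} k (X : Hyb m 1) → Link (str X) (str (raise k X)) 1 (suc k)
  raise-link zero    X = link-refl
  raise-link (suc k) X = link-trans (raise-link k X)
    (step-link (s≤s z≤n) (Forward.next-step (str (raise k X)) (suc k) (s≤s z≤n) (hybrid (raise k X))))

  lowerTo-link : ∀ {m} k (X : Hyb m (suc k)) → Link (str (lowerTo k X)) (str X) 1 (suc k)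
  lowerTo-link zero    X = link-refl
  lowerTo-link (suc k) X = link-trans (lowerTo-link k _)
    (step-link (s≤s z≤n) (Backward.prev-step⁻ (str X) (suc k) (s≤s z≤n) (hybrid X)))

-- Distances in maps

module MapFacts (M : Map) where
  A0 A1 A2 : Fin (m M) → Fin (m M)
  A0 = α0 M
  A1 = α1 M
  A2 = α2 M

  i0 : Involutive A0
  i0 x = proj₁ (inv0 M x)
  i1 : Involutive A1
  i1 x = proj₁ (inv1 M x)
  i2 : Involutive A2
  i2 x = proj₁ (inv2 M x)

  v-inv : All Involutive (vGens M)
  v-inv = i1 ∷ i2 ∷ []
  e-inv : All Involutive (eGens M)
  e-inv = i0 ∷ i2 ∷ []
  f-inv : All Involutive (fGens M)
  f-inv = i0 ∷ i1 ∷ []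
  c-inv : All Involutive (cGens M)
  c-inv = i1 ∷ []
  all-inv : All Involutive (A0 ∷ A1 ∷ A2 ∷ [])
  all-inv = i0 ∷ i1 ∷ i2 ∷ []

  VReach : Fin (m M) → Fin (m M) → Set
  VReach = Reach (vGens M)

  -- Local conditions that characterise the distance from the root vertex. They allow labels of a
  -- constructed quadrangulation to be recognised as distances without exhibiting paths.
  record IsDist (d : Fin (m M) → ℕ) : Set where
    field
      d1    : ∀ x → d (A1 x) ≡ d x
      d2    : ∀ x → d (A2 x) ≡ d x
      dlip  : ∀ x → d (A0 x) ≤ suc (d x)
      droot : d (root M) ≡ 0
      dzero : ∀ x → d x ≡ 0 → VReach (root M) x
      ddesc : ∀ {k} x → d x ≡ suc k → ∃ λ y → VReach x y × d (A0 y) ≡ k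

    dlip' : ∀ x → d x ≤ suc (d (A0 x))
    dlip' x = ≤-trans (≤-reflexive (cong d (sym (i0 x)))) (dlip (A0 x))

    d-vertex : ∀ {x y} → VReach x y → d y ≡ d x
    d-vertex = Reach-invariant d (d1 ∷ d2 ∷ [])

    within-sound : ∀ k {x} → within M k x ≡ true → d x ≤ k
    within-sound zero h = ≤-reflexive (trans (d-vertex (sameOrbit-sound _ v-inv h)) droot)
    within-sound (suc k) {x} h with ∨-elim {within M k x} h
    ... | inj₁ e = m≤n⇒m≤1+n (within-sound k e)
    ... | inj₂ e with anyFin-sound _ e
    ... | y , hy with ∧-elim {sameVertex M x y} hy
    ... | s , w = ≤-trans (≤-reflexive (sym (d-vertex (sameOrbit-sound _ v-inv s))))
          (≤-trans (dlip' y) (s≤s (within-sound k w)))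

    within-complete : ∀ k {x} → d x ≤ k → within M k x ≡ true
    within-complete zero {x} h = sameOrbit-complete _ v-inv (dzero x (ℕₚ.n≤0⇒n≡0 h))
    within-complete (suc k) {x} h with m≤n⇒m<n∨m≡n h
    ... | inj₁ l = ∨-introˡ (within-complete k (ℕ.s≤s⁻¹ l))
    ... | inj₂ e with ddesc x e
    ... | y , r , q = ∨-introʳ {within M k x} (anyFin-complete _ y
          (∧-intro (sameOrbit-complete _ v-inv r) (within-complete k (≤-reflexive q))))

    atDist-sound : ∀ i {x} → atDist M i x ≡ true → d x ≡ i
    atDist-sound zero h = ℕₚ.n≤0⇒n≡0 (within-sound 0 h)
    atDist-sound (suc i) {x} h with ∧-elim {within M (suc i) x} h
    ... | p , q = ≤-antisym (within-sound (suc i) p)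
          (ℕₚ.≰⇒> λ l → true≢false (within-complete i l) (not-elim q))

    atDist-complete : ∀ i {x} → d x ≡ i → atDist M i x ≡ true
    atDist-complete zero h = within-complete 0 (≤-reflexive h)
    atDist-complete (suc i) h = ∧-intro (within-complete (suc i) (≤-reflexive h))
      (not-intro λ w → <⇒≱ (≤-reflexive (sym h)) (within-sound i w))

    dist-bound : ∀ x → d x ≤ m M
    dist-bound x = subst (λ n → d x ≤ n ℕ.+ m M) droot (rounds-bound (A0 ∷ A1 ∷ A2 ∷ []) d
      (dlip' ∷ (λ y → m≤n⇒m≤1+n (≤-reflexive (sym (d1 y))))
      ∷ (λ y → m≤n⇒m≤1+n (≤-reflexive (sym (d2 y)))) ∷ []) (m M) (connected M (root M) x))

    module _ (bip : Bipartite M) where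
      private
        col = proj₁ bip

        col-vertex : ∀ {x y} → VReach x y → col y ≡ col x
        col-vertex = Reach-invariant col ((λ x → proj₁ (proj₂ bip x)) ∷ (λ x → proj₁ (proj₂ (proj₂ bip x))) ∷ [])

        col0 : ∀ x → col (A0 x) ≡ not (col x)
        col0 x = proj₂ (proj₂ (proj₂ bip x))

        parity : ∀ k x → d x ≡ k → col x ≡ iter k not (col (root M))
        parity zero x e = col-vertex (dzero x e)
        parity (suc k) x e with ddesc x e
        ... | y , r , q = trans (sym (col-vertex r)) (trans (cong col (sym (i0 y)))
              (trans (col0 (A0 y)) (cong not (parity k (A0 y) q))))

      -- The colour of a vertex is that of the root changed once per unit of distance, so the ends
      -- of an edge cannot be at equal distance.
      dist-changes : ∀ x → d (A0 x) ≡ suc (d x) ⊎ d x ≡ suc (d (A0 x))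
      dist-changes x with ℕₚ.<-cmp (d (A0 x)) (d x)
      ... | tri< l _ _ = inj₂ (≤-antisym (dlip' x) l)
      ... | tri> _ _ l = inj₁ (≤-antisym (dlip x) l)
      ... | tri≈ _ e _ = ⊥-elim (𝔹ₚ.not-¬ refl (trans (sym (trans (parity _ (A0 x) e) (sym (parity _ x refl)))) (col0 x)))

  dist-unique : ∀ {d d'} → IsDist d → IsDist d' → ∀ x → d x ≡ d' x
  dist-unique {d} {d'} E E' x = ≤-antisym
    (IsDist.within-sound E (d' x) (IsDist.within-complete E' (d' x) ≤-refl))
    (IsDist.within-sound E' (d x) (IsDist.within-complete E (d x) ≤-refl))

  private
    Nearer : ℕ → Fin (m M) → Set
    Nearer k x = ∃ λ y → VReach x y × within M k (A0 y) ≡ true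

    within-cases : ∀ k {x} → within M (suc k) x ≡ true → within M k x ≡ true ⊎ Nearer k x
    within-cases k {x} h with ∨-elim {within M k x} h
    ... | inj₁ w = inj₁ w
    ... | inj₂ w = let y , hy = anyFin-sound _ w
                       s , w' = ∧-elim {sameVertex M x y} hy
                   in inj₂ (y , sameOrbit-sound _ v-inv s , w')

    within-vertex : ∀ k {x y} → VReach x y → within M k x ≡ true → within M k y ≡ true
    within-vertex zero r h = sameOrbit-complete _ v-inv (Reach-trans (sameOrbit-sound _ v-inv h) r)
    within-vertex (suc k) {x} {y} r h with ∨-elim {within M k x} h
    ... | inj₁ e = ∨-introˡ (within-vertex k r e)
    ... | inj₂ e with anyFin-sound _ e
    ... | z , hz with ∧-elim {sameVertex M x z} hz
    ... | s , w = ∨-introʳ {within M k y} (anyFin-complete _ z (∧-intro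
          (sameOrbit-complete _ v-inv (Reach-trans (Reach-sym v-inv r) (sameOrbit-sound _ v-inv s))) w))

    within-A0 : ∀ k {x} → within M k x ≡ true → within M (suc k) (A0 x) ≡ true
    within-A0 k {x} h = ∨-introʳ {within M k (A0 x)} (anyFin-complete _ (A0 x)
      (∧-intro (sameOrbit-complete _ v-inv done) (trans (cong (within M k) (i0 x)) h)))

    within-some : ∀ x → ∃ λ k → within M k x ≡ true
    within-some x = Reach-fold (λ x → ∃ λ k → within M k x ≡ true)
      ( (λ y (k , h) → suc k , within-A0 k h)
      ∷ (λ y (k , h) → k , within-vertex k (done ▸ 1st) h)
      ∷ (λ y (k , h) → k , within-vertex k (done ▸ 2nd) h) ∷ [])
      (0 , sameOrbit-complete _ v-inv done) (sameOrbit-sound _ all-inv (connected M (root M) x))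

    dist-data : ∀ x → ∃ λ k → within M k x ≡ true × (∀ j → j < k → ¬ (within M j x ≡ true))
    dist-data x = let n , h = within-some x in least (λ k → dec-true (within M k x)) n h

  abstract
    dist : Fin (m M) → ℕ
    dist x = proj₁ (dist-data x)

    private
      dist≤ : ∀ k {x} → within M k x ≡ true → dist x ≤ k
      dist≤ k {x} h = ℕₚ.≮⇒≥ λ l → proj₂ (proj₂ (dist-data x)) k l h

      within-dist : ∀ x → within M (dist x) x ≡ true
      within-dist x = proj₁ (proj₂ (dist-data x))

      dist-v : ∀ {x y} → VReach x y → dist y ≡ dist x
      dist-v {x} {y} r = ≤-antisym (dist≤ (dist x) (within-vertex (dist x) r (within-dist x)))
        (dist≤ (dist y) (within-vertex (dist y) (Reach-sym v-inv r) (within-dist y)))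

      dist-lip : ∀ x → dist (A0 x) ≤ suc (dist x)
      dist-lip x = dist≤ (suc (dist x)) (within-A0 (dist x) (within-dist x))

      descend : ∀ {k} x → dist x ≡ suc k → within M k x ≡ true ⊎ Nearer k x → ∃ λ y → VReach x y × dist (A0 y) ≡ k
      descend {k} x e (inj₁ w) = ⊥-elim (<⇒≱ (≤-reflexive (sym e)) (dist≤ k w))
      descend {k} x e (inj₂ (y , r , w)) = y , r , ≤-antisym (dist≤ k w)
        (ℕ.s≤s⁻¹ (≤-trans (≤-reflexive (trans (sym e) (sym (dist-v r))))
          (≤-trans (≤-reflexive (cong dist (sym (i0 y)))) (dist-lip (A0 y)))))

    dist-isDist : IsDist dist
    dist-isDist = record
      { d1 = λ x → dist-v (done ▸ 1st) ; d2 = λ x → dist-v (done ▸ 2nd)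
      ; dlip = dist-lip
      ; droot = ℕₚ.n≤0⇒n≡0 (dist≤ 0 (sameOrbit-complete _ v-inv done))
      ; dzero = λ x e → sameOrbit-sound _ v-inv (subst (λ k → within M k x ≡ true) e (within-dist x))
      ; ddesc = λ {k} x e → descend x e (within-cases k (subst (λ k → within M k x ≡ true) e (within-dist x))) }

  -- Degrees of faces

  turn : Fin (m M) → Fin (m M)
  turn x = A1 (A0 x)

  private
    module C = Colour A0 A1 (inv0 M) (inv1 M)

    turn-inj : ∀ {x y} → turn x ≡ turn y → x ≡ y
    turn-inj e = invol-injective {f = A0} i0 (invol-injective {f = A1} i1 e)

  corner : ∀ {x y} → Reach (cGens M) x y → y ≡ x ⊎ y ≡ A1 x
  corner {x} = Reach-fold (λ y → y ≡ x ⊎ y ≡ A1 x)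
    ((λ { y (inj₁ e) → inj₂ (cong A1 e) ; y (inj₂ e) → inj₁ (trans (cong A1 e) (i1 x)) }) ∷ []) (inj₁ refl)

  private
    no-A1-up : ∀ k z → iter k turn z ≢ A1 z
    no-A1-up zero z e = proj₂ (inv1 M z) (sym e)
    no-A1-up (suc k) z e = C.no-reflection k z
      (trans (sym (i0 _)) (cong A0 (invol-injective {f = A1} i1 e)))

  -- The iterates of `turn` go around the face in one sense and their images under `A1` in the
  -- other. Cancelling reduces a coincidence to one excluded by `no-reflection`.
  no-A1 : ∀ j k x → iter j turn x ≢ A1 (iter k turn x)
  no-A1 j k x e with ℕₚ.≤-total k j
  ... | inj₁ k≤j = no-A1-up (j ℕ.∸ k) (iter k turn x)
        (trans (sym (iter-+ (j ℕ.∸ k) k turn x)) (trans (cong (λ n → iter n turn x) (ℕₚ.m∸n+n≡m k≤j)) e))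
  ... | inj₂ j≤k = no-A1-up (k ℕ.∸ j) (iter j turn x)
        (trans (sym (iter-+ (k ℕ.∸ j) j turn x)) (trans (cong (λ n → iter n turn x) (ℕₚ.m∸n+n≡m j≤k))
          (trans (sym (i1 _)) (cong A1 (sym e)))))

  Returns : ℕ → Fin (m M) → Set
  Returns n x = iter n turn x ≡ x

  -- `A0` leads from a corner to the next or to the preceding one, depending on which of its two
  -- flags is used.
  face-corners : ∀ n {x y} → Returns (suc n) x → Reach (fGens M) x y →
    ∃ λ j → j < suc n × Reach (cGens M) (iter j turn x) y
  face-corners n {x} ret = Reach-fold (λ y → ∃ λ j → j < suc n × Reach (cGens M) (iter j turn x) y)
    ((λ y (j , l , r) → move-0 y j l (corner r)) ∷ (λ y (j , l , r) → j , l , r ▸ 1st) ∷ [])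
    (0 , s≤s z≤n , done)
    where
    Goal : Fin (m M) → Set
    Goal y = ∃ λ j → j < suc n × Reach (cGens M) (iter j turn x) y

    C-to : ∀ {a b} → a ≡ A1 b → Reach (cGens M) a b
    C-to {a} {b} e = subst (Reach (cGens M) a) (trans (cong A1 e) (i1 b)) (done ▸ 1st)

    move-0 : ∀ y j → j < suc n → y ≡ iter j turn x ⊎ y ≡ A1 (iter j turn x) → Goal (A0 y)
    move-0 y j l (inj₁ e) with m≤n⇒m<n∨m≡n l
    ... | inj₁ l' = suc j , l' , C-to (cong (A1 ∘ A0) (sym e))
    ... | inj₂ q = 0 , s≤s z≤n , C-to (trans (sym ret) (trans (cong (λ k → iter k turn x) (sym q)) (cong (A1 ∘ A0) (sym e))))
    -- The corner preceding the first one is the last one, with index `n`.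
    move-0 y zero l (inj₂ e) = n , ≤-refl ,
      Reach-≡ (sym (trans (cong A0 (trans e (trans (cong A1 (sym ret)) (i1 _)))) (i0 _)))
    move-0 y (suc j) l (inj₂ e) = j , ℕₚ.<⇒≤ l , Reach-≡ (sym (trans (cong A0 (trans e (i1 _))) (i0 _)))

  private
    inFace : Fin (m M) → Fin (m M) → Bool
    inFace x y = sameOrbit (fGens M) x y ∧ isRep (cGens M) y

    iter-face : ∀ j x → Reach (fGens M) x (iter j turn x)
    iter-face zero x = done
    iter-face (suc j) x = (iter-face j x ▸ 1st) ▸ 2nd

    corner-face : ∀ {x y} → Reach (cGens M) x y → Reach (fGens M) x y
    corner-face = Reach-map (λ x → x) ((λ y → done ▸ 2nd) ∷ [])

  degree≤ : ∀ n {x} → Returns (suc n) x → faceDegree M x ≤ suc n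
  degree≤ n {x} ret = ≤-trans (count-mono (inFace x) (λ (_ : Fin (suc n)) → true)
    (λ y h → let j , l , _ = G y h in Fin.fromℕ< l , refl)
    λ y z hy hz e → let j , l , r = G y hy ; k , l' , s = G z hz in
      isRep-unique _ c-inv (proj₂ (∧-elim {sameOrbit (fGens M) x y} hy)) (proj₂ (∧-elim {sameOrbit (fGens M) x z} hz))
        (Reach-trans (Reach-sym c-inv r) (Reach-trans (Reach-≡ (cong (λ n → iter n turn x)
          (trans (sym (Finₚ.toℕ-fromℕ< l)) (trans (cong toℕ e) (Finₚ.toℕ-fromℕ< l'))))) s)))
    (count≤m (λ (_ : Fin (suc n)) → true))
    where
    G : ∀ y → inFace x y ≡ true → ∃ λ j → j < suc n × Reach (cGens M) (iter j turn x) y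
    G y h = face-corners n ret (sameOrbit-sound _ f-inv (proj₁ (∧-elim {sameOrbit (fGens M) x y} h)))

  Distinct : ℕ → Fin (m M) → Set
  Distinct n x = ∀ j k → j < k → k < n → iter j turn x ≢ iter k turn x

  distinct-inj : ∀ {n x} → Distinct n x → ∀ (i j : Fin n) → iter (toℕ i) turn x ≡ iter (toℕ j) turn x → i ≡ j
  distinct-inj dis i j e with ℕₚ.<-cmp (toℕ i) (toℕ j)
  ... | tri≈ _ q _ = Finₚ.toℕ-injective q
  ... | tri< l _ _ = ⊥-elim (dis _ _ l (Finₚ.toℕ<n j) e)
  ... | tri> _ _ l = ⊥-elim (dis _ _ l (Finₚ.toℕ<n i) (sym e))

  degree≥ : ∀ n {x} → Distinct n x → n ≤ faceDegree M x
  degree≥ n {x} dis = ≤-trans (≤-reflexive (sym (count-exact (λ (_ : Fin n) → true) (λ j → j) (λ _ → refl) (λ e → e) (λ y _ → y , refl))))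
    (count-mono (λ (_ : Fin n) → true) (inFace x)
    (λ j _ → let y , h , r = rep _ c-inv (iter (toℕ j) turn x) in
      y , ∧-intro (sameOrbit-complete _ f-inv (Reach-trans (iter-face (toℕ j) x) (corner-face r))) h)
    λ i j _ _ e → let _ , _ , r = rep _ c-inv (iter (toℕ i) turn x)
                      _ , _ , s = rep _ c-inv (iter (toℕ j) turn x) in
      same i j (corner (Reach-trans r (Reach-trans (Reach-≡ e) (Reach-sym c-inv s)))))
    where
    same : ∀ i j → iter (toℕ j) turn x ≡ iter (toℕ i) turn x ⊎ iter (toℕ j) turn x ≡ A1 (iter (toℕ i) turn x) → i ≡ j
    same i j (inj₁ e) = distinct-inj dis i j (sym e)
    same i j (inj₂ e) = ⊥-elim (no-A1 (toℕ j) (toℕ i) x e)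

  distinct-from : ∀ {n x} → (∀ k → 1 ≤ k → k < n → iter k turn x ≢ x) → Distinct n x
  distinct-from {n} {x} h j k j<k k<n e = h (k ℕ.∸ j) (ℕₚ.m<n⇒0<n∸m j<k) (ℕₚ.≤-<-trans (ℕₚ.m∸n≤m k j) k<n)
    (sym (iter-injective turn-inj j (trans e (trans (cong (λ n → iter n turn x) (sym (ℕₚ.m+[n∸m]≡n (ℕₚ.<⇒≤ j<k)))) (iter-+ j (k ℕ.∸ j) turn x)))))

  -- Face degree 4 as equations between flags. In a bipartite map the colours rule out the periods 1
  -- and 3, so only 2 has to be excluded.
  Square : Set
  Square = ∀ x → Returns 4 x × ¬ Returns 2 x

  module _ (bip : Bipartite M) where
    private
      col = proj₁ bip
      col-turn : ∀ x → col (turn x) ≡ not (col x)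
      col-turn x = trans (proj₁ (proj₂ bip _)) (proj₂ (proj₂ (proj₂ bip x)))

      not-1 : ∀ x → ¬ Returns 1 x
      not-1 x e = 𝔹ₚ.not-¬ refl (trans (cong col (sym e)) (col-turn x))

      not-3 : ∀ x → ¬ Returns 3 x
      not-3 x e = 𝔹ₚ.not-¬ refl (trans (cong col (sym e)) (trans (col-turn _)
        (cong not (trans (col-turn _) (trans (cong not (col-turn _)) (𝔹ₚ.not-involutive _))))))

    square-distinct : Square → ∀ x → Distinct 4 x
    square-distinct sq x = distinct-from λ
      { 1 _ _ → not-1 x ; 2 _ _ → proj₂ (sq x) ; 3 _ _ → not-3 x
      ; (suc (suc (suc (suc k)))) _ (s≤s (s≤s (s≤s (s≤s ())))) }

    -- Period 2 would leave at most two corners. If four turns moved `x`, the first five iterates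
    -- would be distinct and give five corners.
    quad⇒square : IsQuadrangulation M → Square
    quad⇒square quad x = ret4 , ret2
      where
      ret2 : ¬ Returns 2 x
      ret2 e = <⇒≱ (s≤s (s≤s (s≤s z≤n))) (subst (_≤ 2) (quad x) (degree≤ 1 e))
      ret4 : Returns 4 x
      ret4 with iter 4 turn x ≟ x
      ... | yes e = e
      ... | no ne = ⊥-elim (ℕₚ.1+n≰n (subst (5 ≤_) (quad x) (degree≥ 5 (distinct-from λ
              { 1 _ _ → not-1 x ; 2 _ _ → ret2 ; 3 _ _ → not-3 x ; 4 _ _ → ne
              ; (suc (suc (suc (suc (suc k))))) _ (s≤s (s≤s (s≤s (s≤s (s≤s ()))))) }))))

    square⇒quad : Square → IsQuadrangulation M
    square⇒quad sq x = ≤-antisym (degree≤ 3 (proj₁ (sq x))) (degree≥ 4 (square-distinct sq x))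

    -- Each face has eight flags: four iterates of `turn` and their images under `A1`.
    #F-square : Square → #F M ℕ.* 8 ≡ m M
    #F-square sq = count-orbits-of-size (fGens M) f-inv (λ j x → w x (Fin.splitAt 4 j))
      (λ j x → reach x (Fin.splitAt 4 j)) cover
      (λ x {i} {j} e → to-injective (Finₚ.+↔⊎ {4} {4}) (inj x _ _ e))
      where
      w : Fin (m M) → Fin 4 ⊎ Fin 4 → Fin (m M)
      w x (inj₁ a) = iter (toℕ a) turn x
      w x (inj₂ a) = A1 (iter (toℕ a) turn x)

      reach : ∀ x j → Reach (fGens M) x (w x j)
      reach x (inj₁ a) = iter-face (toℕ a) x
      reach x (inj₂ a) = iter-face (toℕ a) x ▸ 2nd

      inj : ∀ x i j → w x i ≡ w x j → i ≡ j
      inj x (inj₁ a) (inj₁ b) e = cong inj₁ (distinct-inj (square-distinct sq x) a b e)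
      inj x (inj₁ a) (inj₂ b) e = ⊥-elim (no-A1 (toℕ a) (toℕ b) x e)
      inj x (inj₂ a) (inj₁ b) e = ⊥-elim (no-A1 (toℕ b) (toℕ a) x (sym e))
      inj x (inj₂ a) (inj₂ b) e = cong inj₂ (distinct-inj (square-distinct sq x) a b (invol-injective {f = A1} i1 e))

      cover : ∀ {x y} → Reach (fGens M) x y → ∃ λ j → w x (Fin.splitAt 4 j) ≡ y
      cover {x} {y} r with face-corners 3 (proj₁ (sq x)) r
      ... | j , l , s = named (corner s)
        where
        at : iter (toℕ (Fin.fromℕ< l)) turn x ≡ iter j turn x
        at = cong (λ n → iter n turn x) (Finₚ.toℕ-fromℕ< l)
        named : y ≡ iter j turn x ⊎ y ≡ A1 (iter j turn x) → ∃ λ j → w x (Fin.splitAt 4 j) ≡ y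
        named (inj₁ e) = Fin.fromℕ< l Fin.↑ˡ 4 , trans (cong (w x) (Finₚ.splitAt-↑ˡ 4 (Fin.fromℕ< l) 4)) (trans at (sym e))
        named (inj₂ e) = 4 Fin.↑ʳ Fin.fromℕ< l , trans (cong (w x) (Finₚ.splitAt-↑ʳ 4 4 (Fin.fromℕ< l))) (trans (cong A1 at) (sym e))

  #E-size : #E M ℕ.* 4 ≡ m M
  #E-size = count-orbits-of-size (eGens M) e-inv w reach cover inj
    where
    w : Fin 4 → Fin (m M) → Fin (m M)
    w Fin.zero x = x
    w (Fin.suc Fin.zero) x = A0 x
    w (Fin.suc (Fin.suc Fin.zero)) x = A2 x
    w (Fin.suc (Fin.suc (Fin.suc Fin.zero))) x = A0 (A2 x)

    reach : ∀ j x → Reach (eGens M) x (w j x)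
    reach Fin.zero x = done
    reach (Fin.suc Fin.zero) x = done ▸ 1st
    reach (Fin.suc (Fin.suc Fin.zero)) x = done ▸ 2nd
    reach (Fin.suc (Fin.suc (Fin.suc Fin.zero))) x = (done ▸ 2nd) ▸ 1st

    pattern p0 = Fin.zero
    pattern p1 = Fin.suc p0
    pattern p2 = Fin.suc p1
    pattern p3 = Fin.suc p2

    cover : ∀ {x y} → Reach (eGens M) x y → ∃ λ j → w j x ≡ y
    cover {x} = Reach-fold (λ y → ∃ λ j → w j x ≡ y)
      ( (λ { y (p0 , e) → p1 , cong A0 e
           ; y (p1 , e) → p0 , trans (sym (i0 x)) (cong A0 e)
           ; y (p2 , e) → p3 , cong A0 e
           ; y (p3 , e) → p2 , trans (sym (i0 (A2 x))) (cong A0 e) })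
      ∷ (λ { y (p0 , e) → p2 , cong A2 e
           ; y (p1 , e) → p3 , trans (comm02 M x) (cong A2 e)
           ; y (p2 , e) → p0 , trans (sym (i2 x)) (cong A2 e)
           ; y (p3 , e) → p1 , trans (cong A0 (sym (i2 x))) (trans (comm02 M (A2 x)) (cong A2 e)) })
      ∷ []) (p0 , refl)

    ≢0 : ∀ {x} → x ≢ A0 x
    ≢0 e = proj₂ (inv0 M _) (sym e)
    ≢2 : ∀ {x} → x ≢ A2 x
    ≢2 e = proj₂ (inv2 M _) (sym e)
    ≢02 : ∀ {x} → x ≢ A0 (A2 x)
    ≢02 e = free02 M _ (sym e)
    A02 : ∀ {x} → A0 x ≢ A2 x
    A02 {x} e = ≢02 (trans (sym (i0 x)) (cong A0 e))
    A0-02 : ∀ {x} → A0 x ≢ A0 (A2 x)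
    A0-02 e = ≢2 (invol-injective {f = A0} i0 e)

    inj : ∀ x {i j} → w i x ≡ w j x → i ≡ j
    inj x {p0} {p0} e = refl
    inj x {p0} {p1} e = ⊥-elim (≢0 e)
    inj x {p0} {p2} e = ⊥-elim (≢2 e)
    inj x {p0} {p3} e = ⊥-elim (≢02 e)
    inj x {p1} {p0} e = ⊥-elim (≢0 (sym e))
    inj x {p1} {p1} e = refl
    inj x {p1} {p2} e = ⊥-elim (A02 e)
    inj x {p1} {p3} e = ⊥-elim (A0-02 e)
    inj x {p2} {p0} e = ⊥-elim (≢2 (sym e))
    inj x {p2} {p1} e = ⊥-elim (A02 (sym e))
    inj x {p2} {p2} e = refl
    inj x {p2} {p3} e = ⊥-elim (≢0 e)
    inj x {p3} {p0} e = ⊥-elim (≢02 (sym e))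
    inj x {p3} {p1} e = ⊥-elim (A0-02 (sym e))
    inj x {p3} {p2} e = ⊥-elim (≢0 (sym e))
    inj x {p3} {p3} e = refl

-- The flags of D are those flags of the quadrangulation q which lie at the far end of their edge.

record Enc (q : Map) {n} (D : Str n) : Set where
  open MapFacts q
  open Str D
  open Levels D
  field
    f     : Fin n → Fin (m q)
    f-inj : ∀ {x y} → f x ≡ f y → x ≡ y
    cover : ∀ y → (∃ λ x → f x ≡ y) ⊎ (∃ λ x → A0 (f x) ≡ y)
    d     : Fin (m q) → ℕ
    isD   : IsDist d
    d-top : ∀ x → d (f x) ≡ lab x
    d-bot : ∀ x → lab x ≡ suc (d (A0 (f x)))
    f-rt  : A0 (f rt) ≡ root q
    fν    : ∀ x → A2 (f x) ≡ f (ν x)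
    dnα   : ∀ {x} → Dn x → A1 (f x) ≡ f (α x)
    dnβ   : ∀ {x} → Dn x → A1 (A0 (f x)) ≡ f (β x)
    flα   : ∀ {x} → Flat x → A1 (f x) ≡ f (α x)
    flβ   : ∀ {x} → Flat x → A1 (A0 (f x)) ≡ A0 (f (β x))
    upα   : ∀ {x} → Up x → A1 (A0 (f x)) ≡ A0 (f (α x))

  -- This is the corner of `dnβ` for the descending flag `β x`, seen from its other flag.
  upβ : ∀ {x} → Up x → A1 (f x) ≡ A0 (f (β x))
  upβ {x} u = trans (cong (A1 ∘ f) (sym (ββ x))) (trans (cong A1 (sym (dnβ (dn-β u)))) (i1 _))

  f0ν : ∀ x → A2 (A0 (f x)) ≡ A0 (f (ν x))
  f0ν x = trans (sym (comm02 q (f x))) (cong A0 (fν x))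

  disjoint : ∀ {x y} → f x ≢ A0 (f y)
  disjoint {x} {y} e = <-irrefl refl (ℕₚ.<-trans (≤-reflexive (sym dx)) (≤-reflexive (sym dy)))
    where
    dx : d (f x) ≡ suc (d (f y))
    dx = trans (d-top x) (trans (d-bot x) (cong suc (trans (cong (d ∘ A0) e) (cong d (i0 (f y))))))
    dy : d (f y) ≡ suc (d (f x))
    dy = trans (d-top y) (trans (d-bot y) (cong (suc ∘ d) (sym e)))

-- From a bipartite quadrangulation to a labelled structure

module Encode (q : Map) (bip : Bipartite q) (sq : MapFacts.Square q) where
  open MapFacts q

  private
    module ID = IsDist dist-isDist
    open ID using (d1; d2)

    d : Fin (m q) → ℕ
    d = dist

    Top : Fin (m q) → Set
    Top x = d x ≡ suc (d (A0 x))

    changes : ∀ x → d (A0 x) ≡ suc (d x) ⊎ d x ≡ suc (d (A0 x))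
    changes = ID.dist-changes bip

    square : ∀ x → A1 (A0 (A1 (A0 x))) ≡ A0 (A1 (A0 (A1 x)))
    square x = sym (trans (cong (A0 ∘ A1 ∘ A0 ∘ A1) (sym (proj₁ (sq x))))
      (trans (cong (A0 ∘ A1 ∘ A0) (i1 _)) (trans (cong (A0 ∘ A1) (i0 _)) (trans (cong A0 (i1 _)) (i0 _)))))

    -- `A0 (turn x)` lies at the vertex diagonally opposite to `x` in the face, and `A0 (A1 x)` at
    -- the second neighbour of `x`. The cases `qt`, `ql` and `qd` will become `Dn`, `Up` and `Flat`.
    data QKind (x : Fin (m q)) : Set where
      qt : d (A0 x) ≡ suc (d (A0 (turn x))) → d (A0 (A1 x)) ≡ d (A0 x) → QKind x
      ql : d (A0 (A1 x)) ≡ suc (d x) → d (A0 (turn x)) ≡ d x → QKind x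
      qd : d (A0 (A1 x)) ≡ d (A0 x) → d (A0 (turn x)) ≡ d x → QKind x

    turn-d : ∀ x → d (turn x) ≡ d (A0 x)
    turn-d x = d1 (A0 x)

    opposite : ∀ x → d (A0 (A1 (A0 (turn x)))) ≡ d (A0 (A1 x))
    opposite x = trans (cong (d ∘ A0) (square x)) (trans (cong d (i0 _)) (d1 _))

    below : ∀ {x} → Top x → d (A0 x) ≡ suc (d (A0 (turn x))) → d (A0 (turn x)) < d x
    below t e = ≤-trans (≤-reflexive (sym e)) (≤-trans (n≤1+n _) (≤-reflexive (sym t)))

    -- The diagonal vertex and the second neighbour are adjacent, by `opposite`, so their distances
    -- cannot differ by three.
    far : ∀ {x} → Top x → d (A0 x) ≡ suc (d (A0 (turn x))) → ¬ (d (A0 (A1 x)) ≡ suc (d x))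
    far {x} t e e' with changes (A1 (A0 (turn x)))
    ... | inj₁ h = <-irrefl (ℕₚ.suc-injective (trans (cong suc (sym (d1 _))) (trans (sym h) (trans (opposite x) e')))) (below t e)
    ... | inj₂ h = <-irrefl (trans (sym (d1 _)) (trans h (cong suc (trans (opposite x) e'))))
          (ℕₚ.<-trans (below t e) (m<n⇒m<1+n ≤-refl))

    qkind : ∀ {x} → Top x → QKind x
    qkind {x} t with changes (turn x) | changes (A1 x)
    ... | inj₁ a | inj₁ b = ql (trans b (cong suc (d1 x))) (trans a (trans (cong suc (turn-d x)) (sym t)))
    ... | inj₁ a | inj₂ b = qd (ℕₚ.suc-injective (trans (sym b) (trans (d1 x) t))) (trans a (trans (cong suc (turn-d x)) (sym t)))
    ... | inj₂ a | inj₂ b = qt (trans (sym (turn-d x)) a) (ℕₚ.suc-injective (trans (sym b) (trans (d1 x) t)))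
    ... | inj₂ a | inj₁ b = ⊥-elim (far t (trans (sym (turn-d x)) a) (trans b (cong suc (d1 x))))

    -- These become `α` and `β`. In a steep face `a` joins the two edges with the same labels,
    -- across the highest or the lowest corner, and `b` joins edges with different labels at a
    -- middle corner. In a flat face `a` reflects across far corners and `b` across near ones.
    a b : Fin (m q) → Fin (m q)
    a x with d (A0 (A1 x)) ℕ.≟ suc (d x)
    ... | yes _ = A0 (turn x)
    ... | no _  = A1 x
    b x with d (A0 (A1 x)) ℕ.≟ suc (d x) | d (A0 x) ℕ.≟ suc (d (A0 (turn x)))
    ... | yes _ | _     = A0 (A1 x)
    ... | no _  | yes _ = turn x
    ... | no _  | no _  = A0 (turn x)

    not-up : ∀ {x} → Top x → d (A0 (A1 x)) ≡ d (A0 x) → ¬ (d (A0 (A1 x)) ≡ suc (d x))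
    not-up t e e' = <-irrefl (trans (sym e) e') (m<n⇒m<1+n (≤-reflexive (sym t)))

    not-dn : ∀ {x} → Top x → d (A0 (turn x)) ≡ d x → ¬ (d (A0 x) ≡ suc (d (A0 (turn x))))
    not-dn t e e' = <-irrefl (trans e' (cong suc e)) (m<n⇒m<1+n (≤-reflexive (sym t)))

    a-up : ∀ {x} → d (A0 (A1 x)) ≡ suc (d x) → a x ≡ A0 (turn x)
    a-up {x} e with d (A0 (A1 x)) ℕ.≟ suc (d x)
    ... | yes _ = refl
    ... | no h  = ⊥-elim (h e)

    a-else : ∀ {x} → Top x → d (A0 (A1 x)) ≡ d (A0 x) → a x ≡ A1 x
    a-else {x} t e with d (A0 (A1 x)) ℕ.≟ suc (d x)
    ... | yes h = ⊥-elim (not-up t e h)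
    ... | no _  = refl

    b-up : ∀ {x} → d (A0 (A1 x)) ≡ suc (d x) → b x ≡ A0 (A1 x)
    b-up {x} e with d (A0 (A1 x)) ℕ.≟ suc (d x)
    ... | yes _ = refl
    ... | no h  = ⊥-elim (h e)

    b-dn : ∀ {x} → Top x → d (A0 (A1 x)) ≡ d (A0 x) → d (A0 x) ≡ suc (d (A0 (turn x))) → b x ≡ turn x
    b-dn {x} t e e' with d (A0 (A1 x)) ℕ.≟ suc (d x) | d (A0 x) ℕ.≟ suc (d (A0 (turn x)))
    ... | yes h | _     = ⊥-elim (not-up t e h)
    ... | no _  | yes _ = refl
    ... | no _  | no h  = ⊥-elim (h e')

    b-flat : ∀ {x} → Top x → d (A0 (A1 x)) ≡ d (A0 x) → d (A0 (turn x)) ≡ d x → b x ≡ A0 (turn x)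
    b-flat {x} t e e' with d (A0 (A1 x)) ℕ.≟ suc (d x) | d (A0 x) ℕ.≟ suc (d (A0 (turn x)))
    ... | yes h | _     = ⊥-elim (not-up t e h)
    ... | no _  | yes h = ⊥-elim (not-dn t e' h)
    ... | no _  | no _  = refl

    top-A1 : ∀ {x} → Top x → d (A0 (A1 x)) ≡ d (A0 x) → Top (A1 x)
    top-A1 {x} t e = trans (d1 x) (trans t (cong suc (sym e)))

    top-turn : ∀ {x} → d (A0 x) ≡ suc (d (A0 (turn x))) → Top (turn x)
    top-turn {x} e = trans (turn-d x) e

    top-A0turn : ∀ {x} → Top x → d (A0 (turn x)) ≡ d x → Top (A0 (turn x))
    top-A0turn {x} t e = trans e (trans t (cong suc (trans (sym (turn-d x)) (cong d (sym (i0 _))))))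

    top-A0A1 : ∀ {x} → d (A0 (A1 x)) ≡ suc (d x) → Top (A0 (A1 x))
    top-A0A1 {x} e = trans e (cong suc (trans (sym (d1 x)) (cong d (sym (i0 _)))))

    record Laws (x : Fin (m q)) : Set where
      field
        top-a : Top (a x)
        top-b : Top (b x)
        aa    : a (a x) ≡ x
        bb    : b (b x) ≡ x
        a≢    : a x ≢ x
        b≢    : b x ≢ x
        ab    : b (a x) ≡ a (b x)
        ab≢   : b (a x) ≢ x
        da    : d (a x) ≡ d x

    laws : ∀ {x} → Top x → Laws x
    laws {x} t with qkind t
    ... | qt e v = record
      { top-a = subst Top (sym ax) tu ; top-b = subst Top (sym bx) ty
      ; aa = trans (cong a ax) (trans (a-else tu eu) (i1 x))
      ; bb = trans (cong b bx) (trans (b-up ey) (trans (cong A0 (i1 _)) (i0 x)))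
      ; a≢ = λ p → proj₂ (inv1 q x) (trans (sym ax) p)
      ; b≢ = λ p → lower (cong d (trans (sym p) bx))
      ; ab = trans (cong b ax) (trans (b-dn tu eu vu) (trans flip-sq (sym (trans (cong a bx) (a-up ey)))))
      ; ab≢ = λ p → lower (trans (cong d (trans (sym p) (trans (cong b ax) (b-dn tu eu vu)))) (trans (turn-d (A1 x)) (trans v (sym (turn-d x)))))
      ; da = trans (cong d ax) (d1 x) }
      where
      ax : a x ≡ A1 x
      ax = a-else t v
      bx : b x ≡ turn x
      bx = b-dn t v e
      tu : Top (A1 x)
      tu = top-A1 t v
      ty : Top (turn x)
      ty = top-turn e
      eu : d (A0 (A1 (A1 x))) ≡ d (A0 (A1 x))
      eu = trans (cong (d ∘ A0) (i1 x)) (sym v)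
      flip-sq : turn (A1 x) ≡ A0 (turn (turn x))
      flip-sq = sym (trans (cong A0 (square x)) (i0 _))
      vu : d (A0 (A1 x)) ≡ suc (d (A0 (turn (A1 x))))
      vu = trans v (trans e (cong suc (trans (sym (d1 _)) (cong d (trans (sym (i0 _)) (cong A0 (sym flip-sq)))))))
      ey : d (A0 (A1 (turn x))) ≡ suc (d (turn x))
      ey = trans (cong (d ∘ A0) (i1 _)) (trans (cong d (i0 x)) (trans t (cong suc (sym (turn-d x)))))
      lower : d x ≢ d (turn x)
      lower p = ℕₚ.1+n≢n (trans (sym t) (trans p (turn-d x)))
    ... | ql e v = record
      { top-a = subst Top (sym ax) ta ; top-b = subst Top (sym bx) tb
      ; aa = trans (cong a ax) (trans (a-up ea) (trans (cong (A0 ∘ A1) (i0 _)) (trans (cong A0 (i1 _)) (i0 x))))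
      ; bb = trans (cong b bx) (trans (b-dn tb eb vb) (trans (cong A1 (i0 _)) (i1 x)))
      ; a≢ = λ p → proj₂ (inv1 q (A0 x)) (trans (sym (i0 _)) (cong A0 (trans (sym ax) p)))
      ; b≢ = λ p → higher (cong d (trans (sym p) bx))
      ; ab = trans (cong b ax) (trans (b-up ea) (trans mid (sym (trans (cong a bx) (a-else tb eb)))))
      ; ab≢ = λ p → higher (trans (cong d (trans (sym p) (trans (cong b ax) (trans (b-up ea) mid)))) (d1 _))
      ; da = trans (cong d ax) v }
      where
      ax : a x ≡ A0 (turn x)
      ax = a-up e
      bx : b x ≡ A0 (A1 x)
      bx = b-up e
      ta : Top (A0 (turn x))
      ta = top-A0turn t v
      tb : Top (A0 (A1 x))
      tb = top-A0A1 e
      ea : d (A0 (A1 (A0 (turn x)))) ≡ suc (d (A0 (turn x)))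
      ea = trans (opposite x) (trans e (cong suc (sym v)))
      mid : A0 (A1 (A0 (turn x))) ≡ A1 (A0 (A1 x))
      mid = trans (cong A0 (square x)) (i0 _)
      eb : d (A0 (A1 (A0 (A1 x)))) ≡ d (A0 (A0 (A1 x)))
      eb = trans (cong (d ∘ A0) (sym mid)) (trans (cong d (i0 _)) (trans (d1 _) (trans v (trans (sym (d1 x)) (cong d (sym (i0 _)))))))
      vb : d (A0 (A0 (A1 x))) ≡ suc (d (A0 (turn (A0 (A1 x)))))
      vb = trans (cong d (i0 _)) (trans (d1 x) (trans t (cong (suc ∘ d ∘ A0) (sym (trans (cong A1 (i0 _)) (i1 x))))))
      higher : d x ≢ d (A0 (A1 x))
      higher p = ℕₚ.1+n≢n (trans (sym e) (sym p))
    ... | qd v w = record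
      { top-a = subst Top (sym ax) tu ; top-b = subst Top (sym bx) ty
      ; aa = trans (cong a ax) (trans (a-else tu eu) (i1 x))
      ; bb = trans (cong b bx) (trans (b-flat ty vy wy) (trans (cong (A0 ∘ A1) (i0 _)) (trans (cong A0 (i1 _)) (i0 x))))
      ; a≢ = λ p → proj₂ (inv1 q x) (trans (sym ax) p)
      ; b≢ = λ p → proj₂ (inv1 q (A0 x)) (trans (sym (i0 _)) (cong A0 (trans (sym bx) p)))
      ; ab = trans bax (sym (trans (cong a bx) (trans (a-else ty vy) (square x))))
      ; ab≢ = λ p → proj₂ (sq x) (trans (square x) (trans (sym bax) p))
      ; da = trans (cong d ax) (d1 x) }
      where
      ax : a x ≡ A1 x
      ax = a-else t v
      bx : b x ≡ A0 (turn x)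
      bx = b-flat t v w
      tu : Top (A1 x)
      tu = top-A1 t v
      ty : Top (A0 (turn x))
      ty = top-A0turn t w
      eu : d (A0 (A1 (A1 x))) ≡ d (A0 (A1 x))
      eu = trans (cong (d ∘ A0) (i1 x)) (sym v)
      wu : d (A0 (turn (A1 x))) ≡ d (A1 x)
      wu = trans (cong d (sym (square x))) (trans (d1 _) (trans w (sym (d1 x))))
      bax : b (a x) ≡ A0 (A1 (A0 (A1 x)))
      bax = trans (cong b ax) (b-flat tu eu wu)
      vy : d (A0 (A1 (A0 (turn x)))) ≡ d (A0 (A0 (turn x)))
      vy = trans (opposite x) (trans v (trans (sym (turn-d x)) (cong d (sym (i0 _)))))
      wy : d (A0 (turn (A0 (turn x)))) ≡ d (A0 (turn x))
      wy = trans (cong (d ∘ A0) (trans (cong A1 (i0 _)) (i1 _))) (trans (cong d (i0 x)) (sym w))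

    topᵇ : Fin (m q) → Bool
    topᵇ x = ⌊ d x ℕ.≟ suc (d (A0 x)) ⌋

    top-sound : ∀ {x} → topᵇ x ≡ true → Top x
    top-sound {x} h = ⌊⌋-sound {d = d x ℕ.≟ suc (d (A0 x))} h
    top-complete : ∀ {x} → Top x → topᵇ x ≡ true
    top-complete {x} h = ⌊⌋-complete {d = d x ℕ.≟ suc (d (A0 x))} h

  size : ℕ
  size = count topᵇ

  private
    f : Fin size → Fin (m q)
    f = enum topᵇ

    f-top : ∀ x → Top (f x)
    f-top x = top-sound (enum-holds topᵇ x)

    f-inj : ∀ {x y} → f x ≡ f y → x ≡ y
    f-inj = enum-injective topᵇ

    module La x = Laws (laws (f-top x))

    back : ∀ {y} → Top y → ∃ λ x → f x ≡ y
    back {y} t = index topᵇ y (top-complete t)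

    top-A2 : ∀ {x} → Top x → Top (A2 x)
    top-A2 {x} t = trans (d2 x) (trans t (cong suc (sym (trans (cong d (comm02 q x)) (d2 _)))))

    root-top : Top (A0 (root q))
    root-top with changes (root q)
    ... | inj₁ e = trans e (cong (suc ∘ d) (sym (i0 _)))
    ... | inj₂ e with trans (sym ID.droot) e
    ... | ()

    ν α β : Fin size → Fin size
    ν x = proj₁ (back (top-A2 (f-top x)))
    α x = proj₁ (back (La.top-a x))
    β x = proj₁ (back (La.top-b x))

    fν : ∀ x → f (ν x) ≡ A2 (f x)
    fν x = proj₂ (back (top-A2 (f-top x)))
    fα : ∀ x → f (α x) ≡ a (f x)
    fα x = proj₂ (back (La.top-a x))
    fβ : ∀ x → f (β x) ≡ b (f x)
    fβ x = proj₂ (back (La.top-b x))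

    db≤ : ∀ {x} → Top x → d (b x) ≤ suc (d x)
    db≤ {x} t with qkind t
    ... | qt e v = ≤-trans (≤-reflexive (trans (cong d (b-dn t v e)) (turn-d x)))
                     (m≤n⇒m≤1+n (≤-trans (n≤1+n _) (≤-reflexive (sym t))))
    ... | ql e v = ≤-reflexive (trans (cong d (b-up e)) e)
    ... | qd v w = m≤n⇒m≤1+n (≤-reflexive (trans (cong d (b-flat t v w)) w))

    -- The root flag has distance 0 and is a near flag; the structure is rooted at the far flag on
    -- the same side of that edge.
    rt : ∃ λ x → f x ≡ A0 (root q)
    rt = back root-top

  structure : Str size
  structure = record
    { ν = ν ; α = α ; β = β ; lab = d ∘ f ; rt = proj₁ rt
    ; ν-inv = λ x → f-inj (trans (fν _) (trans (cong A2 (fν x)) (i2 _)))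
                  , λ e → proj₂ (inv2 q (f x)) (trans (sym (fν x)) (cong f e))
    ; α-inv = λ x → f-inj (trans (fα _) (trans (cong a (fα x)) (La.aa x)))
                  , λ e → La.a≢ x (trans (sym (fα x)) (cong f e))
    ; β-inv = λ x → f-inj (trans (fβ _) (trans (cong b (fβ x)) (La.bb x)))
                  , λ e → La.b≢ x (trans (sym (fβ x)) (cong f e))
    ; comm = λ x → f-inj (trans (fβ _) (trans (cong b (fα x)) (trans (La.ab x) (sym (trans (fα _) (cong a (fβ x)))))))
    ; free = λ x e → La.ab≢ x (trans (sym (trans (fβ _) (cong b (fα x)))) (cong f e))
    ; lab-ν = λ x → trans (cong d (fν x)) (d2 _)
    ; lab-α = λ x → trans (cong d (fα x)) (La.da x)
    ; lab-β = λ x → ≤-trans (≤-reflexive (cong d (fβ x))) (db≤ (f-top x))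
    ; lab-pos = λ x → ≤-trans (s≤s z≤n) (≤-reflexive (sym (f-top x)))
    ; lab-rt = trans (cong d (proj₂ rt)) (trans root-top (cong suc (trans (cong d (i0 _)) ID.droot)))
    }

  private
    open Levels structure using (Dn; Flat; Up)

    data Fit (x : Fin size) : Set where
      dn : Dn x → A1 (f x) ≡ f (α x) → A1 (A0 (f x)) ≡ f (β x) → Fit x
      fl : Flat x → A1 (f x) ≡ f (α x) → A1 (A0 (f x)) ≡ A0 (f (β x)) → Fit x
      up : Up x → A1 (A0 (f x)) ≡ A0 (f (α x)) → Fit x

    fit : ∀ x → Fit x
    fit x with qkind (f-top x)
    ... | qt e v = dn (trans (f-top x) (cong suc (sym (trans (cong d (trans (fβ x) (b-dn (f-top x) v e))) (turn-d (f x))))))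
                     (sym (trans (fα x) (a-else (f-top x) v))) (sym (trans (fβ x) (b-dn (f-top x) v e)))
    ... | ql e v = up (trans (cong d (trans (fβ x) (b-up e))) e)
                     (sym (trans (cong A0 (trans (fα x) (a-up e))) (i0 _)))
    ... | qd v w = fl (trans (cong d (trans (fβ x) (b-flat (f-top x) v w))) w)
                     (sym (trans (fα x) (a-else (f-top x) v)))
                     (sym (trans (cong A0 (trans (fβ x) (b-flat (f-top x) v w))) (i0 _)))

    module L = Levels structure

  enc : Enc q structure
  enc = record
    { f = f ; f-inj = f-inj ; cover = cover ; d = d ; isD = dist-isDist
    ; d-top = λ _ → refl ; d-bot = f-top
    ; f-rt = trans (cong A0 (proj₂ rt)) (i0 _)
    ; fν = λ x → sym (fν x)
    ; dnα = λ {x} h → dnα x h (fit x) ; dnβ = λ {x} h → dnβ x h (fit x)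
    ; flα = λ {x} h → flα x h (fit x) ; flβ = λ {x} h → flβ x h (fit x)
    ; upα = λ {x} h → upα x h (fit x) }
    where
    cover : ∀ y → (∃ λ x → f x ≡ y) ⊎ (∃ λ x → A0 (f x) ≡ y)
    cover y with changes y
    ... | inj₂ t = inj₁ (back t)
    ... | inj₁ e with back {A0 y} (trans e (cong (suc ∘ d) (sym (i0 y))))
    ... | x , e' = inj₂ (x , trans (cong A0 e') (i0 y))
    dnα : ∀ x → Dn x → Fit x → A1 (f x) ≡ f (α x)
    dnα x h (dn _ e _) = e
    dnα x h (fl h' _ _) = ⊥-elim (L.dn⇒¬flat h h')
    dnα x h (up h' _) = ⊥-elim (L.dn⇒¬up h h')
    dnβ : ∀ x → Dn x → Fit x → A1 (A0 (f x)) ≡ f (β x)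
    dnβ x h (dn _ _ e) = e
    dnβ x h (fl h' _ _) = ⊥-elim (L.dn⇒¬flat h h')
    dnβ x h (up h' _) = ⊥-elim (L.dn⇒¬up h h')
    flα : ∀ x → Flat x → Fit x → A1 (f x) ≡ f (α x)
    flα x h (fl _ e _) = e
    flα x h (dn h' _ _) = ⊥-elim (L.dn⇒¬flat h' h)
    flα x h (up h' _) = ⊥-elim (L.up⇒¬flat h' h)
    flβ : ∀ x → Flat x → Fit x → A1 (A0 (f x)) ≡ A0 (f (β x))
    flβ x h (fl _ _ e) = e
    flβ x h (dn h' _ _) = ⊥-elim (L.dn⇒¬flat h' h)
    flβ x h (up h' _) = ⊥-elim (L.up⇒¬flat h' h)
    upα : ∀ x → Up x → Fit x → A1 (A0 (f x)) ≡ A0 (f (α x))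
    upα x h (up _ e) = e
    upα x h (dn h' _ _) = ⊥-elim (L.dn⇒¬up h' h)
    upα x h (fl h' _ _) = ⊥-elim (L.up⇒¬flat h h')

  abstract
    encoding : ∃ λ n → Σ (Str n) (Enc q)
    encoding = size , structure , enc

-- Distances, vertices and orientations of an encoded quadrangulation

module EncFacts {q : Map} {n} {D : Str n} (E : Enc q D) where
  open MapFacts q public
  open Str D public
  open Levels D public
  open Hybrids D public
  open Enc E public
  open IsDist isD public

  lab-flat : ∀ {x} → Keep 1 x → Flat x
  lab-flat (inj₁ h) = h
  lab-flat {x} (inj₂ (p , q)) = trans (≤-antisym q (lab-pos (β x))) (≤-antisym (lab-pos x) p)

  dn-lab>1 : ∀ {t} → Dn t → 1 < lab t
  dn-lab>1 {t} h = ≤-trans (s≤s (lab-pos (β t))) (≤-reflexive (sym h))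

  pc-flat : ∀ {x} → Flat x → pc x ≡ β x
  pc-flat h = trans (pc-else (λ d → dn⇒¬flat d h)) (c-flat h)

  pc-up : ∀ {x} → Up x → pc x ≡ α x
  pc-up h = trans (pc-else (λ d → dn⇒¬up d h)) (c-steep (up⇒¬flat h))

  -- The flags of label 1 are those with near end at the root vertex, and their contour turns around
  -- it. Any other near vertex has a neighbour of smaller distance, and a turn around it reaches
  -- that neighbour only after passing a descending flag.
  hybrid₁ : Hybrid 1
  hybrid₁ = record { low = low ; high = high }
    where
    R : Fin n → Fin n → Set
    R = Reach (ν ∷ b 1 ∷ [])

    Z : Fin (m q) → Set
    Z y = ∃ λ x → y ≡ A0 (f x) × lab x ≡ 1 × R rt x

    z1 : ∀ y → Z y → Z (A1 y)
    z1 _ (x , refl , e , r) with kind x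
    ... | flat h = β x , flβ h , trans h e , subst (R rt) (b-keep (inj₁ h)) (r ▸ 2nd)
    ... | dn h = ⊥-elim (<-irrefl (sym e) (dn-lab>1 h))
    ... | up h = α x , upα h , trans (lab-α x) e , subst (R rt) (b-cross (up⇒¬flat h ∘ lab-flat)) (r ▸ 2nd)

    z2 : ∀ y → Z y → Z (A2 y)
    z2 _ (x , refl , e , r) = ν x , f0ν x , trans (lab-ν x) e , r ▸ 1st

    low : ∀ x → lab x ≤ 1 → R rt x
    low x l with Reach-fold Z (z1 ∷ z2 ∷ []) (rt , sym f-rt , lab-rt , done)
                  (dzero (A0 (f x)) (ℕₚ.suc-injective (trans (sym (d-bot x)) (≤-antisym l (lab-pos x)))))
    ... | x' , e , _ , r = subst (R rt) (f-inj (invol-injective {f = A0} i0 (sym e))) r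

    W : Fin n → Fin (m q) → Set
    W x y = (∃ λ z → y ≡ A0 (f z) × P x z) ⊎ (∃ λ t → Dn t × P x t)

    w1 : ∀ x y → W x y → W x (A1 y)
    w1 x _ (inj₁ (z , refl , p)) with kind z
    ... | flat h = inj₁ (β z , flβ h , subst (P x) (pc-flat h) (p ▸ 2nd))
    ... | dn h = inj₂ (z , h , p)
    ... | up h = inj₁ (α z , upα h , subst (P x) (pc-up h) (p ▸ 2nd))
    w1 x _ (inj₂ found) = inj₂ found

    w2 : ∀ x y → W x y → W x (A2 y)
    w2 x _ (inj₁ (z , refl , p)) = inj₁ (ν z , f0ν z , p ▸ 1st)
    w2 x _ (inj₂ found) = inj₂ found

    high : ∀ x → 1 < lab x → ∃ λ t → Dn t × P x t
    high x l with d (A0 (f x)) in e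
    ... | zero = ⊥-elim (<-irrefl (sym (trans (d-bot x) (cong suc e))) l)
    ... | suc k with ddesc (A0 (f x)) e
    ... | y , r , e' with Reach-fold (W x) (w1 x ∷ w2 x ∷ []) (inj₁ (x , refl , done)) r
    ... | inj₂ found = found
    ... | inj₁ (z , refl , p) = ⊥-elim (<-irrefl (trans (sym e') (trans (cong d (i0 (f z))) (trans (d-top z)
            (trans (P-lab p) (trans (d-bot x) (cong suc e)))))) (m<n⇒m<1+n ≤-refl))

  -- A walk turns around the near vertex of its flags. It is interrupted at the corners whose other
  -- side is a far flag at this vertex.
  P-bot : ∀ {x y} → P x y → VReach (A0 (f x)) (A0 (f y))
  P-bot = Reach-map (A0 ∘ f) ((λ y → subst (VReach _) (f0ν y) (done ▸ 2nd)) ∷ pc-move ∷ [])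
    where
    pc-move : ∀ y → VReach (A0 (f y)) (A0 (f (pc y)))
    pc-move y with kind y
    ... | flat h = subst (VReach _) (trans (flβ h) (cong (A0 ∘ f) (sym (pc-flat h)))) (done ▸ 1st)
    ... | up h   = subst (VReach _) (trans (upα h) (cong (A0 ∘ f) (sym (pc-up h)))) (done ▸ 1st)
    ... | dn h   = Reach-≡ (cong (A0 ∘ f) (sym (pc-dn h)))

  VR⇒reach : ∀ {x y} → VR 1 x y → VReach (f x) (f y)
  VR⇒reach here = done
  VR⇒reach (by-ν r) = subst (VReach _) (fν _) (VR⇒reach r ▸ 2nd)
  VR⇒reach (by-α {y} h r) with kind y
  ... | flat k = subst (VReach _) (flα k) (VR⇒reach r ▸ 1st)
  ... | dn k   = subst (VReach _) (dnα k) (VR⇒reach r ▸ 1st)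
  ... | up k   = ⊥-elim (h (k , lab-pos y))
  VR⇒reach (by-β {t} {t'} h h' _ p r) = subst (VReach _) (dnβ h')
    (Reach-trans (subst (VReach _) (trans (cong A1 (sym (dnβ h))) (i1 _)) (VR⇒reach r ▸ 1st)) (P-bot p) ▸ 1st)

  -- Turning around a vertex alternates between far flags and stretches of near flags. A stretch is
  -- entered at an ascending flag and left after a walk between two descending flags, which is what
  -- `by-β` records.
  reach⇒VR : ∀ {x y} → VReach (f x) (f y) → VR 1 x y
  reach⇒VR {x} {y} r with Reach-fold St (s1 ∷ s2 ∷ []) (inj₁ (x , refl , here)) r
    where
    St : Fin (m q) → Set
    St y = (∃ λ z → y ≡ f z × VR 1 x z) ⊎ (∃ λ z → ∃ λ t → y ≡ A0 (f z) × Dn t × P t z × VR 1 x (β t))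

    s1 : ∀ y → St y → St (A1 y)
    s1 _ (inj₁ (z , refl , v)) with kind z
    ... | flat h = inj₁ (α z , flα h , by-α (λ (u , _) → up⇒¬flat u h) v)
    ... | dn h   = inj₁ (α z , dnα h , by-α (λ (u , _) → dn⇒¬up h u) v)
    ... | up h   = inj₂ (β z , β z , upβ h , dn-β h , done , subst (VR 1 x) (sym (ββ z)) v)
    s1 _ (inj₂ (z , t , refl , ht , p , v)) with kind z
    ... | flat h = inj₂ (β z , t , flβ h , ht , subst (P t) (pc-flat h) (p ▸ 2nd) , v)
    ... | up h   = inj₂ (α z , t , upα h , ht , subst (P t) (pc-up h) (p ▸ 2nd) , v)
    ... | dn h   = inj₁ (β z , dnβ h , by-β ht h (dn-lab>1 ht) p v)

    s2 : ∀ y → St y → St (A2 y)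
    s2 _ (inj₁ (z , refl , v)) = inj₁ (ν z , fν z , by-ν v)
    s2 _ (inj₂ (z , t , refl , ht , p , v)) = inj₂ (ν z , t , f0ν z , ht , p ▸ 1st , v)
  ... | inj₁ (z , e , v) = subst (VR 1 x) (f-inj (sym e)) v
  ... | inj₂ (z , t , e , _) = ⊥-elim (disjoint e)

  private
    A0-inj : ∀ {x y} → A0 x ≡ A0 y → x ≡ y
    A0-inj = invol-injective {f = A0} i0

  module Ext {B : Set} (g h : Fin n → B) where
    ext : Fin (m q) → B
    ext y with cover y
    ... | inj₁ (x , _) = g x
    ... | inj₂ (x , _) = h x

    ext-top : ∀ x → ext (f x) ≡ g x
    ext-top x with cover (f x)
    ... | inj₁ (x' , e) = cong g (f-inj e)
    ... | inj₂ (x' , e) = ⊥-elim (disjoint (sym e))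

    ext-bot : ∀ x → ext (A0 (f x)) ≡ h x
    ext-bot x with cover (A0 (f x))
    ... | inj₁ (x' , e) = ⊥-elim (disjoint e)
    ... | inj₂ (x' , e) = cong h (f-inj (A0-inj e))

  by-cover : (Q : Fin (m q) → Set) → (∀ x → Q (f x)) → (∀ x → Q (A0 (f x))) → ∀ y → Q y
  by-cover Q t b y with cover y
  ... | inj₁ (x , refl) = t x
  ... | inj₂ (x , refl) = b x

  -- `β` amounts to `A0`, `A1`, `A0` at flat flags but only to two of these generators at steep
  -- ones; positivity of labels makes the flat flags the only ones kept at level 1.
  orient-to : Orientable q → ∃ (Orientation 1)
  orient-to (s , S) = s ∘ f , λ x →
      trans (cong s (sym (fν x))) (s2 (f x)) , sα x , (λ k → sβ-flat (lab-flat k)) , λ k → sβ-steep (λ h → k (inj₁ h))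
    where
    s0 : ∀ x → s (A0 x) ≡ not (s x)
    s0 x = proj₁ (S x)
    s1 : ∀ x → s (A1 x) ≡ not (s x)
    s1 x = proj₁ (proj₂ (S x))
    s2 : ∀ x → s (A2 x) ≡ not (s x)
    s2 x = proj₂ (proj₂ (S x))
    s10 : ∀ x → s (A1 (A0 x)) ≡ s x
    s10 x = trans (s1 _) (trans (cong not (s0 x)) (𝔹ₚ.not-involutive _))
    s-flip : ∀ {x y} → s (A0 x) ≡ s y → s x ≡ not (s y)
    s-flip {x} e = trans (sym (𝔹ₚ.not-involutive _)) (cong not (trans (sym (s0 x)) e))
    sα : ∀ x → s (f (α x)) ≡ not (s (f x))
    sα x with kind x
    ... | flat h = trans (cong s (sym (flα h))) (s1 _)
    ... | dn h   = trans (cong s (sym (dnα h))) (s1 _)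
    ... | up h   = s-flip (trans (cong s (sym (upα h))) (s10 _))
    sβ-flat : ∀ {x} → Flat x → s (f (β x)) ≡ not (s (f x))
    sβ-flat h = s-flip (trans (cong s (sym (flβ h))) (s10 _))
    sβ-steep : ∀ {x} → ¬ Flat x → s (f (β x)) ≡ s (f x)
    sβ-steep {x} k with kind x
    ... | flat h = ⊥-elim (k h)
    ... | dn h   = trans (cong s (sym (dnβ h))) (s10 _)
    ... | up h   = 𝔹ₚ.not-injective (trans (sym (s0 _)) (trans (cong s (sym (upβ h))) (s1 _)))

  orient-from : ∃ (Orientation 1) → Orientable q
  orient-from (s , O) = ext , by-cover _
    (λ x → trans (ext-bot x) (cong not (sym (ext-top x)))
         , trans (s1-top x) (cong not (sym (ext-top x)))
         , trans (cong ext (fν x)) (trans (ext-top _) (trans (proj₁ (O x)) (cong not (sym (ext-top x))))))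
    (λ x → trans (cong ext (i0 _)) (trans (ext-top x) (trans (sym (𝔹ₚ.not-involutive _)) (cong not (sym (ext-bot x)))))
         , trans (s1-bot x) (cong not (sym (ext-bot x)))
         , trans (cong ext (f0ν x)) (trans (ext-bot _) (trans (cong not (proj₁ (O x))) (cong not (sym (ext-bot x))))))
    where
    open Ext s (not ∘ s)
    sα : ∀ x → s (α x) ≡ not (s x)
    sα x = proj₁ (proj₂ (O x))
    s-steep : ∀ {x} → ¬ Flat x → s (β x) ≡ s x
    s-steep h = proj₂ (proj₂ (proj₂ (O _))) (h ∘ lab-flat)
    s1-top : ∀ x → ext (A1 (f x)) ≡ not (s x)
    s1-top x with kind x
    ... | flat h = trans (cong ext (flα h)) (trans (ext-top _) (sα x))
    ... | dn h   = trans (cong ext (dnα h)) (trans (ext-top _) (sα x))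
    ... | up h   = trans (cong ext (upβ h)) (trans (ext-bot _) (cong not (s-steep (up⇒¬flat h))))
    s1-bot : ∀ x → ext (A1 (A0 (f x))) ≡ not (not (s x))
    s1-bot x with kind x
    ... | flat h = trans (cong ext (flβ h)) (trans (ext-bot _) (cong not (proj₁ (proj₂ (proj₂ (O x))) (inj₁ h))))
    ... | up h   = trans (cong ext (upα h)) (trans (ext-bot _) (cong not (sα x)))
    ... | dn h   = trans (cong ext (dnβ h)) (trans (ext-top _) (trans (s-steep (dn⇒¬flat h)) (sym (𝔹ₚ.not-involutive _))))

-- Isomorphisms of quadrangulations and of their structures

≅-refl : ∀ {M} → M ≅ M
≅-refl = record { φ = ↔-id ; pres0 = λ _ → refl ; pres1 = λ _ → refl ; pres2 = λ _ → refl ; presR = refl }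

≅-sym : ∀ {M N} → M ≅ N → N ≅ M
≅-sym {M} {N} I = record
  { φ = ↔-flip φ ; pres0 = ↔-natural φ pres0 ; pres1 = ↔-natural φ pres1 ; pres2 = ↔-natural φ pres2
  ; presR = trans (cong (Inverse.from φ) (sym presR)) (Inverse.strictlyInverseʳ φ _) }
  where open _≅_ I

module _ {q q' : Map} (I : q ≅ q') where
  open _≅_ I
  private
    module M = MapFacts q
    module M' = MapFacts q'
    to : Fin (m q) → Fin (m q')
    to = Inverse.to φ
    from : Fin (m q') → Fin (m q)
    from = Inverse.from φ

    from-reach : ∀ {x y} → M'.VReach (to x) y → M.VReach x (from y)
    from-reach {x} {y} r = subst (λ z → M.VReach z (from y)) (Inverse.strictlyInverseʳ φ x)
      (Reach-map from ((λ y → Reach-trans (done ▸ 1st) (Reach-≡ (sym (↔-natural φ pres1 y))))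
                      ∷ (λ y → Reach-trans (done ▸ 2nd) (Reach-≡ (sym (↔-natural φ pres2 y)))) ∷ []) r)

  isDist-iso : ∀ {d} → M'.IsDist d → M.IsDist (d ∘ to)
  isDist-iso {d} isD = record
    { d1 = λ x → trans (cong d (pres1 x)) (d1 _)
    ; d2 = λ x → trans (cong d (pres2 x)) (d2 _)
    ; dlip = λ x → ≤-trans (≤-reflexive (cong d (pres0 x))) (dlip _)
    ; droot = trans (cong d presR) droot
    ; dzero = λ x e → subst (M.VReach (root q)) (Inverse.strictlyInverseʳ φ x)
        (from-reach (subst (λ r → M'.VReach r (to x)) (sym presR) (dzero (to x) e)))
    ; ddesc = λ x e → let y , r , h = ddesc (to x) e in
        from y , from-reach r , trans (cong d (trans (pres0 _) (cong (α0 q') (Inverse.strictlyInverseˡ φ y)))) h }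
    where open M'.IsDist isD

  module Transfer {n n'} {D : Str n} {D' : Str n'} (E : Enc q D) (E' : Enc q' D') where
    module D = Str D
    module D' = Str D'
    module L = Levels D
    module L' = Levels D'
    module E = Enc E
    module E' = Enc E'

    same-d : ∀ x → E.d x ≡ E'.d (to x)
    same-d = M.dist-unique E.isD (isDist-iso E'.isD)

    -- Distances are unique, so an isomorphism preserves them and sends far flags to far flags.
    to-top : ∀ x → ∃ λ x' → E'.f x' ≡ to (E.f x)
    to-top x with E'.cover (to (E.f x))
    ... | inj₁ found = found
    ... | inj₂ (x' , e) = ⊥-elim (<-irrefl refl (ℕₚ.<-trans up down))
      where
      down : E.d (M.A0 (E.f x)) < E.d (E.f x)
      down = ≤-reflexive (trans (sym (E.d-bot x)) (sym (E.d-top x)))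
      up : E.d (E.f x) < E.d (M.A0 (E.f x))
      up = ≤-reflexive (trans (cong suc (trans (same-d _) (cong E'.d (sym e)))) (trans (sym (E'.d-bot x')) (trans (sym (E'.d-top x'))
        (trans (cong E'.d (trans (sym (M'.i0 _)) (trans (cong M'.A0 e) (sym (pres0 _))))) (sym (same-d _))))))

    g : Fin n → Fin n'
    g x = proj₁ (to-top x)

    fg : ∀ x → E'.f (g x) ≡ to (E.f x)
    fg x = proj₂ (to-top x)

    fg0 : ∀ x → M'.A0 (E'.f (g x)) ≡ to (M.A0 (E.f x))
    fg0 x = trans (cong M'.A0 (fg x)) (sym (pres0 _))

    gν : ∀ x → g (D.ν x) ≡ D'.ν (g x)
    gν x = E'.f-inj (trans (fg _) (trans (cong to (sym (E.fν x))) (trans (pres2 _)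
      (trans (cong M'.A2 (sym (fg x))) (E'.fν (g x))))))

    glab : ∀ x → D'.lab (g x) ≡ D.lab x
    glab x = trans (sym (E'.d-top (g x))) (trans (cong E'.d (fg x)) (trans (sym (same-d _)) (E.d-top x)))

    grt : g D.rt ≡ D'.rt
    grt = E'.f-inj (invol-injective {f = M'.A0} M'.i0
      (trans (fg0 _) (trans (cong to E.f-rt) (trans presR (sym E'.f-rt)))))

    A1-top : ∀ x {y} → M.A1 (E.f x) ≡ y → M'.A1 (E'.f (g x)) ≡ to y
    A1-top x e = trans (cong M'.A1 (fg x)) (trans (sym (pres1 _)) (cong to e))

    A1-bot : ∀ x {y} → M.A1 (M.A0 (E.f x)) ≡ y → M'.A1 (M'.A0 (E'.f (g x))) ≡ to y
    A1-bot x e = trans (cong M'.A1 (fg0 x)) (trans (sym (pres1 _)) (cong to e))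

    tt-eq : ∀ {x z y} → y ≡ to (E.f x) → y ≡ E'.f z → g x ≡ z
    tt-eq e e' = E'.f-inj (trans (fg _) (trans (sym e) e'))
    bb-eq : ∀ {x z y} → y ≡ to (M.A0 (E.f x)) → y ≡ M'.A0 (E'.f z) → g x ≡ z
    bb-eq e e' = E'.f-inj (invol-injective {f = M'.A0} M'.i0 (trans (fg0 _) (trans (sym e) e')))
    tb : ∀ {x z y} → y ≡ to (E.f x) → y ≡ M'.A0 (E'.f z) → ⊥
    tb e e' = E'.disjoint (trans (fg _) (trans (sym e) e'))
    bt : ∀ {x z y} → y ≡ to (M.A0 (E.f x)) → y ≡ E'.f z → ⊥
    bt e e' = E'.disjoint (sym (trans (fg0 _) (trans (sym e) e')))

    -- The kind of a flag shows in whether `A1` leads from it, and from its near partner, to a far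
    -- or a near flag. Flags of different kinds therefore cannot correspond, and in equal kinds the
    -- same rules determine `α` and `β`.
    gαβ : ∀ x → g (D.α x) ≡ D'.α (g x) × g (D.β x) ≡ D'.β (g x)
    gαβ x with L.kind x | L'.kind (g x)
    ... | L.dn h | L'.dn h' = tt-eq (A1-top x (E.dnα h)) (E'.dnα h') , tt-eq (A1-bot x (E.dnβ h)) (E'.dnβ h')
    ... | L.flat h | L'.flat h' = tt-eq (A1-top x (E.flα h)) (E'.flα h') , bb-eq (A1-bot x (E.flβ h)) (E'.flβ h')
    ... | L.up h | L'.up h' = bb-eq (A1-bot x (E.upα h)) (E'.upα h') , bb-eq (A1-top x (E.upβ h)) (E'.upβ h')
    ... | L.dn h | L'.flat h' = ⊥-elim (tb (A1-bot x (E.dnβ h)) (E'.flβ h'))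
    ... | L.dn h | L'.up h' = ⊥-elim (tb (A1-bot x (E.dnβ h)) (E'.upα h'))
    ... | L.flat h | L'.dn h' = ⊥-elim (bt (A1-bot x (E.flβ h)) (E'.dnβ h'))
    ... | L.flat h | L'.up h' = ⊥-elim (tb (A1-top x (E.flα h)) (E'.upβ h'))
    ... | L.up h | L'.dn h' = ⊥-elim (bt (A1-top x (E.upβ h)) (E'.dnα h'))
    ... | L.up h | L'.flat h' = ⊥-elim (bt (A1-top x (E.upβ h)) (E'.flα h'))


module _ {q q' : Map} {n n'} {D : Str n} {D' : Str n'} (E : Enc q D) (E' : Enc q' D') where
  private
    module E = Enc E
    module E' = Enc E'

  map-iso⇒str-iso : q ≅ q' → Iso D D'
  map-iso⇒str-iso I = record
    { φ = record { to = T.g ; from = T'.g ; to-cong = cong T.g ; from-cong = cong T'.g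
                 ; inverse = (λ { refl → gg' _ }) , (λ { refl → g'g _ }) }
    ; φν = T.gν ; φα = λ x → proj₁ (T.gαβ x) ; φβ = λ x → proj₂ (T.gαβ x) ; φlab = T.glab ; φrt = T.grt }
    where
    module T = Transfer I E E'
    module T' = Transfer (≅-sym I) E' E
    g'g : ∀ x → T'.g (T.g x) ≡ x
    g'g x = E.f-inj (trans (T'.fg _) (trans (cong (Inverse.from (_≅_.φ I)) (T.fg x)) (Inverse.strictlyInverseʳ (_≅_.φ I) _)))
    gg' : ∀ x → T.g (T'.g x) ≡ x
    gg' x = E'.f-inj (trans (T.fg _) (trans (cong (Inverse.to (_≅_.φ I)) (T'.fg x)) (Inverse.strictlyInverseˡ (_≅_.φ I) _)))

  str-iso⇒map-iso : Iso D D' → q ≅ q'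
  str-iso⇒map-iso I = record
    { φ = record { to = X.ext ; from = X'.ext ; to-cong = cong X.ext ; from-cong = cong X'.ext
                 ; inverse = (λ { refl → xx' _ }) , (λ { refl → x'x _ }) }
    ; pres0 = F.by-cover _
        (λ x → trans (X.ext-bot x) (cong M'.A0 (sym (X.ext-top x))))
        (λ x → trans (cong X.ext (M.i0 _)) (trans (X.ext-top x) (trans (sym (M'.i0 _)) (cong M'.A0 (sym (X.ext-bot x))))))
    ; pres1 = F.by-cover _ p1-top p1-bot
    ; pres2 = F.by-cover _
        (λ x → trans (cong X.ext (E.fν x)) (trans (X.ext-top _) (trans (cong E'.f (I.φν x))
                 (trans (sym (E'.fν _)) (cong M'.A2 (sym (X.ext-top x)))))))
        (λ x → trans (cong X.ext (E.f0ν x)) (trans (X.ext-bot _) (trans (cong (M'.A0 ∘ E'.f) (I.φν x))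
                 (trans (sym (E'.f0ν _)) (cong M'.A2 (sym (X.ext-bot x)))))))
    ; presR = trans (cong X.ext (sym E.f-rt)) (trans (X.ext-bot _) (trans (cong (M'.A0 ∘ E'.f) I.φrt) E'.f-rt)) }
    where
    module I = Iso I
    module J = Iso (Iso-sym I)
    module IF = IsoFacts I
    module F = EncFacts E
    module F' = EncFacts E'
    module M = MapFacts q
    module M' = MapFacts q'
    module X = F.Ext (E'.f ∘ I.f) (M'.A0 ∘ E'.f ∘ I.f)
    module X' = F'.Ext (E.f ∘ J.f) (M.A0 ∘ E.f ∘ J.f)
    xx' : ∀ y → X.ext (X'.ext y) ≡ y
    xx' = F'.by-cover _
      (λ x → trans (cong X.ext (X'.ext-top x)) (trans (X.ext-top _) (cong E'.f (Inverse.strictlyInverseˡ I.φ x))))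
      (λ x → trans (cong X.ext (X'.ext-bot x)) (trans (X.ext-bot _) (cong (M'.A0 ∘ E'.f) (Inverse.strictlyInverseˡ I.φ x))))
    x'x : ∀ y → X'.ext (X.ext y) ≡ y
    x'x = F.by-cover _
      (λ x → trans (cong X'.ext (X.ext-top x)) (trans (X'.ext-top _) (cong E.f (Inverse.strictlyInverseʳ I.φ x))))
      (λ x → trans (cong X'.ext (X.ext-bot x)) (trans (X'.ext-bot _) (cong (M.A0 ∘ E.f) (Inverse.strictlyInverseʳ I.φ x))))
    flat' : ∀ {x} → F.Flat x → F'.Flat (I.f x)
    flat' = IF.flat'
    dn' : ∀ {x} → F.Dn x → F'.Dn (I.f x)
    dn' = IF.dn'
    up' : ∀ {x} → F.Up x → F'.Up (I.f x)
    up' = IF.up'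
    p1-top : ∀ x → X.ext (M.A1 (E.f x)) ≡ M'.A1 (X.ext (E.f x))
    p1-top x = trans (go (F.kind x)) (cong M'.A1 (sym (X.ext-top x)))
      where
      go : F.Kind x → X.ext (M.A1 (E.f x)) ≡ M'.A1 (E'.f (I.f x))
      go (F.flat h) = trans (cong X.ext (E.flα h)) (trans (X.ext-top _) (trans (cong E'.f (I.φα x)) (sym (E'.flα (flat' {x} h)))))
      go (F.dn h) = trans (cong X.ext (E.dnα h)) (trans (X.ext-top _) (trans (cong E'.f (I.φα x)) (sym (E'.dnα (dn' {x} h)))))
      go (F.up h) = trans (cong X.ext (E.upβ h)) (trans (X.ext-bot _) (trans (cong (M'.A0 ∘ E'.f) (I.φβ x)) (sym (E'.upβ (up' {x} h)))))
    p1-bot : ∀ x → X.ext (M.A1 (M.A0 (E.f x))) ≡ M'.A1 (X.ext (M.A0 (E.f x)))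
    p1-bot x = trans (go (F.kind x)) (cong M'.A1 (sym (X.ext-bot x)))
      where
      go : F.Kind x → X.ext (M.A1 (M.A0 (E.f x))) ≡ M'.A1 (M'.A0 (E'.f (I.f x)))
      go (F.flat h) = trans (cong X.ext (E.flβ h)) (trans (X.ext-bot _) (trans (cong (M'.A0 ∘ E'.f) (I.φβ x)) (sym (E'.flβ (flat' {x} h)))))
      go (F.dn h) = trans (cong X.ext (E.dnβ h)) (trans (X.ext-top _) (trans (cong E'.f (I.φβ x)) (sym (E'.dnβ (dn' {x} h)))))
      go (F.up h) = trans (cong X.ext (E.upα h)) (trans (X.ext-bot _) (trans (cong (M'.A0 ∘ E'.f) (I.φα x)) (sym (E'.upα (up' {x} h)))))

-- From a labelled structure back to a quadrangulation

module Decode {n} (D : Str n) (H : Levels.Hybrid D 1) where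
  open Str D
  open Levels D
  open Hybrid H

  private
    -- inj₁ x is the flag x itself, inj₂ x the other flag on the same side of its edge.
    S : Set
    S = Fin n ⊎ Fin n

    -- The rules of `Enc`, now taken as a definition of the three involutions.
    s0 s1 s2 : S → S
    s0 (inj₁ x) = inj₂ x
    s0 (inj₂ x) = inj₁ x
    s2 (inj₁ x) = inj₁ (ν x)
    s2 (inj₂ x) = inj₂ (ν x)
    s1 (inj₁ x) with kind x
    ... | up _   = inj₂ (β x)
    ... | flat _ = inj₁ (α x)
    ... | dn _   = inj₁ (α x)
    s1 (inj₂ x) with kind x
    ... | up _   = inj₂ (α x)
    ... | flat _ = inj₂ (β x)
    ... | dn _   = inj₁ (β x)

    top-flat : ∀ {x} → Flat x → s1 (inj₁ x) ≡ inj₁ (α x)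
    top-flat {x} h with kind x
    ... | up h'  = ⊥-elim (up⇒¬flat h' h)
    ... | flat _ = refl
    ... | dn _   = refl
    top-dn : ∀ {x} → Dn x → s1 (inj₁ x) ≡ inj₁ (α x)
    top-dn {x} h with kind x
    ... | up h'  = ⊥-elim (dn⇒¬up h h')
    ... | flat _ = refl
    ... | dn _   = refl
    top-up : ∀ {x} → Up x → s1 (inj₁ x) ≡ inj₂ (β x)
    top-up {x} h with kind x
    ... | up _    = refl
    ... | flat h' = ⊥-elim (up⇒¬flat h h')
    ... | dn h'   = ⊥-elim (dn⇒¬up h' h)
    bot-flat : ∀ {x} → Flat x → s1 (inj₂ x) ≡ inj₂ (β x)
    bot-flat {x} h with kind x
    ... | up h'  = ⊥-elim (up⇒¬flat h' h)
    ... | flat _ = refl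
    ... | dn h'  = ⊥-elim (dn⇒¬flat h' h)
    bot-dn : ∀ {x} → Dn x → s1 (inj₂ x) ≡ inj₁ (β x)
    bot-dn {x} h with kind x
    ... | up h'   = ⊥-elim (dn⇒¬up h h')
    ... | flat h' = ⊥-elim (dn⇒¬flat h h')
    ... | dn _    = refl
    bot-up : ∀ {x} → Up x → s1 (inj₂ x) ≡ inj₂ (α x)
    bot-up {x} h with kind x
    ... | up _    = refl
    ... | flat h' = ⊥-elim (up⇒¬flat h h')
    ... | dn h'   = ⊥-elim (dn⇒¬up h' h)

    inj₁-inj : ∀ {x y : Fin n} → _≡_ {A = S} (inj₁ x) (inj₁ y) → x ≡ y
    inj₁-inj refl = refl
    inj₂-inj : ∀ {x y : Fin n} → _≡_ {A = S} (inj₂ x) (inj₂ y) → x ≡ y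
    inj₂-inj refl = refl
    sides : ∀ {x y : Fin n} → _≢_ {A = S} (inj₁ x) (inj₂ y)
    sides ()

    s00 : ∀ x → s0 (s0 x) ≡ x
    s00 (inj₁ x) = refl
    s00 (inj₂ x) = refl
    s0≢ : ∀ x → s0 x ≢ x
    s0≢ (inj₁ x) ()
    s0≢ (inj₂ x) ()
    s22 : ∀ x → s2 (s2 x) ≡ x
    s22 (inj₁ x) = cong inj₁ (νν x)
    s22 (inj₂ x) = cong inj₂ (νν x)
    s2≢ : ∀ x → s2 x ≢ x
    s2≢ (inj₁ x) e = proj₂ (ν-inv x) (inj₁-inj e)
    s2≢ (inj₂ x) e = proj₂ (ν-inv x) (inj₂-inj e)
    s02 : ∀ x → s0 (s2 x) ≡ s2 (s0 x)
    s02 (inj₁ x) = refl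
    s02 (inj₂ x) = refl
    s02≢ : ∀ x → s0 (s2 x) ≢ x
    s02≢ (inj₁ x) ()
    s02≢ (inj₂ x) ()

    s11 : ∀ x → s1 (s1 x) ≡ x
    s11 (inj₁ x) with kind x
    ... | up h   = trans (bot-dn (dn-β h)) (cong inj₁ (ββ x))
    ... | flat h = trans (top-flat (flat-α h)) (cong inj₁ (αα x))
    ... | dn h   = trans (top-dn (dn-α h)) (cong inj₁ (αα x))
    s11 (inj₂ x) with kind x
    ... | up h   = trans (bot-up (up-α h)) (cong inj₂ (αα x))
    ... | flat h = trans (bot-flat (flat-β h)) (cong inj₂ (ββ x))
    ... | dn h   = trans (top-up (up-β h)) (cong inj₂ (ββ x))

    s1≢ : ∀ x → s1 x ≢ x
    s1≢ (inj₁ x) e with kind x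
    ... | up h   = sides (sym e)
    ... | flat h = proj₂ (α-inv x) (inj₁-inj e)
    ... | dn h   = proj₂ (α-inv x) (inj₁-inj e)
    s1≢ (inj₂ x) e with kind x
    ... | up h   = proj₂ (α-inv x) (inj₂-inj e)
    ... | flat h = proj₂ (β-inv x) (inj₂-inj e)
    ... | dn h   = sides e

    -- Two turns. They act by `α` and `β` in some order and, on steep flags, exchange far and near.
    -- Commutation makes `r2` an involution, and `free` keeps it from fixing a flat flag.
    r2 : S → S
    r2 x = s1 (s0 (s1 (s0 x)))

    r2-flat₁ : ∀ {x} → Flat x → r2 (inj₁ x) ≡ inj₁ (α (β x))
    r2-flat₁ h = trans (cong (s1 ∘ s0) (bot-flat h)) (top-flat (flat-β h))
    r2-flat₂ : ∀ {x} → Flat x → r2 (inj₂ x) ≡ inj₂ (β (α x))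
    r2-flat₂ h = trans (cong (s1 ∘ s0) (top-flat h)) (bot-flat (flat-α h))
    r2-dn₁ : ∀ {x} → Dn x → r2 (inj₁ x) ≡ inj₂ (α (β x))
    r2-dn₁ h = trans (cong (s1 ∘ s0) (bot-dn h)) (bot-up (up-β h))
    r2-dn₂ : ∀ {x} → Dn x → r2 (inj₂ x) ≡ inj₁ (β (α x))
    r2-dn₂ h = trans (cong (s1 ∘ s0) (top-dn h)) (bot-dn (dn-α h))
    r2-up₁ : ∀ {x} → Up x → r2 (inj₁ x) ≡ inj₂ (β (α x))
    r2-up₁ h = trans (cong (s1 ∘ s0) (bot-up h)) (top-up (up-α h))
    r2-up₂ : ∀ {x} → Up x → r2 (inj₂ x) ≡ inj₁ (α (β x))
    r2-up₂ h = trans (cong (s1 ∘ s0) (top-up h)) (top-dn (dn-β h))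

    βαβα : ∀ x → β (α (β (α x))) ≡ x
    βαβα x = trans (cong β (trans (cong α (comm x)) (αα _))) (ββ x)
    αβαβ : ∀ x → α (β (α (β x))) ≡ x
    αβαβ x = trans (cong α (trans (cong β (sym (comm x))) (ββ _))) (αα x)
    r4-top : ∀ {x} → Kind x → r2 (r2 (inj₁ x)) ≡ inj₁ x
    r4-top {x} (flat h) = trans (cong r2 (r2-flat₁ h)) (trans (r2-flat₁ (flat-α (flat-β h))) (cong inj₁ (αβαβ x)))
    r4-top {x} (dn h)   = trans (cong r2 (r2-dn₁ h)) (trans (r2-up₂ (up-α (up-β h))) (cong inj₁ (αβαβ x)))
    r4-top {x} (up h)   = trans (cong r2 (r2-up₁ h)) (trans (r2-dn₂ (dn-β (up-α h))) (cong inj₁ (βαβα x)))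

    r4-bot : ∀ {x} → Kind x → r2 (r2 (inj₂ x)) ≡ inj₂ x
    r4-bot {x} (flat h) = trans (cong r2 (r2-flat₂ h)) (trans (r2-flat₂ (flat-β (flat-α h))) (cong inj₂ (βαβα x)))
    r4-bot {x} (dn h)   = trans (cong r2 (r2-dn₂ h)) (trans (r2-up₁ (up-β (dn-α h))) (cong inj₂ (βαβα x)))
    r4-bot {x} (up h)   = trans (cong r2 (r2-up₂ h)) (trans (r2-dn₁ (dn-α (dn-β h))) (cong inj₂ (αβαβ x)))

    r4 : ∀ x → r2 (r2 x) ≡ x
    r4 (inj₁ x) = r4-top (kind x)
    r4 (inj₂ x) = r4-bot (kind x)

    r2≢-top : ∀ {x} → Kind x → r2 (inj₁ x) ≢ inj₁ x
    r2≢-top {x} (flat h) e = free x (trans (comm x) (inj₁-inj (trans (sym (r2-flat₁ h)) e)))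
    r2≢-top (dn h) e = sides (trans (sym e) (r2-dn₁ h))
    r2≢-top (up h) e = sides (trans (sym e) (r2-up₁ h))

    r2≢-bot : ∀ {x} → Kind x → r2 (inj₂ x) ≢ inj₂ x
    r2≢-bot {x} (flat h) e = free x (inj₂-inj (trans (sym (r2-flat₂ h)) e))
    r2≢-bot (dn h) e = sides (trans (sym (r2-dn₂ h)) e)
    r2≢-bot (up h) e = sides (trans (sym (r2-up₂ h)) e)

    r2≢ : ∀ x → r2 x ≢ x
    r2≢ (inj₁ x) = r2≢-top (kind x)
    r2≢ (inj₂ x) = r2≢-bot (kind x)

    dS : S → ℕ
    dS (inj₁ x) = lab x
    dS (inj₂ x) = ℕ.pred (lab x)

    lab-suc : ∀ x → lab x ≡ suc (ℕ.pred (lab x))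
    lab-suc x with lab x | lab-pos x
    ... | suc _ | _ = refl

    dS1 : ∀ x → dS (s1 x) ≡ dS x
    dS1 (inj₁ x) with kind x
    ... | up h   = cong ℕ.pred h
    ... | flat h = lab-α x
    ... | dn h   = lab-α x
    dS1 (inj₂ x) with kind x
    ... | up h   = cong ℕ.pred (lab-α x)
    ... | flat h = cong ℕ.pred h
    ... | dn h   = cong ℕ.pred (sym h)

    dS2 : ∀ x → dS (s2 x) ≡ dS x
    dS2 (inj₁ x) = lab-ν x
    dS2 (inj₂ x) = cong ℕ.pred (lab-ν x)

    dSlip : ∀ x → dS (s0 x) ≤ suc (dS x)
    dSlip (inj₁ x) = m≤n⇒m≤1+n (ℕₚ.pred[n]≤n {lab x})
    dSlip (inj₂ x) = ≤-reflexive (lab-suc x)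

    VS : S → S → Set
    VS = Reach (s1 ∷ s2 ∷ [])

    P-bot : ∀ {x y} → P x y → VS (inj₂ x) (inj₂ y)
    P-bot = Reach-map inj₂ ((λ y → done ▸ 2nd) ∷ mv ∷ [])
      where
      mv : ∀ y → VS (inj₂ y) (inj₂ (pc y))
      mv y = go (kind y)
        where
        go : Kind y → VS (inj₂ y) (inj₂ (pc y))
        go (flat h) = subst (VS _) (trans (bot-flat h) (cong inj₂ (sym (trans (pc-else (λ d → dn⇒¬flat d h)) (c-flat h))))) (done ▸ 1st)
        go (up h)   = subst (VS _) (trans (bot-up h) (cong inj₂ (sym (trans (pc-else (λ d → dn⇒¬up d h)) (c-steep (up⇒¬flat h)))))) (done ▸ 1st)
        go (dn h)   = Reach-≡ (cong inj₂ (sym (pc-dn h)))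

    low-bot : ∀ {x} → Reach (ν ∷ b 1 ∷ []) rt x → lab x ≡ 1 × VS (inj₂ rt) (inj₂ x)
    low-bot = Reach-fold (λ x → lab x ≡ 1 × VS (inj₂ rt) (inj₂ x))
      ( (λ y (e , r) → trans (lab-ν y) e , r ▸ 2nd)
      ∷ (λ y (e , r) → go y e r (kind y)) ∷ []) (lab-rt , done)
      where
      go : ∀ y → lab y ≡ 1 → VS (inj₂ rt) (inj₂ y) → Kind y → lab (b 1 y) ≡ 1 × VS (inj₂ rt) (inj₂ (b 1 y))
      go y e r (flat h) = trans (cong lab (b-keep (inj₁ h))) (trans h e)
        , subst (VS _) (trans (bot-flat h) (cong inj₂ (sym (b-keep (inj₁ h))))) (r ▸ 1st)
      go y e r (dn h) = ⊥-elim (<-irrefl (sym (trans (sym h) e)) (s≤s (lab-pos (β y))))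
      go y e r (up h) = trans (cong lab (b-cross ¬k)) (trans (lab-α y) e)
        , subst (VS _) (trans (bot-up h) (cong inj₂ (sym (b-cross ¬k)))) (r ▸ 1st)
        where
        ¬k : ¬ Keep 1 y
        ¬k (inj₁ f) = up⇒¬flat h f
        ¬k (inj₂ (_ , l)) = <⇒≱ (≤-reflexive (sym (up-lab h e))) l

    -- The contour of label 1 in `low` is a turn around one vertex, so only the root vertex has
    -- distance 0.
    dSzero : ∀ x → dS x ≡ 0 → VS (inj₂ rt) x
    dSzero (inj₁ x) e = ⊥-elim (<-irrefl (sym e) (lab-pos x))
    dSzero (inj₂ x) e = proj₂ (low-bot (low x (≤-reflexive (trans (lab-suc x) (cong suc e)))))

    -- The descending flag supplied by `high` lies at the same near vertex. Its corner there
    -- continues to a far flag whose edge leads to the smaller distance.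
    dSdesc : ∀ {k} x → dS x ≡ suc k → ∃ λ y → VS x y × dS (s0 y) ≡ k
    dSdesc (inj₁ x) e = inj₁ x , done , cong ℕ.pred e
    dSdesc {k} (inj₂ x) e = let t , h , p = high x (≤-trans (s≤s (s≤s z≤n)) (≤-reflexive (sym lx))) in
      inj₁ (β t) , subst (VS _) (bot-dn h) (P-bot p ▸ 1st)
      , cong ℕ.pred (ℕₚ.suc-injective (trans (sym h) (trans (P-lab p) lx)))
      where
      lx : lab x ≡ suc (suc k)
      lx = trans (lab-suc x) (cong suc e)

    All3 : S → S → Set
    All3 = Reach (s0 ∷ s1 ∷ s2 ∷ [])

    V⇒All : ∀ {x y} → VS x y → All3 x y
    V⇒All = Reach-map (λ x → x) ((λ _ → done ▸ 2nd) ∷ (λ _ → done ▸ 3rd) ∷ [])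

    s-inv : All Involutive (s0 ∷ s1 ∷ s2 ∷ [])
    s-inv = s00 ∷ s11 ∷ s22 ∷ []

    -- Connectedness comes from descending along `dSdesc` to the root vertex.
    reach-root : ∀ k x → dS x ≡ k → All3 (inj₂ rt) x
    reach-root zero x e = V⇒All (dSzero x e)
    reach-root (suc k) x e = let y , r , h = dSdesc x e in
      Reach-trans (reach-root k (s0 y) h) (Reach-trans (subst (All3 _) (s00 y) (done ▸ 1st)) (Reach-sym s-inv (V⇒All r)))

    σ : Fin (n ℕ.+ n) ↔ S
    σ = Finₚ.+↔⊎ {n} {n}
    to : Fin (n ℕ.+ n) → S
    to = Inverse.to σ
    from : S → Fin (n ℕ.+ n)
    from = Inverse.from σ
    to-from : ∀ x → to (from x) ≡ x
    to-from = Inverse.strictlyInverseˡ σ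
    from-to : ∀ x → from (to x) ≡ x
    from-to = Inverse.strictlyInverseʳ σ

    conj : (S → S) → Fin (n ℕ.+ n) → Fin (n ℕ.+ n)
    conj s x = from (s (to x))

    conj-conj : ∀ s t x → conj s (conj t x) ≡ from (s (t (to x)))
    conj-conj s t x = cong (from ∘ s) (to-from _)

    conj-inv : ∀ {s} → (∀ x → s (s x) ≡ x) → (∀ x → s x ≢ x) → Inv (conj s)
    conj-inv {s} h k x = trans (conj-conj s s x) (trans (cong from (h _)) (from-to x))
      , λ e → k (to x) (trans (sym (to-from _)) (cong to e))

    conj-from : ∀ s x → conj s (from x) ≡ from (s x)
    conj-from s x = cong (from ∘ s) (to-from x)

    All3-from : ∀ {x y} → All3 x y → Reach (conj s0 ∷ conj s1 ∷ conj s2 ∷ []) (from x) (from y)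
    All3-from = Reach-map from
      ( (λ y → Reach-trans (done ▸ 1st) (Reach-≡ (conj-from s0 y)))
      ∷ (λ y → Reach-trans (done ▸ 2nd) (Reach-≡ (conj-from s1 y)))
      ∷ (λ y → Reach-trans (done ▸ 3rd) (Reach-≡ (conj-from s2 y))) ∷ [])

    i0 : Inv (conj s0)
    i0 = conj-inv s00 s0≢
    i1 : Inv (conj s1)
    i1 = conj-inv s11 s1≢
    i2 : Inv (conj s2)
    i2 = conj-inv s22 s2≢

  quadrangulation : Map
  quadrangulation = record
    { m = n ℕ.+ n ; α0 = conj s0 ; α1 = conj s1 ; α2 = conj s2
    ; inv0 = i0 ; inv1 = i1 ; inv2 = i2
    ; comm02 = λ x → trans (conj-conj s0 s2 x) (trans (cong from (s02 (to x))) (sym (conj-conj s2 s0 x)))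
    ; free02 = λ x e → s02≢ (to x) (trans (sym (to-from _)) (cong to (trans (sym (conj-conj s0 s2 x)) e)))
    ; root = from (inj₂ rt)
    ; connected = λ x y → sameOrbit-complete _ ((λ x → proj₁ (i0 x)) ∷ (λ x → proj₁ (i1 x)) ∷ (λ x → proj₁ (i2 x)) ∷ [])
        (subst₂ (Reach _) (from-to x) (from-to y) (All3-from
          (Reach-trans (Reach-sym s-inv (reach-root _ (to x) refl)) (reach-root _ (to y) refl)))) }

  private
    module M = MapFacts quadrangulation

    VS-from : ∀ {x y} → VS x y → M.VReach (from x) (from y)
    VS-from = Reach-map from
      ( (λ y → Reach-trans (done ▸ 1st) (Reach-≡ (conj-from s1 y)))
      ∷ (λ y → Reach-trans (done ▸ 2nd) (Reach-≡ (conj-from s2 y))) ∷ [])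

    isDist : M.IsDist (dS ∘ to)
    isDist = record
      { d1 = λ x → trans (cong dS (to-from (s1 (to x)))) (dS1 (to x))
      ; d2 = λ x → trans (cong dS (to-from (s2 (to x)))) (dS2 (to x))
      ; dlip = λ x → ≤-trans (≤-reflexive (cong dS (to-from (s0 (to x))))) (dSlip (to x))
      ; droot = trans (cong dS (to-from (inj₂ rt))) (cong ℕ.pred lab-rt)
      ; dzero = λ x e → subst (M.VReach (root quadrangulation)) (from-to x) (VS-from (dSzero (to x) e))
      ; ddesc = λ x e → let y , r , h = dSdesc (to x) e in
          from y , subst (λ z → M.VReach z (from y)) (from-to x) (VS-from r)
          , trans (cong dS (to-from (s0 (to (from y))))) (trans (cong (dS ∘ s0) (to-from y)) h) }

  bipartite : Bipartite quadrangulation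
  bipartite = col ∘ to , λ x →
      trans (cong col (to-from (s1 (to x)))) (col1 (to x)) , trans (cong col (to-from (s2 (to x)))) (col2 (to x))
    , trans (cong col (to-from (s0 (to x)))) (col0 (to x))
    where
    col : S → Bool
    col x = even (dS x)
    col1 : ∀ x → col (s1 x) ≡ col x
    col1 x = cong even (dS1 x)
    col2 : ∀ x → col (s2 x) ≡ col x
    col2 x = cong even (dS2 x)
    col0 : ∀ x → col (s0 x) ≡ not (col x)
    col0 (inj₁ x) = trans (sym (𝔹ₚ.not-involutive _)) (cong not (cong even (sym (lab-suc x))))
    col0 (inj₂ x) = cong even (lab-suc x)

  square : M.Square
  square x = trans (turn2 (M.turn (M.turn x))) (trans (cong (from ∘ r2 ∘ to) (turn2 x)) (trans (cong (from ∘ r2) (to-from (r2 (to x)))) (trans (cong from (r4 (to x))) (from-to x))))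
    , λ e → r2≢ (to x) (trans (sym (to-from (r2 (to x)))) (cong to (trans (sym (turn2 x)) e)))
    where
    turn2 : ∀ x → M.turn (M.turn x) ≡ from (r2 (to x))
    turn2 x = trans (cong (conj s1 ∘ conj s0) (conj-conj s1 s0 x)) (trans (cong (conj s1) (conj-from s0 (s1 (s0 (to x))))) (conj-from s1 (s0 (s1 (s0 (to x))))))

  enc : Enc quadrangulation D
  enc = record
    { f = from ∘ inj₁
    ; f-inj = λ e → inj₁-inj (from-injective σ e)
    ; cover = λ y → cover (to y) (from-to y)
    ; d = dS ∘ to ; isD = isDist
    ; d-top = λ x → cong dS (to-from (inj₁ x))
    ; d-bot = λ x → trans (lab-suc x) (cong suc (sym (trans (cong (dS ∘ to) (conj-from s0 (inj₁ x))) (cong dS (to-from (inj₂ x))))))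
    ; f-rt = conj-from s0 (inj₁ rt)
    ; fν = λ x → conj-from s2 (inj₁ x)
    ; dnα = λ {x} h → trans (conj-from s1 (inj₁ x)) (cong from (top-dn h))
    ; dnβ = λ {x} h → trans (bot x) (cong from (bot-dn h))
    ; flα = λ {x} h → trans (conj-from s1 (inj₁ x)) (cong from (top-flat h))
    ; flβ = λ {x} h → trans (bot x) (trans (cong from (bot-flat h)) (sym (conj-from s0 (inj₁ (β x)))))
    ; upα = λ {x} h → trans (bot x) (trans (cong from (bot-up h)) (sym (conj-from s0 (inj₁ (α x))))) }
    where
    bot : ∀ x → conj s1 (conj s0 (from (inj₁ x))) ≡ from (s1 (inj₂ x))
    bot x = trans (cong (conj s1) (conj-from s0 (inj₁ x))) (conj-from s1 (inj₂ x))
    cover : ∀ {y} s → from s ≡ y → (∃ λ x → from (inj₁ x) ≡ y) ⊎ (∃ λ x → conj s0 (from (inj₁ x)) ≡ y)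
    cover (inj₁ x) e = inj₁ (x , e)
    cover (inj₂ x) e = inj₂ (x , trans (conj-from s0 (inj₁ x)) e)

  abstract
    decoding : ∃ λ q → Bipartite q × MapFacts.Square q × Enc q D
    decoding = quadrangulation , bipartite , square , enc

-- Unicellular maps as labelled structures

count-1-unique : ∀ {n} (p : Fin n → Bool) → count p ≡ 1 → ∀ {x y} → p x ≡ true → p y ≡ true → x ≡ y
count-1-unique p e {x} {y} hx hy = trans (sym (proj₂ (index p x hx))) (trans (cong (enum p) (unique e _ _)) (proj₂ (index p y hy)))
  where
  unique : ∀ {k} → k ≡ 1 → (i j : Fin k) → i ≡ j
  unique refl Fin.zero Fin.zero = refl

count-1 : ∀ {n} (p : Fin n → Bool) x → p x ≡ true → (∀ y → p y ≡ true → y ≡ x) → count p ≡ 1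
count-1 p x hx uniq = count-exact {k = 1} p (λ _ → x) (λ _ → hx) (λ { {Fin.zero} {Fin.zero} _ → refl }) (λ y hy → Fin.zero , sym (uniq y hy))

module Unicell (M : Map) where
  open MapFacts M

  FReach : Fin (m M) → Fin (m M) → Set
  FReach = Reach (fGens M)

  one-face : Unicellular M → ∀ x y → FReach x y
  one-face u x y = let a , ha , r = rep _ f-inv x
                       b , hb , s = rep _ f-inv y in
    Reach-trans r (Reach-trans (Reach-≡ (count-1-unique (isRep (fGens M)) u ha hb)) (Reach-sym f-inv s))

one-orbit : ∀ {n} (gs : List (Fin n → Fin n)) → All Involutive gs → ∀ x → (∀ y → Reach gs x y) → count (isRep gs) ≡ 1
one-orbit gs inv x all = let a , ha , _ = rep gs inv x in
  count-1 (isRep gs) a ha λ y hy → isRep-unique gs inv hy ha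
    (Reach-trans (Reach-sym inv (all y)) (all a))

-- Stated by equations so that it covers a map built from a structure as well as a unicellular map
-- given beforehand. With `N` bounding the labels, every flag is kept and `b N` is `β`.
record Carries (M : Map) (D : Str (m M)) (N : ℕ) : Set where
  field
    α0≡ : ∀ x → α0 M x ≡ Str.β D x
    α1≡ : ∀ x → α1 M x ≡ Str.ν D x
    α2≡ : ∀ x → α2 M x ≡ Str.α D x
    lab≤ : ∀ x → Str.lab D x ≤ N

  module M = MapFacts M
  open Str D
  open Levels D
  open Hybrids D

  keep : ∀ x → Keep N x
  keep x = inj₂ (lab≤ x , lab≤ (β x))

  VR⇒reach : ∀ {x y} → VR N x y → M.VReach x y
  VR⇒reach here = done
  VR⇒reach (by-ν r) = subst (M.VReach _) (α1≡ _) (VR⇒reach r ▸ 1st)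
  VR⇒reach (by-α _ r) = subst (M.VReach _) (α2≡ _) (VR⇒reach r ▸ 2nd)
  VR⇒reach (by-β {t} _ _ h _ _) = ⊥-elim (<⇒≱ h (lab≤ t))

  reach⇒VR : ∀ {x y} → M.VReach x y → VR N x y
  reach⇒VR {x} = Reach-fold (VR N x)
    ( (λ y v → subst (VR N x) (sym (α1≡ y)) (by-ν v))
    ∷ (λ y v → subst (VR N x) (sym (α2≡ y)) (by-α
        (λ (u , l) → <⇒≱ (≤-trans (s≤s l) (≤-reflexive (sym u))) (lab≤ (β y))) v)) ∷ []) here

  orient-to : Orientable M → ∃ (Orientation N)
  orient-to (s , O) = s , λ x → trans (cong s (sym (α1≡ x))) (proj₁ (proj₂ (O x)))
    , trans (cong s (sym (α2≡ x))) (proj₂ (proj₂ (O x)))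
    , (λ _ → trans (cong s (sym (α0≡ x))) (proj₁ (O x))) , λ k → ⊥-elim (k (keep x))

  orient-from : ∃ (Orientation N) → Orientable M
  orient-from (s , O) = s , λ x → trans (cong s (α0≡ x)) (proj₁ (proj₂ (proj₂ (O x))) (keep x))
    , trans (cong s (α1≡ x)) (proj₁ (O x)) , trans (cong s (α2≡ x)) (proj₁ (proj₂ (O x)))

  F⇒b : ∀ {x y} → Reach (fGens M) x y → Reach (ν ∷ b N ∷ []) x y
  F⇒b = Reach-map (λ x → x)
    ( (λ y → Reach-trans (done ▸ 2nd) (Reach-≡ (trans (b-keep (keep y)) (sym (α0≡ y)))))
    ∷ (λ y → Reach-trans (done ▸ 1st) (Reach-≡ (sym (α1≡ y)))) ∷ [])

  b⇒F : ∀ {x y} → Reach (ν ∷ b N ∷ []) x y → Reach (fGens M) x y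
  b⇒F = Reach-map (λ x → x)
    ( (λ y → Reach-trans (done ▸ 2nd) (Reach-≡ (α1≡ y)))
    ∷ (λ y → Reach-trans (done ▸ 1st) (Reach-≡ (trans (α0≡ y) (sym (b-keep (keep y)))))) ∷ [])

  -- The contour at a level above all labels is the orbit of `α1` and `α0`, that is a face; `high`
  -- is vacuous.
  hybrid-N : Unicellular M → Hybrid N
  hybrid-N u = record { low = λ x _ → F⇒b (Unicell.one-face M u rt x) ; high = λ x h → ⊥-elim (<⇒≱ h (lab≤ x)) }

  unicellular : Hybrid N → Unicellular M
  unicellular H = one-orbit (fGens M) M.f-inv rt λ y → b⇒F (Hybrid.low H y (lab≤ y))

-- Comparison of vertices, corners, orientability and Euler characteristic

module Compare {q : Map} {M : Map} {D : Str (m M)} {D' : Str (m M)} {N : ℕ}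
  (bip : Bipartite q) (sq : MapFacts.Square q) (E : Enc q D) (L : Link D D' 1 N) (C : Carries M D' N)
  (uni : Unicellular M) where

  private
    module E = EncFacts E
    module L = Link L
    module C = Carries C
    module M = MapFacts M
    module D' = Str D'

  f : Fin (m M) → Fin (m q)
  f = E.f

  lab≡ : ∀ x → D'.lab x ≡ E.lab x
  lab≡ = L.lab-eq

  -- Vertices of `M` are orbits at level `N` of `D'`. The chain of shifts identifies them with
  -- orbits at level 1 of `D`, which are the vertices of `q` seen from their far flags.
  pres : ∀ {x y} → M.VReach x y → E.VReach (f x) (f y)
  pres r = E.VR⇒reach (L.VR-from (C.reach⇒VR r))

  refl' : ∀ {x y} → E.VReach (f x) (f y) → M.VReach x y
  refl' r = C.VR⇒reach (L.VR-to (E.reach⇒VR r))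

  orient-q⇒M : Orientable q → Orientable M
  orient-q⇒M o = C.orient-from (let s , O = E.orient-to o in s , L.or-to O)

  orient-M⇒q : Orientable M → Orientable q
  orient-M⇒q o = E.orient-from (let s , O = C.orient-to o in s , L.or-from O)

  -- Every vertex other than the root vertex has a flag which is the far end of its edge.
  above : ∀ y → E.d y ≢ 0 → ∃ λ x → E.VReach y (f x)
  above y h with E.d y in e
  ... | zero = ⊥-elim (h refl)
  ... | suc k with E.ddesc y e
  ... | z , r , e' with E.cover z
  ... | inj₁ (x , refl) = x , r
  ... | inj₂ (x , refl) = ⊥-elim (<-irrefl refl (ℕₚ.<-trans below over))
    where
    below : E.d (f x) < E.d (E.A0 (f x))
    below = ≤-reflexive (trans (cong suc (trans (cong E.d (sym (E.i0 (f x)))) e')) (sym (trans (E.d-vertex r) e)))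
    over : E.d (E.A0 (f x)) < E.d (f x)
    over = ≤-reflexive (trans (sym (E.d-bot x)) (sym (E.d-top x)))

  module _ (p : Fin (m M) → Bool) (i : ℕ) (p-sound : ∀ {x} → p x ≡ true → D'.lab x ≡ suc i)
    (p-complete : ∀ {x} → D'.lab x ≡ suc i → p x ≡ true) where

    private
      d-lab : ∀ x → E.d (f x) ≡ D'.lab x
      d-lab x = trans (E.d-top x) (sym (lab≡ x))

      at : Fin (m q) → Bool
      at = atDist q (suc i)

      p-lab : ∀ {x y} → D'.lab y ≡ D'.lab x → p x ≡ p y
      p-lab e = bool-ext (λ h → p-complete (trans e (p-sound h))) (λ h → p-complete (trans (sym e) (p-sound h)))

    vertices-level : count (λ x → isRep (vGens M) x ∧ p x) ≡ layerSize q (suc i)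
    vertices-level = count-orbits (vGens M) (vGens q) M.v-inv E.v-inv p at
      (λ r → p-lab (trans (sym (d-lab _)) (trans (E.d-vertex (pres r)) (d-lab _))))
      (λ r → at-d (E.d-vertex r)) f
      (λ x h → E.atDist-complete (suc i) (trans (d-lab x) (p-sound h)))
      (λ _ → pres) (λ _ _ → refl')
      onto
      where
      at-d : ∀ {x y} → E.d y ≡ E.d x → at x ≡ at y
      at-d e = bool-ext (λ h → E.atDist-complete (suc i) (trans e (E.atDist-sound (suc i) h)))
                        (λ h → E.atDist-complete (suc i) (trans (sym e) (E.atDist-sound (suc i) h)))
      onto : ∀ y → at y ≡ true → ∃ λ x → p x ≡ true × E.VReach y (f x)
      onto y h with E.atDist-sound (suc i) h
      ... | e with above y (λ z → ℕₚ.1+n≢0 (trans (sym e) z))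
      ... | x , r = x , p-complete (trans (sym (d-lab x)) (trans (E.d-vertex r) e)) , r

    -- A corner of `M` consists of a flag and its image under `ν`. In `q` these are the two far
    -- flags of one edge, whose far end has the label of the corner.
    corners-level : count (λ x → isRep (cGens M) x ∧ p x) ≡ layerEdges q (suc i)
    corners-level = count-orbits (cGens M) (eGens q) M.c-inv E.e-inv p edge p-inv edge-inv f f-p
      (λ _ → c⇒e) (λ _ _ → e⇒c) onto
      where
      E-at : ℕ → Fin (m q) → Bool
      E-at k x = atDist q k x

      edge : Fin (m q) → Bool
      edge x = (E-at (suc i) x ∧ E-at i (α0 q x)) ∨ (E-at i x ∧ E-at (suc i) (α0 q x))

      ν-lab : ∀ x → D'.lab (α1 M x) ≡ D'.lab x
      ν-lab x = trans (cong D'.lab (C.α1≡ x)) (D'.lab-ν x)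

      p-inv : ∀ {x y} → Reach (cGens M) x y → p x ≡ p y
      p-inv r = p-lab (Reach-invariant D'.lab (ν-lab ∷ []) r)

      at-2 : ∀ k x → E-at k (α2 q x) ≡ E-at k x
      at-2 k x = bool-ext (λ h → E.atDist-complete k (trans (sym (E.d2 x)) (E.atDist-sound k h)))
                          (λ h → E.atDist-complete k (trans (E.d2 x) (E.atDist-sound k h)))

      edge-inv : ∀ {x y} → Reach (eGens q) x y → edge x ≡ edge y
      edge-inv r = sym (Reach-invariant edge (edge-0 ∷ edge-2 ∷ []) r)
        where
        edge-0 : ∀ y → edge (E.A0 y) ≡ edge y
        edge-0 y = trans (cong (λ z → (E-at (suc i) (E.A0 y) ∧ E-at i z) ∨ (E-at i (E.A0 y) ∧ E-at (suc i) z)) (E.i0 y))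
          (trans (𝔹ₚ.∨-comm _ (E-at i (E.A0 y) ∧ E-at (suc i) y))
            (cong₂ _∨_ (𝔹ₚ.∧-comm (E-at i (E.A0 y)) _) (𝔹ₚ.∧-comm (E-at (suc i) (E.A0 y)) _)))
        edge-2 : ∀ y → edge (E.A2 y) ≡ edge y
        edge-2 y = cong₂ _∨_ (cong₂ _∧_ (at-2 (suc i) y) (far i)) (cong₂ _∧_ (at-2 i y) (far (suc i)))
          where
          far : ∀ k → E-at k (E.A0 (E.A2 y)) ≡ E-at k (E.A0 y)
          far k = trans (cong (E-at k) (comm02 q y)) (at-2 k (E.A0 y))

      d0-lab : ∀ x → D'.lab x ≡ suc (E.d (E.A0 (f x)))
      d0-lab x = trans (lab≡ x) (E.d-bot x)

      f-p : ∀ x → p x ≡ true → edge (f x) ≡ true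
      f-p x h = ∨-introˡ (∧-intro (E.atDist-complete (suc i) (trans (d-lab x) (p-sound h)))
        (E.atDist-complete i (ℕₚ.suc-injective (trans (sym (d0-lab x)) (p-sound h)))))

      c⇒e : ∀ {x y} → Reach (cGens M) x y → Reach (eGens q) (f x) (f y)
      c⇒e = Reach-map f ((λ y → Reach-trans (done ▸ 2nd) (Reach-≡ (trans (E.fν y) (cong f (sym (trans (C.α1≡ y) (L.ν-eq y))))))) ∷ [])

      e⇒c : ∀ {x y} → Reach (eGens q) (f x) (f y) → Reach (cGens M) x y
      e⇒c {x} r = finish (Reach-fold St (st0 ∷ st2 ∷ []) (x , done , inj₁ refl) r)
        where
        St : Fin (m q) → Set
        St y = ∃ λ z → Reach (cGens M) x z × (y ≡ f z ⊎ y ≡ E.A0 (f z))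
        st0 : ∀ y → St y → St (E.A0 y)
        st0 y (z , s , inj₁ e) = z , s , inj₂ (cong E.A0 e)
        st0 y (z , s , inj₂ e) = z , s , inj₁ (trans (cong E.A0 e) (E.i0 _))
        νf : ∀ z → f (E.ν z) ≡ f (α1 M z)
        νf z = cong f (sym (trans (C.α1≡ z) (L.ν-eq z)))
        st2 : ∀ y → St y → St (E.A2 y)
        st2 y (z , s , inj₁ e) = α1 M z , s ▸ 1st , inj₁ (trans (cong E.A2 e) (trans (E.fν z) (νf z)))
        st2 y (z , s , inj₂ e) = α1 M z , s ▸ 1st , inj₂ (trans (cong E.A2 e) (trans (E.f0ν z) (cong E.A0 (νf z))))
        finish : ∀ {y} → St (f y) → Reach (cGens M) x y
        finish (z , s , inj₁ e) = subst (Reach (cGens M) x) (E.f-inj (sym e)) s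
        finish (z , s , inj₂ e) = ⊥-elim (E.disjoint e)

      edge-cases : ∀ {y} → edge y ≡ true → (E.d y ≡ suc i × E.d (E.A0 y) ≡ i) ⊎ (E.d y ≡ i × E.d (E.A0 y) ≡ suc i)
      edge-cases {y} h with ∨-elim {E-at (suc i) y ∧ E-at i (α0 q y)} h
      ... | inj₁ t = let a , b = ∧-elim {E-at (suc i) y} t in inj₁ (E.atDist-sound (suc i) a , E.atDist-sound i b)
      ... | inj₂ t = let a , b = ∧-elim {E-at i y} t in inj₂ (E.atDist-sound i a , E.atDist-sound (suc i) b)

      onto : ∀ y → edge y ≡ true → ∃ λ x → p x ≡ true × Reach (eGens q) y (f x)
      onto y h with E.cover y | edge-cases h
      ... | inj₁ (x , refl) | inj₁ (e , _) = x , p-complete (trans (sym (d-lab x)) e) , done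
      ... | inj₁ (x , refl) | inj₂ (e , e') = ⊥-elim (<-irrefl (trans (sym e) (trans (d-lab x) (trans (d0-lab x) (cong suc e')))) (m<n⇒m<1+n ≤-refl))
      ... | inj₂ (x , refl) | inj₂ (e , e') = x , p-complete (trans (d0-lab x) (cong suc e)) , subst (Reach _ _) (E.i0 (f x)) (done ▸ 1st)
      ... | inj₂ (x , refl) | inj₁ (e , e') = ⊥-elim (<-irrefl (trans (sym e') (trans (cong E.d (E.i0 (f x)))
              (trans (d-lab x) (trans (d0-lab x) (cong suc e))))) (m<n⇒m<1+n ≤-refl))

  -- Each side of an edge of `q` has one far and one near flag.
  size-q : m q ≡ m M ℕ.+ m M
  size-q = ≤-antisym
    (Finₚ.injective⇒≤ {f = from ∘ toS} λ e → toS-inj _ _ (from-injective (Finₚ.+↔⊎ {m M} {m M}) e))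
    (Finₚ.injective⇒≤ {f = fromS ∘ to} λ e → to-injective (Finₚ.+↔⊎ {m M} {m M}) (fromS-inj _ _ e))
    where
    to : Fin (m M ℕ.+ m M) → Fin (m M) ⊎ Fin (m M)
    to = Inverse.to (Finₚ.+↔⊎ {m M} {m M})
    from : Fin (m M) ⊎ Fin (m M) → Fin (m M ℕ.+ m M)
    from = Inverse.from (Finₚ.+↔⊎ {m M} {m M})
    fromS : Fin (m M) ⊎ Fin (m M) → Fin (m q)
    fromS (inj₁ x) = f x
    fromS (inj₂ x) = E.A0 (f x)
    fromS-inj : ∀ x y → fromS x ≡ fromS y → x ≡ y
    fromS-inj (inj₁ x) (inj₁ y) e = cong inj₁ (E.f-inj e)
    fromS-inj (inj₁ x) (inj₂ y) e = ⊥-elim (E.disjoint e)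
    fromS-inj (inj₂ x) (inj₁ y) e = ⊥-elim (E.disjoint (sym e))
    fromS-inj (inj₂ x) (inj₂ y) e = cong inj₂ (E.f-inj (invol-injective {f = E.A0} E.i0 e))
    back : ∀ y → ∃ λ s → fromS s ≡ y
    back y with E.cover y
    ... | inj₁ (x , e) = inj₁ x , e
    ... | inj₂ (x , e) = inj₂ x , e
    toS : Fin (m q) → Fin (m M) ⊎ Fin (m M)
    toS y = proj₁ (back y)
    toS-inj : ∀ x y → toS x ≡ toS y → x ≡ y
    toS-inj x y e = trans (sym (proj₂ (back x))) (trans (cong fromS e) (proj₂ (back y)))

  faces-edges : #F q ≡ #E M
  faces-edges = ℕₚ.*-cancelʳ-≡ (#F q) (#E M) 8 (begin
    #F q ℕ.* 8                ≡⟨ E.#F-square bip sq ⟩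
    m q                       ≡⟨ size-q ⟩
    m M ℕ.+ m M               ≡⟨ cong₂ ℕ._+_ M.#E-size M.#E-size ⟨
    #E M ℕ.* 4 ℕ.+ #E M ℕ.* 4 ≡⟨ ℕₚ.*-distribˡ-+ (#E M) 4 4 ⟨
    #E M ℕ.* 8                ∎)
    where open ≡-Reasoning

  edges-faces : #E q ≡ #F q ℕ.* 2
  edges-faces = ℕₚ.*-cancelʳ-≡ (#E q) (#F q ℕ.* 2) 4
    (trans E.#E-size (trans (sym (E.#F-square bip sq)) (sym (ℕₚ.*-assoc (#F q) 2 4))))

  -- All vertices of `q` except the root vertex have a far flag and so come from vertices of `M`.
  vertices : #V q ≡ suc (#V M)
  vertices = trans (count-split (isRep (vGens q)) far) (trans (ℕₚ.+-comm (count (λ x → isRep (vGens q) x ∧ far x)) _)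
    (cong₂ ℕ._+_ one (trans (sym others) (count-ext {q = isRep (vGens M)} λ x → 𝔹ₚ.∧-identityʳ _))))
    where
    far : Fin (m q) → Bool
    far x = not ⌊ E.d x ℕ.≟ 0 ⌋
    far-sound : ∀ {x} → far x ≡ true → E.d x ≢ 0
    far-sound {x} h e = true≢false (⌊⌋-complete {d = E.d x ℕ.≟ 0} e) (not-elim h)
    far-complete : ∀ {x} → E.d x ≢ 0 → far x ≡ true
    far-complete {x} h = not-intro (h ∘ ⌊⌋-sound {d = E.d x ℕ.≟ 0})
    others : count (λ x → isRep (vGens M) x ∧ true) ≡ count (λ x → isRep (vGens q) x ∧ far x)
    others = count-orbits (vGens M) (vGens q) M.v-inv E.v-inv (λ _ → true) far (λ _ → refl)
      (λ r → cong (λ n → not ⌊ n ℕ.≟ 0 ⌋) (sym (E.d-vertex r))) f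
      (λ x _ → far-complete λ e → ℕₚ.1+n≢0 (trans (sym (E.d-bot x)) (trans (sym (E.d-top x)) e)))
      (λ _ → pres) (λ _ _ → refl')
      (λ y h → let x , r = above y (far-sound h) in x , refl , r)
    one : count (λ x → isRep (vGens q) x ∧ not (far x)) ≡ 1
    one = let y , hy , r = rep (vGens q) E.v-inv (root q) in
      count-1 _ y (∧-intro hy (trans (𝔹ₚ.not-involutive _) (⌊⌋-complete {d = E.d y ℕ.≟ 0} (trans (E.d-vertex r) E.droot))))
        λ z hz → let a , c = ∧-elim {isRep (vGens q) z} hz in
          isRep-unique (vGens q) E.v-inv a hy (Reach-trans (Reach-sym E.v-inv
            (E.dzero z (⌊⌋-sound {d = E.d z ℕ.≟ 0} (trans (sym (𝔹ₚ.not-involutive _)) c)))) r)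

  -- With `n` faces, `q` has `2n` edges, which contribute `-n` together with the faces. In `M`, `n`
  -- edges and one face contribute `1 - n`, which makes up for the lost root vertex.
  euler-eq : euler q ≡ euler M
  euler-eq = begin
    (+ #V q - + #E q) ℤ.+ + #F q
      ≡⟨ cong₂ (λ v e → (+ v - + e) ℤ.+ + #F q) vertices edges-faces ⟩
    (+ suc (#V M) - + (#F q ℕ.* 2)) ℤ.+ + #F q
      ≡⟨ cong (λ e → (+ suc (#V M) - e) ℤ.+ + #F q) (ℤₚ.pos-* (#F q) 2) ⟩
    ((+ 1 ℤ.+ + #V M) - (+ #F q ℤ.* + 2)) ℤ.+ + #F q
      ≡⟨ arith (+ #V M) (+ #F q) ⟩
    (+ #V M - + #F q) ℤ.+ + 1
      ≡⟨ cong₂ (λ e k → (+ #V M - + e) ℤ.+ + k) faces-edges (sym uni) ⟩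
    (+ #V M - + #E M) ℤ.+ + #F M ∎
    where
    open ≡-Reasoning
    arith : ∀ v k → ((+ 1 ℤ.+ v) - (k ℤ.* + 2)) ℤ.+ k ≡ (v - k) ℤ.+ + 1
    arith = solve-∀

  surface-q⇒M : ∀ S → OnSurface q S → OnSurface M S
  surface-q⇒M (orientable g)    (o , e) = orient-q⇒M o , trans (sym euler-eq) e
  surface-q⇒M (nonorientable k) (o , e) = o ∘ orient-M⇒q , trans (sym euler-eq) e

  surface-M⇒q : ∀ S → OnSurface M S → OnSurface q S
  surface-M⇒q (orientable g)    (o , e) = orient-M⇒q o , trans euler-eq e
  surface-M⇒q (nonorientable k) (o , e) = o ∘ orient-q⇒M , trans euler-eq e

-- Passage between structures, maps and integer labels

diff≤1 : ∀ a b → a ≤ suc b → b ≤ suc a → ∣ + a - + b ∣ ≤ 1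
diff≤1 a b h k rewrite ℤₚ.m-n≡m⊖n a b with ℕₚ.≤-total a b
... | inj₁ a≤b = ≤-trans (≤-reflexive (ℤₚ.∣⊖∣-≤ a≤b)) (ℕₚ.m≤n+o⇒m∸n≤o b a (≤-trans k (≤-reflexive (ℕₚ.+-comm 1 a))))
... | inj₂ b≤a = ≤-trans (≤-reflexive (cong ∣_∣ (ℤₚ.⊖-≥ b≤a))) (ℕₚ.m≤n+o⇒m∸n≤o a b (≤-trans h (≤-reflexive (ℕₚ.+-comm 1 b))))

diff≤1⁻ : ∀ a b → ∣ + a - + b ∣ ≤ 1 → b ≤ suc a
diff≤1⁻ a b h rewrite ℤₚ.m-n≡m⊖n a b with ℕₚ.≤-total a b
... | inj₁ a≤b = ≤-trans (ℕₚ.m≤n+m∸n b a) (≤-trans (ℕₚ.+-monoʳ-≤ a (subst (_≤ 1) (ℤₚ.∣⊖∣-≤ a≤b) h)) (≤-reflexive (ℕₚ.+-comm a 1)))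
... | inj₂ b≤a = m≤n⇒m≤1+n b≤a

-- The contour of the last hybrid is its only face, which also makes it connected.

module ToMap {n} (D : Str n) (N : ℕ) (H : Levels.Hybrid D N) (lab≤ : ∀ x → Str.lab D x ≤ N) where
  open Str D
  open Levels D

  private
    face : ∀ {x y} → Reach (ν ∷ b N ∷ []) x y → Reach (β ∷ ν ∷ α ∷ []) x y
    face = Reach-map (λ x → x)
      ( (λ y → done ▸ 2nd)
      ∷ (λ y → Reach-trans (done ▸ 1st) (Reach-≡ (sym (b-keep (inj₂ (lab≤ y , lab≤ (β y))))))) ∷ [])

    inv : All Involutive (β ∷ ν ∷ α ∷ [])
    inv = ββ ∷ νν ∷ αα ∷ []

    from-rt : ∀ x → Reach (β ∷ ν ∷ α ∷ []) rt x
    from-rt x = face (Levels.Hybrid.low H x (lab≤ x))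

  toMap : Map
  toMap = record
    { m = n ; α0 = β ; α1 = ν ; α2 = α ; inv0 = β-inv ; inv1 = ν-inv ; inv2 = α-inv
    ; comm02 = comm ; free02 = free ; root = rt
    ; connected = λ x y → sameOrbit-complete _ inv (Reach-trans (Reach-sym inv (from-rt x)) (from-rt y)) }

  carries : Carries toMap D N
  carries = record { α0≡ = λ _ → refl ; α1≡ = λ _ → refl ; α2≡ = λ _ → refl ; lab≤ = lab≤ }

  uni : Unicellular toMap
  uni = Carries.unicellular carries H

module FromLabelled {S n} (u : WLUnicellular S n) where
  open WLUnicellular u

  private
    +∣∣ : ∀ x → + ∣ label x ∣ ≡ label x
    +∣∣ x = ℤₚ.0≤i⇒+∣i∣≡i (ℤₚ.≤-trans (ℤ.+≤+ z≤n) (labPos x))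

    step-lab : ∀ x → ∣ label (α0 map x) ∣ ≤ suc ∣ label x ∣
    step-lab x = diff≤1⁻ ∣ label x ∣ ∣ label (α0 map x) ∣
      (subst₂ (λ a b → ∣ a - b ∣ ≤ 1) (sym (+∣∣ x)) (sym (+∣∣ (α0 map x))) (labEdge x))

  structure : Str (m map)
  structure = record
    { ν = α1 map ; α = α2 map ; β = α0 map ; lab = λ x → ∣ label x ∣ ; rt = root map
    ; ν-inv = inv1 map ; α-inv = inv2 map ; β-inv = inv0 map ; comm = comm02 map ; free = free02 map
    ; lab-ν = λ x → cong ∣_∣ (labVert1 x) ; lab-α = λ x → cong ∣_∣ (labVert2 x)
    ; lab-β = step-lab
    ; lab-pos = λ x → ℤₚ.drop‿+≤+ (subst (+ 1 ℤ.≤_) (sym (+∣∣ x)) (labPos x))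
    ; lab-rt = cong ∣_∣ labRoot }

  label-lab : ∀ x → label x ≡ + Str.lab structure x
  label-lab x = sym (+∣∣ x)

  lab-bound : ∀ x → Str.lab structure x ≤ suc (m map)
  lab-bound x = subst (λ k → Str.lab structure x ≤ k ℕ.+ m map) (cong ∣_∣ labRoot)
    (rounds-bound (α0 map ∷ α1 map ∷ α2 map ∷ []) (λ x → ∣ label x ∣)
      ( (λ y → ≤-trans (≤-reflexive (cong (∣_∣ ∘ label) (sym (MapFacts.i0 map y)))) (step-lab (α0 map y)))
      ∷ (λ y → m≤n⇒m≤1+n (≤-reflexive (cong ∣_∣ (sym (labVert1 y)))))
      ∷ (λ y → m≤n⇒m≤1+n (≤-reflexive (cong ∣_∣ (sym (labVert2 y))))) ∷ [])
      (m map) (connected map (root map) x))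

-- The bijection and its inverse

module Bijection (S : Surface) (n : ℕ) where

  -- A quadrangulation with n faces has 8n flags, which bounds all distances and labels.
  k N : ℕ
  k = n ℕ.* 8
  N = suc k

  module Image (q : BipQuad S n) where
    open BipQuad q renaming (map to Q)
    private
      module M = MapFacts Q

      sq : M.Square
      sq = M.quad⇒square bip quad
      encoded : ∃ λ n → Σ (Str n) (Enc Q)
      encoded = Encode.encoding Q bip sq

    size : ℕ
    size = proj₁ encoded

    enc : Enc Q (proj₁ (proj₂ encoded))
    enc = proj₂ (proj₂ encoded)

    start : Hyb size 1
    start = hyb (proj₁ (proj₂ encoded)) (EncFacts.hybrid₁ enc)

    end : Hyb size N
    end = raise k start

    D : Str size
    D = Hyb.str end

    link : Link (Hyb.str start) D 1 N
    link = raise-link k start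

    lab≤ : ∀ x → Str.lab D x ≤ N
    lab≤ x = m≤n⇒m≤1+n (≤-trans (≤-reflexive (trans (Link.lab-eq link x) (sym (Enc.d-top enc x))))
      (≤-trans (M.IsDist.dist-bound (Enc.isD enc) (Enc.f enc x))
        (≤-reflexive (trans (sym (M.#F-square bip sq)) (cong (ℕ._* 8) nfaces)))))

    open Str D
    open Levels D
    open ToMap D N (Hyb.hybrid end) lab≤ public
    open Compare bip sq enc link carries uni public

    image : WLUnicellular S n
    image = record
      { map = toMap ; label = λ x → + lab x
      ; onS = surface-q⇒M S onS
      ; unicell = uni
      ; nedges = trans (sym faces-edges) nfaces
      ; labVert1 = λ x → cong +_ (lab-ν x) ; labVert2 = λ x → cong +_ (lab-α x)
      ; labRoot = cong +_ lab-rt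
      ; labEdge = λ x → diff≤1 (lab x) (lab (β x)) (≤-trans (≤-reflexive (cong lab (sym (ββ x)))) (lab-β (β x))) (lab-β x)
      ; labPos = λ x → ℤ.+≤+ (lab-pos x) }

    vertsLabel≡ : ∀ i → WLUnicellular.vertsLabel image (suc i) ≡ layerSize Q (suc i)
    vertsLabel≡ i = vertices-level (λ x → ⌊ + lab x ℤ.≟ + suc i ⌋) i
      (λ {x} h → ℤₚ.+-injective (⌊⌋-sound {d = + lab x ℤ.≟ + suc i} h))
      (λ {x} e → ⌊⌋-complete {d = + lab x ℤ.≟ + suc i} (cong +_ e))

    cornersLabel≡ : ∀ i → WLUnicellular.cornersLabel image (suc i) ≡ layerEdges Q (suc i)
    cornersLabel≡ i = corners-level (λ x → ⌊ + lab x ℤ.≟ + suc i ⌋) i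
      (λ {x} h → ℤₚ.+-injective (⌊⌋-sound {d = + lab x ℤ.≟ + suc i} h))
      (λ {x} e → ⌊⌋-complete {d = + lab x ℤ.≟ + suc i} (cong +_ e))

  open Image using (image)

  image-resp : (q q' : BipQuad S n) → q ≅Q q' → image q ≅L image q'
  image-resp q q' I = record { φ = φ ; pres0 = φβ ; pres1 = φν ; pres2 = φα ; presR = φrt }
                    , λ x → cong +_ (φlab x)
    where
    open Iso (raise-iso k (Image.start q) (Image.start q') (map-iso⇒str-iso (Image.enc q) (Image.enc q') I))

  -- Lowering respects isomorphisms and undoes raising, so the initial structures are isomorphic,
  -- and they determine their quadrangulations.
  image-inj : (q q' : BipQuad S n) → image q ≅L image q' → q ≅Q q'
  image-inj q q' (I , l) = str-iso⇒map-iso (Image.enc q) (Image.enc q')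
    (Iso-trans (Iso-sym (lowerTo-raise k (Image.start q)))
      (Iso-trans (lowerTo-iso k (Image.end q) (Image.end q') ends) (lowerTo-raise k (Image.start q'))))
    where
    open _≅_ I
    ends : Iso (Image.D q) (Image.D q')
    ends = record { φ = φ ; φν = pres1 ; φα = pres2 ; φβ = pres0 ; φlab = λ x → ℤₚ.+-injective (l x) ; φrt = presR }

  module Preimage (u : WLUnicellular S n) where
    open WLUnicellular u
    private
      module Fr = FromLabelled u

      lab≤ : ∀ x → Str.lab Fr.structure x ≤ N
      -- The `n` edges have `4n` flags, so labels are at most `1 + 4n`, and `4 ≤ 8` brings this
      -- below `N`.
      lab≤ x = ≤-trans (Fr.lab-bound x) (s≤s (≤-trans
        (≤-reflexive (trans (sym (MapFacts.#E-size map)) (cong (ℕ._* 4) nedges)))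
        (ℕₚ.*-monoʳ-≤ n (s≤s (s≤s (s≤s (s≤s (z≤n {4}))))))))

      carries : Carries map Fr.structure N
      carries = record { α0≡ = λ _ → refl ; α1≡ = λ _ → refl ; α2≡ = λ _ → refl ; lab≤ = lab≤ }

      end : Hyb (m map) N
      end = hyb Fr.structure (Carries.hybrid-N carries unicell)

      start : Hyb (m map) 1
      start = lowerTo k end

      decoded : ∃ λ q → Bipartite q × MapFacts.Square q × Enc q (Hyb.str start)
      decoded = Decode.decoding (Hyb.str start) (Hyb.hybrid start)

      Q : Map
      Q = proj₁ decoded
      bip : Bipartite Q
      bip = proj₁ (proj₂ decoded)
      sq : MapFacts.Square Q
      sq = proj₁ (proj₂ (proj₂ decoded))
      enc : Enc Q (Hyb.str start)
      enc = proj₂ (proj₂ (proj₂ decoded))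

      module Co = Compare bip sq enc (lowerTo-link k end) carries unicell

    preimage : BipQuad S n
    preimage = record
      { map = Q
      ; onS = Co.surface-M⇒q S onS
      ; quad = MapFacts.square⇒quad Q bip sq
      ; bip = bip
      ; nfaces = trans Co.faces-edges nedges }

    image-preimage : image preimage ≅L u
    image-preimage = record { φ = φ ; pres0 = φβ ; pres1 = φν ; pres2 = φα ; presR = φrt }
                   , λ x → trans (Fr.label-lab _) (cong +_ (φlab x))
      where
      open Iso (Iso-trans
        -- Encoding the decoded quadrangulation need not return `start` itself, but two encodings of
        -- the same map are isomorphic.
        (raise-iso k (Image.start preimage) start (map-iso⇒str-iso (Image.enc preimage) enc ≅-refl))
        (raise-lowerTo k end))

theorem3p1 : (S : Surface) (n : ℕ) → 1 ≤ n →
    Σ (BipQuad S n → WLUnicellular S n) λ Φ →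
    ((q q' : BipQuad S n) → q ≅Q q' → Φ q ≅L Φ q') ×
    ((q q' : BipQuad S n) → Φ q ≅L Φ q' → q ≅Q q') ×
    ((u : WLUnicellular S n) → Σ (BipQuad S n) λ q → Φ q ≅L u) ×
    ((q : BipQuad S n) (i : ℕ) → 1 ≤ i →
    (WLUnicellular.vertsLabel (Φ q) i ≡ layerSize (BipQuad.map q) i) ×
    (WLUnicellular.cornersLabel (Φ q) i ≡ layerEdges (BipQuad.map q) i))
theorem3p1 S n _ = Image.image , image-resp , image-inj , (λ u → Preimage.preimage u , Preimage.image-preimage u)
  , λ { q (suc i) _ → Image.vertsLabel≡ q i , Image.cornersLabel≡ q i }
  where open Bijection S n
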